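{- There is an algorithm that, given a semi-permutation instance $X$ of Min-Sat in reduced form and a partitioning tree $T$ for it, produces a feasible $T$-special solution for $X$ of cost at most $2|X|+2\,\mathrm{opt}(X)$, in time $|X|^{O(1)}\cdot c(X)^{O(c(X))}$.
   Context: Points have integer coordinates. Two points are collinear if they share an $x$- or $y$-coordinate; for non-collinear $p,q$, $\square_{p,q}$ is the smallest closed axis-parallel rectangle containing both; the pair is satisfied in $S$ if some $r\in S\setminus\{p,q\}$ lies in $\square_{p,q}$; $S$ is satisfied if all its non-collinear pairs are. A row (column) is active for $X$ if it contains a point of $X$; $c(X)$ is the number of active columns. $X$ is a semi-permutation if each active row contains exactly one point. Min-Sat: a feasible solution is $Y$ with $X\cup Y$ satisfied, cost $|Y|$, minimum $\mathrm{opt}(X)$. Writing $X=\{p_1,\dots,p_m\}$ with increasing $y$, $p_i$ is redundant if $p_{i-1}.x=p_i.x=p_{i+1}.x$; $X$ is in reduced form if no point is redundant. Partitioning tree: with $\mathcal L$ the vertical lines with half-integral $x$-coordinate strictly between the minimum and maximum $x$-coordinates of $X$, a partitioning tree is a rooted binary tree whose vertices $v$ carry closed vertical strips $S(v)$, the root carrying the bounding box of $X$, each internal vertex $v$ owning a line $L(v)\in\mathcal L$ strictly inside $S(v)$ with its two children carrying the two strips into which $L(v)$ splits $S(v)$, and each leaf strip containing exactly one active column. A solution $Y$ is $T$-special if every point of $Y$ lies on a row that is active for $X$ and on a vertical line that is a boundary of $S(v)$ for some $v\in V(T)$. -}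

module Defs where

open import Data.Bool.Base using (Bool; true; false; if_then_else_)
open import Data.Integer.Base as ℤ using (ℤ; +_)
open import Data.Integer.Divisibility using (_∣_)
open import Data.Integer.Properties as ℤ using ()
open import Data.List.Base using (List; []; _∷_; _++_; length; map; deduplicate)
open import Data.List.Membership.Propositional using (_∈_)
open import Data.List.Relation.Unary.All as All using (All; []; _∷_)
open import Data.List.Relation.Unary.Unique.Propositional using (Unique)
open import Data.Nat.Base as ℕ using (ℕ)
open import Data.Product.Base using (∃; ∃-syntax; _×_; _,_; proj₁; proj₂)
open import Data.Product using (∃!)
open import Data.Sum.Base using (_⊎_)
open import Relation.Binary.PropositionalEquality using (_≡_; _≢_)
open import Relation.Nullary using (¬_)
open import Relation.Nullary.Decidable using (⌊_⌋)

-- The first coordinate is measured in half-units, so that points on the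
-- half-integral lines of a partitioning tree are again points.  Hence
-- (x , y) denotes the point (x / 2 , y) of the plane.
Point : Set
Point = ℤ × ℤ

xc yc : Point → ℤ
xc = proj₁
yc = proj₂

IntegerPoint : Point → Set
IntegerPoint p = + 2 ∣ xc p

HalfIntegral : ℤ → Set
HalfIntegral x = ¬ (+ 2 ∣ x)

-- A finite set of points is a list without repetitions; its cardinality
-- is then its length.
PointList : Set
PointList = List Point

Collinear : Point → Point → Set
Collinear p q = (xc p ≡ xc q) ⊎ (yc p ≡ yc q)

_∈□[_,_] : Point → Point → Point → Set
r ∈□[ p , q ] =
  (xc p ℤ.⊓ xc q ℤ.≤ xc r × xc r ℤ.≤ xc p ℤ.⊔ xc q) ×
  (yc p ℤ.⊓ yc q ℤ.≤ yc r × yc r ℤ.≤ yc p ℤ.⊔ yc q)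

SatisfiedPair : PointList → Point → Point → Set
SatisfiedPair S p q = ∃[ r ] r ∈ S × r ≢ p × r ≢ q × r ∈□[ p , q ]

Satisfied : PointList → Set
Satisfied S = ∀ p q → p ∈ S → q ∈ S → ¬ Collinear p q → SatisfiedPair S p q

ActiveRow : PointList → ℤ → Set
ActiveRow X y = ∃[ p ] p ∈ X × yc p ≡ y

ActiveColumn : PointList → ℤ → Set
ActiveColumn X x = ∃[ p ] p ∈ X × xc p ≡ x

#columns : PointList → ℕ
#columns X = length (deduplicate ℤ._≟_ (map xc X))

SemiPermutation : PointList → Set
SemiPermutation X = ∀ y → ActiveRow X y → ∃! _≡_ (λ p → p ∈ X × yc p ≡ y)

-- q is the point that follows p when X is listed by increasing y.
Successor : PointList → Point → Point → Set
Successor X p q =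
  p ∈ X × q ∈ X × yc p ℤ.< yc q ×
  (∀ r → r ∈ X → ¬ (yc p ℤ.< yc r × yc r ℤ.< yc q))

Redundant : PointList → Point → Set
Redundant X p = ∃[ q ] ∃[ r ]
  Successor X q p × Successor X p r × xc q ≡ xc p × xc p ≡ xc r

ReducedForm : PointList → Set
ReducedForm X = ∀ p → p ∈ X → ¬ Redundant X p

Feasible : PointList → PointList → Set
Feasible X Y = Unique Y × Satisfied (X ++ Y)

-- There is at most one such n, namely opt(X).
IsOpt : PointList → ℕ → Set
IsOpt X n =
  (∃[ Y ] Feasible X Y × length Y ≡ n) ×
  (∀ Y → Feasible X Y → n ℕ.≤ length Y)

-- An internal vertex stores the abscissa (in half-units) of its line
-- L(v); the strips S(v) are determined by these and by the root strip.
data Tree : Set where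
  leaf : Tree
  node : (ℓ : ℤ) (left right : Tree) → Tree

-- ℓ ∈ 𝓛: strictly between the least and the greatest abscissa of X.
SplittingLine : PointList → ℤ → Set
SplittingLine X ℓ =
  HalfIntegral ℓ ×
  (∃[ p ] p ∈ X × xc p ℤ.< ℓ) ×
  (∃[ q ] q ∈ X × ℓ ℤ.< xc q)

-- T is a valid tree of subdivisions of the closed strip [ lo , hi ].
data Partitions (X : PointList) (lo hi : ℤ) : Tree → Set where
  leaf : ∃! _≡_ (λ x → ActiveColumn X x × lo ℤ.≤ x × x ℤ.≤ hi) →
         Partitions X lo hi leaf
  node : ∀ {ℓ l r} → SplittingLine X ℓ → lo ℤ.< ℓ → ℓ ℤ.< hi →
         Partitions X lo ℓ l → Partitions X ℓ hi r →
         Partitions X lo hi (node ℓ l r)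

BoundingStrip : PointList → ℤ → ℤ → Set
BoundingStrip X lo hi =
  ActiveColumn X lo × ActiveColumn X hi ×
  (∀ p → p ∈ X → lo ℤ.≤ xc p × xc p ℤ.≤ hi)

PartitioningTree : PointList → (lo hi : ℤ) → Tree → Set
PartitioningTree X lo hi T = BoundingStrip X lo hi × Partitions X lo hi T

-- Strip lo hi T a b: if S(root of T) = [ lo , hi ], then S(v) = [ a , b ]
-- for some vertex v of T.
data Strip (lo hi : ℤ) : Tree → ℤ → ℤ → Set where
  here  : ∀ {T} → Strip lo hi T lo hi
  left  : ∀ {ℓ l r a b} → Strip lo ℓ l a b → Strip lo hi (node ℓ l r) a b
  right : ∀ {ℓ l r a b} → Strip ℓ hi r a b → Strip lo hi (node ℓ l r) a b

BoundaryLine : (lo hi : ℤ) → Tree → ℤ → Set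
BoundaryLine lo hi T x = ∃[ a ] ∃[ b ] Strip lo hi T a b × (x ≡ a ⊎ x ≡ b)

Special : PointList → (lo hi : ℤ) → Tree → PointList → Set
Special X lo hi T Y =
  ∀ p → p ∈ Y → ActiveRow X (yc p) × BoundaryLine lo hi T (xc p)

-- An algorithm is a single program, independent of the input, of a
-- call-by-value functional language.  Evaluating any construct, once,
-- costs one step on top of the evaluation of its parts, and a fold costs
-- one further step per constructor traversed.  Building a closure costs
-- one step; its body is charged at every application.  Integers are
-- atomic and only addition, subtraction and comparison are available, as
-- on the unit-cost RAM without multiplication.  Every program terminates;
-- this is no restriction for time bounds such as polynomials and
-- c ^ O(c), since a machine can be simulated for a precomputed number of
-- steps.

infixr 7 _⊗_
infixr 6 _⇒_

data Ty : Set where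
  int bool tree : Ty
  list          : Ty → Ty
  _⊗_ _⇒_       : Ty → Ty → Ty

Ctx : Set
Ctx = List Ty

infixl 5 _·_

data Tm (Γ : Ctx) : Ty → Set where
  var      : ∀ {A} → A ∈ Γ → Tm Γ A
  ƛ        : ∀ {A B} → Tm (A ∷ Γ) B → Tm Γ (A ⇒ B)
  _·_      : ∀ {A B} → Tm Γ (A ⇒ B) → Tm Γ A → Tm Γ B
  lit      : ℤ → Tm Γ int
  add sub  : Tm Γ int → Tm Γ int → Tm Γ int
  leq      : Tm Γ int → Tm Γ int → Tm Γ bool
  tt ff    : Tm Γ bool
  ite      : ∀ {A} → Tm Γ bool → Tm Γ A → Tm Γ A → Tm Γ A
  pair     : ∀ {A B} → Tm Γ A → Tm Γ B → Tm Γ (A ⊗ B)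
  fst      : ∀ {A B} → Tm Γ (A ⊗ B) → Tm Γ A
  snd      : ∀ {A B} → Tm Γ (A ⊗ B) → Tm Γ B
  nil      : ∀ {A} → Tm Γ (list A)
  cons     : ∀ {A} → Tm Γ A → Tm Γ (list A) → Tm Γ (list A)
  caseList : ∀ {A B} → Tm Γ (list A) →
             Tm Γ B → Tm (A ∷ list A ∷ Γ) B → Tm Γ B
  -- In the step, variable 0 is the head and variable 1 the result for
  -- the tail.
  foldList : ∀ {A B} → Tm Γ (list A) →
             Tm Γ B → Tm (A ∷ B ∷ Γ) B → Tm Γ B
  -- In the step, variable 0 is the label and variables 1 and 2 are the
  -- results for the left and right subtrees.
  foldTree : ∀ {B} → Tm Γ tree →
             Tm Γ B → Tm (int ∷ B ∷ B ∷ Γ) B → Tm Γ B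

-- A value together with the number of steps taken to compute it.
Timed : Set → Set
Timed A = A × ℕ

return : ∀ {A} → A → Timed A
return a = a , 0

infixl 1 _>>=_
_>>=_ : ∀ {A B} → Timed A → (A → Timed B) → Timed B
(a , m) >>= f = proj₁ (f a) , m ℕ.+ proj₂ (f a)

step : ∀ {A} → Timed A → Timed A
step (a , m) = a , ℕ.suc m

Val : Ty → Set
Val int      = ℤ
Val bool     = Bool
Val tree     = Tree
Val (list A) = List (Val A)
Val (A ⊗ B)  = Val A × Val B
Val (A ⇒ B)  = Val A → Timed (Val B)

Env : Ctx → Set
Env = All Val

foldListᵗ : ∀ {A B : Set} → (A → B → Timed B) → B → List A → Timed B
foldListᵗ f b []       = step (return b)
foldListᵗ f b (a ∷ as) = step (foldListᵗ f b as >>= f a)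

foldTreeᵗ : ∀ {B : Set} → (ℤ → B → B → Timed B) → B → Tree → Timed B
foldTreeᵗ f b leaf         = step (return b)
foldTreeᵗ f b (node ℓ l r) =
  step (foldTreeᵗ f b l >>= λ u → foldTreeᵗ f b r >>= λ v → f ℓ u v)

eval : ∀ {Γ A} → Tm Γ A → Env Γ → Timed (Val A)
eval (var i)          ρ = step (return (All.lookup ρ i))
eval (ƛ t)            ρ = step (return (λ a → eval t (a ∷ ρ)))
eval (t · u)          ρ = step (eval t ρ >>= λ f → eval u ρ >>= f)
eval (lit n)          ρ = step (return n)
eval (add t u)        ρ = step (eval t ρ >>= λ m → eval u ρ >>= λ n → return (m ℤ.+ n))
eval (sub t u)        ρ = step (eval t ρ >>= λ m → eval u ρ >>= λ n → return (m ℤ.- n))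
eval (leq t u)        ρ = step (eval t ρ >>= λ m → eval u ρ >>= λ n → return ⌊ m ℤ.≤? n ⌋)
eval tt               ρ = step (return true)
eval ff               ρ = step (return false)
eval (ite t u v)      ρ = step (eval t ρ >>= λ b → if b then eval u ρ else eval v ρ)
eval (pair t u)       ρ = step (eval t ρ >>= λ a → eval u ρ >>= λ b → return (a , b))
eval (fst t)          ρ = step (eval t ρ >>= λ p → return (proj₁ p))
eval (snd t)          ρ = step (eval t ρ >>= λ p → return (proj₂ p))
eval nil              ρ = step (return [])
eval (cons t u)       ρ = step (eval t ρ >>= λ a → eval u ρ >>= λ as → return (a ∷ as))
eval (caseList t u v) ρ = step (eval t ρ >>= λ
  { []       → eval u ρ
  ; (a ∷ as) → eval v (a ∷ as ∷ ρ) })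
eval (foldList t u v) ρ = step (eval t ρ >>= λ as → eval u ρ >>= λ b →
  foldListᵗ (λ a b → eval v (a ∷ b ∷ ρ)) b as)
eval (foldTree t u v) ρ = step (eval t ρ >>= λ T → eval u ρ >>= λ b →
  foldTreeᵗ (λ ℓ l r → eval v (ℓ ∷ l ∷ r ∷ ρ)) b T)

Algorithm : Ty → Ty → Set
Algorithm A B = Tm (A ∷ []) B

run : ∀ {A B} → Algorithm A B → Val A → Timed (Val B)
run t a = eval t (a ∷ [])

output : ∀ {A B} → Algorithm A B → Val A → Val B
output t a = proj₁ (run t a)

time : ∀ {A B} → Algorithm A B → Val A → ℕ
time t a = proj₂ (run t a)

point : Ty
point = int ⊗ int

{-# OPTIONS --safe #-}
-- Let S = X ∪ Y be satisfied.  Moving every point to the left line of its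
-- leaf strip and to the closest active row below it is a monotone map, and
-- monotone images of satisfied sets are satisfied; copying each image point
-- to both boundaries of its strip then gives a special solution of cost at
-- most 2 |S|.  Hence it suffices to find a smallest satisfied superset of
-- the image of X in the grid of leaf strips and active rows.  Row by row,
-- whether a set of strips may be touched depends only on the relative order
-- of the last touches of the strips, so there are c ^ O(c) states and
-- dynamic programming over the rows applies.
--
-- The program is written in a first-order fragment of the language, for
-- which the time is at most N ^ d if no list longer than N is traversed,
-- where d depends on the program only.
module Submission where

open import Data.Bool.Base using (Bool; true; false; if_then_else_)
open import Data.Bool.Properties as Bool using ()
open import Data.Empty using (⊥-elim)
open import Data.Integer.Base as ℤ using (ℤ; +_)
open import Data.Integer.Divisibility using (_∣_)
open import Data.Integer.Properties as ℤ using ()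
open import Data.List.Base using (List; []; _∷_; _++_; length; foldr; map; deduplicate; cartesianProductWith; filter)
open import Data.List.Membership.DecPropositional using (_∈?_)
open import Data.List.Membership.Propositional using (_∈_)
open import Data.List.Membership.Propositional.Properties using (∈-map⁺; ∈-map⁻; ∈-++⁺ˡ; ∈-++⁺ʳ; ∈-++⁻; ∈-∃++; ∈-deduplicate⁺; ∈-cartesianProductWith⁺; ∈-cartesianProductWith⁻; ∈-filter⁺; ∈-filter⁻; ∈-length)
open import Data.List.Properties using (length-map; length-++; foldr-++; ++-assoc; ++-identityʳ; map-++; map-is-foldr; map-∘; map-cong-local)
open import Data.List.Relation.Binary.Permutation.Propositional using (_↭_; ↭-refl; ↭-trans; ↭-swap; ↭-prep; ↭-sym; ↭⇒↭ₛ)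
import Data.List.Relation.Binary.Permutation.Propositional.Properties as ↭
open import Data.List.Relation.Binary.Permutation.Propositional.Properties using (∈-resp-↭; All-resp-↭; ↭-length; drop-∷)
import Data.List.Relation.Binary.Permutation.Setoid.Properties as ↭ₛ
open import Data.List.Relation.Binary.Pointwise as Pointwise using (Pointwise; []; _∷_)
open import Data.List.Relation.Unary.All as All using ([]; _∷_; All)
open import Data.List.Relation.Unary.AllPairs as AllPairs using (AllPairs; []; _∷_)
import Data.List.Relation.Unary.AllPairs.Properties as AllPairs
open import Data.List.Relation.Unary.Any using (here; there)
open import Data.List.Relation.Unary.Unique.Propositional using (Unique)
import Data.List.Relation.Unary.Unique.Propositional.Properties as Unique
open import Data.Nat.Base as ℕ using (ℕ; zero; suc; _+_; _*_; _^_; _≤_; _⊔_; z≤n; s≤s)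
open import Data.Nat.Properties
open import Data.Nat.Solver using (module +-*-Solver)
open import Data.Product.Base using (_×_; _,_; proj₁; proj₂; ∃-syntax; Σ-syntax)
open import Data.Product.Properties using (≡-dec)
open import Data.Sum.Base using (_⊎_; inj₁; inj₂; [_,_]′)
open import Data.Unit.Base using (⊤)
open import Function.Base using (_∘_)
open import Relation.Binary.Definitions using (tri<; tri≈; tri>; DecidableEquality)
open import Relation.Binary.PropositionalEquality hiding (J)
open import Relation.Nullary using (¬_; yes; no)
open import Relation.Nullary.Decidable using (⌊_⌋)
open import Relation.Nullary.Reflects using (Reflects; ofʸ; ofⁿ)
open import Defs

-- First-order programs

-- The points of `X` are not moved in the solution; the copies on both boundaries make this
-- harmless. A point inside a strip has, on the side facing any other strip, a boundary point in its
-- own row, and two points of `X` inside one strip share its only active column. Only a pair on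
-- facing boundaries has to use the satisfaction of the image. The bound 2|X| + 2 opt(X) arises
-- because the images of `X` are copied as well as those of `Y`. A new row need only be checked
-- against one older point per strip: the last touch of a column lies in the rectangle spanned by a
-- new point and any earlier point of that column. Validity only compares levels, so they can be
-- replaced by ranks after every row; ranks from 0 to c + 1 suffice, which gives (c + 2)^c states.

data Expr (Γ : Ctx) : Ty → Set where
  var      : ∀ {A} → A ∈ Γ → Expr Γ A
  bind     : ∀ {A B} → Expr Γ A → Expr (A ∷ Γ) B → Expr Γ B
  lit      : ℤ → Expr Γ int
  add      : Expr Γ int → Expr Γ int → Expr Γ int
  leq      : Expr Γ int → Expr Γ int → Expr Γ bool
  tt ff    : Expr Γ bool
  ite      : ∀ {A} → Expr Γ bool → Expr Γ A → Expr Γ A → Expr Γ A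
  pair     : ∀ {A B} → Expr Γ A → Expr Γ B → Expr Γ (A ⊗ B)
  fst      : ∀ {A B} → Expr Γ (A ⊗ B) → Expr Γ A
  snd      : ∀ {A B} → Expr Γ (A ⊗ B) → Expr Γ B
  nil      : ∀ {A} → Expr Γ (list A)
  cons     : ∀ {A} → Expr Γ A → Expr Γ (list A) → Expr Γ (list A)
  caseList : ∀ {A B} → Expr Γ (list A) →
             Expr Γ B → Expr (A ∷ list A ∷ Γ) B → Expr Γ B
  foldList : ∀ {A B} → Expr Γ (list A) →
             Expr Γ B → Expr (A ∷ B ∷ Γ) B → Expr Γ B
  foldTree : ∀ {B} → Expr Γ tree →
             Expr Γ B → Expr (int ∷ B ∷ B ∷ Γ) B → Expr Γ B

compile : ∀ {Γ A} → Expr Γ A → Tm Γ A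
compile (var i)          = var i
compile (bind t u)       = ƛ (compile u) · compile t
compile (lit n)          = lit n
compile (add t u)        = add (compile t) (compile u)
compile (leq t u)        = leq (compile t) (compile u)
compile tt               = tt
compile ff               = ff
compile (ite t u v)      = ite (compile t) (compile u) (compile v)
compile (pair t u)       = pair (compile t) (compile u)
compile (fst t)          = fst (compile t)
compile (snd t)          = snd (compile t)
compile nil              = nil
compile (cons t u)       = cons (compile t) (compile u)
compile (caseList t u v) = caseList (compile t) (compile u) (compile v)
compile (foldList t u v) = foldList (compile t) (compile u) (compile v)
compile (foldTree t u v) = foldTree (compile t) (compile u) (compile v)

caseList′ : ∀ {A B : Set} → List A → B → (A → List A → B) → B
caseList′ []       b f = b
caseList′ (a ∷ as) b f = f a as

foldTree′ : ∀ {B : Set} → (ℤ → B → B → B) → B → Tree → B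
foldTree′ f b leaf         = b
foldTree′ f b (node ℓ l r) = f ℓ (foldTree′ f b l) (foldTree′ f b r)

⟦_⟧ : ∀ {Γ A} → Expr Γ A → Env Γ → Val A
⟦ var i ⟧          ρ = All.lookup ρ i
⟦ bind t u ⟧       ρ = ⟦ u ⟧ (⟦ t ⟧ ρ ∷ ρ)
⟦ lit n ⟧          ρ = n
⟦ add t u ⟧        ρ = ⟦ t ⟧ ρ ℤ.+ ⟦ u ⟧ ρ
⟦ leq t u ⟧        ρ = ⌊ ⟦ t ⟧ ρ ℤ.≤? ⟦ u ⟧ ρ ⌋
⟦ tt ⟧             ρ = true
⟦ ff ⟧             ρ = false
⟦ ite t u v ⟧      ρ = if ⟦ t ⟧ ρ then ⟦ u ⟧ ρ else ⟦ v ⟧ ρ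
⟦ pair t u ⟧       ρ = ⟦ t ⟧ ρ , ⟦ u ⟧ ρ
⟦ fst t ⟧          ρ = proj₁ (⟦ t ⟧ ρ)
⟦ snd t ⟧          ρ = proj₂ (⟦ t ⟧ ρ)
⟦ nil ⟧            ρ = []
⟦ cons t u ⟧       ρ = ⟦ t ⟧ ρ ∷ ⟦ u ⟧ ρ
⟦ caseList t u v ⟧ ρ = caseList′ (⟦ t ⟧ ρ) (⟦ u ⟧ ρ) (λ a as → ⟦ v ⟧ (a ∷ as ∷ ρ))
⟦ foldList t u v ⟧ ρ = foldr (λ a b → ⟦ v ⟧ (a ∷ b ∷ ρ)) (⟦ u ⟧ ρ) (⟦ t ⟧ ρ)
⟦ foldTree t u v ⟧ ρ = foldTree′ (λ ℓ l r → ⟦ v ⟧ (ℓ ∷ l ∷ r ∷ ρ)) (⟦ u ⟧ ρ) (⟦ t ⟧ ρ)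

-- Sizes of traversed data and the exponent of the time bound

#nodes : Tree → ℕ
#nodes leaf         = 0
#nodes (node ℓ l r) = suc (#nodes l + #nodes r)

OnTree : ∀ {B : Set} → (ℤ → B → B → Set) → (ℤ → B → B → B) → B → Tree → Set
OnTree Q g b leaf         = ⊤
OnTree Q g b (node ℓ l r) =
  OnTree Q g b l × OnTree Q g b r × Q ℓ (foldTree′ g b l) (foldTree′ g b r)

-- Every list or tree that the evaluation traverses has size at most N.
-- For a fold this is asked of the accumulators that really occur.
Small : ∀ {Γ A} → ℕ → Expr Γ A → Env Γ → Set
Small N (var i)          ρ = ⊤
Small N (bind t u)       ρ = Small N t ρ × Small N u (⟦ t ⟧ ρ ∷ ρ)
Small N (lit n)          ρ = ⊤
Small N (add t u)        ρ = Small N t ρ × Small N u ρ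
Small N (leq t u)        ρ = Small N t ρ × Small N u ρ
Small N tt               ρ = ⊤
Small N ff               ρ = ⊤
Small N (ite t u v)      ρ = Small N t ρ × Small N u ρ × Small N v ρ
Small N (pair t u)       ρ = Small N t ρ × Small N u ρ
Small N (fst t)          ρ = Small N t ρ
Small N (snd t)          ρ = Small N t ρ
Small N nil              ρ = ⊤
Small N (cons t u)       ρ = Small N t ρ × Small N u ρ
Small N (caseList t u v) ρ =
  Small N t ρ × Small N u ρ ×
  (∀ a as → ⟦ t ⟧ ρ ≡ a ∷ as → Small N v (a ∷ as ∷ ρ))
Small N (foldList t u v) ρ =
  Small N t ρ × Small N u ρ × length (⟦ t ⟧ ρ) ≤ N ×
  (∀ zs a as → ⟦ t ⟧ ρ ≡ zs ++ a ∷ as →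
    Small N v (a ∷ foldr (λ a b → ⟦ v ⟧ (a ∷ b ∷ ρ)) (⟦ u ⟧ ρ) as ∷ ρ))
Small N (foldTree t u v) ρ =
  Small N t ρ × Small N u ρ × #nodes (⟦ t ⟧ ρ) ≤ N ×
  OnTree (λ ℓ l r → Small N v (ℓ ∷ l ∷ r ∷ ρ)) (λ ℓ l r → ⟦ v ⟧ (ℓ ∷ l ∷ r ∷ ρ)) (⟦ u ⟧ ρ) (⟦ t ⟧ ρ)

-- A construct multiplies the bound for its parts by at most `N`, a fold by at most the square of
-- `N`. The exponent is read off the syntax alone, so it is a constant of the algorithm.
degree : ∀ {Γ A} → Expr Γ A → ℕ
degree (var i)          = 0
degree (bind t u)       = 1 + (degree t ⊔ degree u)
degree (lit n)          = 0
degree (add t u)        = 1 + (degree t ⊔ degree u)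
degree (leq t u)        = 1 + (degree t ⊔ degree u)
degree tt               = 0
degree ff               = 0
degree (ite t u v)      = 1 + (degree t ⊔ (degree u ⊔ degree v))
degree (pair t u)       = 1 + (degree t ⊔ degree u)
degree (fst t)          = 1 + degree t
degree (snd t)          = 1 + degree t
degree nil              = 0
degree (cons t u)       = 1 + (degree t ⊔ degree u)
degree (caseList t u v) = 1 + (degree t ⊔ (degree u ⊔ degree v))
degree (foldList t u v) = 2 + (degree t ⊔ (degree u ⊔ degree v))
degree (foldTree t u v) = 2 + (degree t ⊔ (degree u ⊔ degree v))

foldListᵗ-value : ∀ {A B : Set} (f : A → B → Timed B) (g : A → B → B) b as →
  (∀ a b → proj₁ (f a b) ≡ g a b) → proj₁ (foldListᵗ f b as) ≡ foldr g b as
foldListᵗ-value f g b []       eq = refl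
foldListᵗ-value f g b (a ∷ as) eq =
  trans (eq a _) (cong (g a) (foldListᵗ-value f g b as eq))

foldTreeᵗ-value : ∀ {B : Set} (f : ℤ → B → B → Timed B) (g : ℤ → B → B → B) b T →
  (∀ ℓ u v → proj₁ (f ℓ u v) ≡ g ℓ u v) → proj₁ (foldTreeᵗ f b T) ≡ foldTree′ g b T
foldTreeᵗ-value f g b leaf         eq = refl
foldTreeᵗ-value f g b (node ℓ l r) eq =
  trans (eq ℓ _ _) (cong₂ (g ℓ) (foldTreeᵗ-value f g b l eq) (foldTreeᵗ-value f g b r eq))

compile-value : ∀ {Γ A} (t : Expr Γ A) (ρ : Env Γ) → proj₁ (eval (compile t) ρ) ≡ ⟦ t ⟧ ρ
compile-value (var i)    ρ = refl
compile-value (bind t u) ρ =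
  trans (compile-value u _) (cong (λ v → ⟦ u ⟧ (v ∷ ρ)) (compile-value t ρ))
compile-value (lit n)    ρ = refl
compile-value (add t u)  ρ = cong₂ ℤ._+_ (compile-value t ρ) (compile-value u ρ)
compile-value (leq t u)  ρ =
  cong₂ (λ m n → ⌊ m ℤ.≤? n ⌋) (compile-value t ρ) (compile-value u ρ)
compile-value tt         ρ = refl
compile-value ff         ρ = refl
compile-value (ite t u v) ρ
  with proj₁ (eval (compile t) ρ) | ⟦ t ⟧ ρ | compile-value t ρ
... | true  | true  | refl = compile-value u ρ
... | false | false | refl = compile-value v ρ
compile-value (pair t u) ρ = cong₂ _,_ (compile-value t ρ) (compile-value u ρ)
compile-value (fst t)    ρ = cong proj₁ (compile-value t ρ)
compile-value (snd t)    ρ = cong proj₂ (compile-value t ρ)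
compile-value nil        ρ = refl
compile-value (cons t u) ρ = cong₂ _∷_ (compile-value t ρ) (compile-value u ρ)
compile-value (caseList t u v) ρ
  with proj₁ (eval (compile t) ρ) | ⟦ t ⟧ ρ | compile-value t ρ
... | []     | []     | refl = compile-value u ρ
... | a ∷ as | .a ∷ .as | refl = compile-value v (a ∷ as ∷ ρ)
compile-value (foldList t u v) ρ =
  trans (foldListᵗ-value _ _ _ (proj₁ (eval (compile t) ρ)) (λ a b → compile-value v (a ∷ b ∷ ρ)))
        (cong₂ (foldr (λ a b → ⟦ v ⟧ (a ∷ b ∷ ρ))) (compile-value u ρ) (compile-value t ρ))
compile-value (foldTree t u v) ρ =
  trans (foldTreeᵗ-value _ _ _ (proj₁ (eval (compile t) ρ)) (λ ℓ l r → compile-value v (ℓ ∷ l ∷ r ∷ ρ)))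
        (cong₂ (foldTree′ (λ ℓ l r → ⟦ v ⟧ (ℓ ∷ l ∷ r ∷ ρ))) (compile-value u ρ) (compile-value t ρ))

-- The step is bounded only at the accumulators that suffixes of the list produce. A uniform bound
-- over all accumulators would fail for a step that itself traverses its accumulator.
foldListᵗ-time : ∀ {A B : Set} (f : A → B → Timed B) (g : A → B → B) b k as →
  (∀ a b → proj₁ (f a b) ≡ g a b) →
  (∀ zs a as′ → as ≡ zs ++ a ∷ as′ → proj₂ (f a (foldr g b as′)) ≤ k) →
  proj₂ (foldListᵗ f b as) ≤ 1 + length as * (1 + k)
foldListᵗ-time f g b k []       eq le = ≤-refl
foldListᵗ-time f g b k (a ∷ as) eq le = s≤s (begin
  proj₂ (foldListᵗ f b as) + proj₂ (f a (proj₁ (foldListᵗ f b as)))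
    ≤⟨ +-mono-≤ (foldListᵗ-time f g b k as eq (λ zs x xs e → le (a ∷ zs) x xs (cong (a ∷_) e)))
                (≤-trans (≤-reflexive (cong (λ z → proj₂ (f a z)) (foldListᵗ-value f g b as eq)))
                         (le [] a as refl)) ⟩
  1 + length as * (1 + k) + k ≡⟨ cong suc (+-comm (length as * (1 + k)) k) ⟩
  1 + k + length as * (1 + k) ∎)
  where open ≤-Reasoning

OnTree-map : ∀ {B : Set} {Q Q′ : ℤ → B → B → Set} {g b} T →
  (∀ ℓ u v → Q ℓ u v → Q′ ℓ u v) → OnTree Q g b T → OnTree Q′ g b T
OnTree-map leaf         f _           = _
OnTree-map (node ℓ l r) f (p , q , s) = OnTree-map l f p , OnTree-map r f q , f ℓ _ _ s

foldTreeᵗ-time : ∀ {B : Set} (f : ℤ → B → B → Timed B) (g : ℤ → B → B → B) b k T →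
  (∀ ℓ u v → proj₁ (f ℓ u v) ≡ g ℓ u v) → OnTree (λ ℓ u v → proj₂ (f ℓ u v) ≤ k) g b T →
  proj₂ (foldTreeᵗ f b T) ≤ 1 + #nodes T * (2 + k)
foldTreeᵗ-time f g b k leaf         eq _              = ≤-refl
foldTreeᵗ-time f g b k (node ℓ l r) eq (le , le′ , le″) = s≤s (begin
  proj₂ (foldTreeᵗ f b l) + (proj₂ (foldTreeᵗ f b r) + proj₂ (f ℓ _ _))
    ≤⟨ +-mono-≤ (foldTreeᵗ-time f g b k l eq le) (+-mono-≤ (foldTreeᵗ-time f g b k r eq le′)
         (≤-trans (≤-reflexive (cong₂ (λ u v → proj₂ (f ℓ u v)) (foldTreeᵗ-value f g b l eq)
                                                                (foldTreeᵗ-value f g b r eq))) le″)) ⟩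
  1 + m * (2 + k) + (1 + n * (2 + k) + k)
    ≡⟨ solve 3 (λ m n k → con 1 :+ m :* (con 2 :+ k) :+ (con 1 :+ n :* (con 2 :+ k) :+ k) :=
                          con 2 :+ k :+ (m :+ n) :* (con 2 :+ k)) refl m n k ⟩
  2 + k + (m + n) * (2 + k) ∎)
  where
    open ≤-Reasoning
    open +-*-Solver
    m = #nodes l
    n = #nodes r

module _ {N : ℕ} (4≤N : 4 ≤ N) where

  private instance
    N≢0 : ℕ.NonZero N
    N≢0 = ℕ.>-nonZero (≤-trans (s≤s z≤n) 4≤N)

  1≤power : ∀ d → 1 ≤ N ^ d
  1≤power d = m^n>0 N d

  power-mono : ∀ {d e} → d ≤ e → N ^ d ≤ N ^ e
  power-mono = ^-monoʳ-≤ N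

  -- Three parts and one step make four summands, each at most `N ^ D`; this is the origin of the
  -- requirement `4 ≤ N`.
  straight-line : ∀ {a b c} d e f → a ≤ N ^ d → b ≤ N ^ e → c ≤ N ^ f →
    suc (a + (b + c)) ≤ N ^ (1 + (d ⊔ (e ⊔ f)))
  straight-line {a} {b} {c} d e f p q r = begin
    suc (a + (b + c))   ≤⟨ +-mono-≤ (1≤power D) (+-mono-≤ (≤-trans p (power-mono (m≤m⊔n d _)))
                           (+-mono-≤ (≤-trans q (power-mono (≤-trans (m≤m⊔n e f) (m≤n⊔m d _))))
                                     (≤-trans r (power-mono (≤-trans (m≤n⊔m e f) (m≤n⊔m d _)))))) ⟩
    M + (M + (M + M))   ≡⟨ cong (λ z → M + (M + (M + z))) (sym (+-identityʳ M)) ⟩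
    4 * M               ≤⟨ *-monoˡ-≤ M 4≤N ⟩
    N ^ (1 + D)         ∎
    where
      open ≤-Reasoning
      D = d ⊔ (e ⊔ f)
      M = N ^ D

  straight-line₂ : ∀ {a b} d e → a ≤ N ^ d → b ≤ N ^ e → suc (a + (b + 0)) ≤ N ^ (1 + (d ⊔ e))
  straight-line₂ d e p q =
    subst (λ z → _ ≤ N ^ (1 + (d ⊔ z))) (⊔-identityʳ e) (straight-line d e 0 p q z≤n)

  straight-line₁ : ∀ {a} d → a ≤ N ^ d → suc (a + 0) ≤ N ^ (1 + d)
  straight-line₁ d p = subst (λ z → _ ≤ N ^ (1 + z)) (⊔-identityʳ d) (straight-line₂ d 0 p z≤n)

  -- One factor `N` counts the iterations. The other absorbs the constants, once every summand is
  -- bounded by a multiple of `N ^ D` or of `N * N ^ D`.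
  traversal : ∀ {a b c n k} d e f → a ≤ N ^ d → b ≤ N ^ e → k ≤ N ^ f → n ≤ N →
    c ≤ 1 + n * (2 + k) → suc (a + (b + c)) ≤ N ^ (2 + (d ⊔ (e ⊔ f)))
  traversal {a} {b} {c} {n} {k} d e f p q r s le = begin
    suc (a + (b + c))
      ≤⟨ s≤s (+-mono-≤ (≤-trans p (power-mono (m≤m⊔n d _)))
             (+-mono-≤ (≤-trans q (power-mono (≤-trans (m≤m⊔n e f) (m≤n⊔m d _))))
                       (≤-trans le (s≤s (*-mono-≤ s (+-monoʳ-≤ 2 (≤-trans r (power-mono (≤-trans (m≤n⊔m e f) (m≤n⊔m d _)))))))))) ⟩
    suc (M + (M + (1 + N * (2 + M))))
      ≤⟨ s≤s (+-monoʳ-≤ M (+-monoʳ-≤ M (+-mono-≤ (1≤power D) (*-monoʳ-≤ N (+-monoˡ-≤ M (*-monoʳ-≤ 2 (1≤power D))))))) ⟩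
    suc (M + (M + (M + N * (2 * M + M))))
      ≤⟨ +-monoˡ-≤ (M + (M + (M + N * (2 * M + M)))) (1≤power D) ⟩
    M + (M + (M + (M + N * (2 * M + M))))
      ≡⟨ solve 2 (λ N M → M :+ (M :+ (M :+ (M :+ N :* (con 2 :* M :+ M)))) :=
                          con 4 :* M :+ N :* (con 3 :* M)) refl N M ⟩
    4 * M + N * (3 * M)
      ≤⟨ +-monoˡ-≤ (N * (3 * M)) (*-monoˡ-≤ M 4≤N) ⟩
    N * M + N * (3 * M)
      ≡⟨ solve 2 (λ N M → N :* M :+ N :* (con 3 :* M) := N :* (con 4 :* M)) refl N M ⟩
    N * (4 * M)
      ≤⟨ *-monoʳ-≤ N (*-monoˡ-≤ M 4≤N) ⟩
    N ^ (2 + D) ∎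
    where
      open ≤-Reasoning
      open +-*-Solver
      D = d ⊔ (e ⊔ f)
      M = N ^ D

  compile-time : ∀ {Γ A} (t : Expr Γ A) (ρ : Env Γ) → Small N t ρ →
                 proj₂ (eval (compile t) ρ) ≤ N ^ degree t
  compile-time (var i)    ρ s = ≤-refl
  compile-time (bind t u) ρ (s , s′) =
    -- The function part is an abstraction: building its closure is a single step, hence the
    -- exponent 0.
    straight-line 0 (degree t) (degree u) ≤-refl (compile-time t ρ s)
      (subst (λ v → proj₂ (eval (compile u) (v ∷ ρ)) ≤ _) (sym (compile-value t ρ)) (compile-time u _ s′))
  compile-time (lit n)    ρ s = ≤-refl
  compile-time (add t u)  ρ (s , s′) =
    straight-line₂ (degree t) (degree u) (compile-time t ρ s) (compile-time u ρ s′)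
  compile-time (leq t u)  ρ (s , s′) =
    straight-line₂ (degree t) (degree u) (compile-time t ρ s) (compile-time u ρ s′)
  compile-time tt         ρ s = ≤-refl
  compile-time ff         ρ s = ≤-refl
  compile-time (ite t u v) ρ (s , s′ , s″) =
    -- Only one branch runs; charging both avoids a case distinction on the test.
    ≤-trans (s≤s (+-monoʳ-≤ (proj₂ (eval (compile t) ρ)) (branch (proj₁ (eval (compile t) ρ)))))
      (straight-line (degree t) (degree u) (degree v)
        (compile-time t ρ s) (compile-time u ρ s′) (compile-time v ρ s″))
    where
    branch : ∀ b → proj₂ (if b then eval (compile u) ρ else eval (compile v) ρ) ≤
                   proj₂ (eval (compile u) ρ) + proj₂ (eval (compile v) ρ)
    branch true  = m≤m+n _ _
    branch false = m≤n+m _ _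
  compile-time (pair t u) ρ (s , s′) =
    straight-line₂ (degree t) (degree u) (compile-time t ρ s) (compile-time u ρ s′)
  compile-time (fst t)    ρ s = straight-line₁ (degree t) (compile-time t ρ s)
  compile-time (snd t)    ρ s = straight-line₁ (degree t) (compile-time t ρ s)
  compile-time nil        ρ s = ≤-refl
  compile-time (cons t u) ρ (s , s′) =
    straight-line₂ (degree t) (degree u) (compile-time t ρ s) (compile-time u ρ s′)
  compile-time (caseList t u v) ρ (s , s′ , s″)
    with proj₁ (eval (compile t) ρ) | ⟦ t ⟧ ρ | compile-value t ρ
  ... | []     | []     | refl =
    ≤-trans (s≤s (+-monoʳ-≤ (proj₂ (eval (compile t) ρ)) (m≤m+n _ 0)))
      (straight-line (degree t) (degree u) (degree v) (compile-time t ρ s) (compile-time u ρ s′) z≤n)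
  ... | a ∷ as | .a ∷ .as | refl =
    straight-line (degree t) (degree u) (degree v) (compile-time t ρ s) z≤n
      (compile-time v _ (s″ a as refl))
  compile-time (foldList t u v) ρ (s , s′ , n≤N , s″)
    with proj₁ (eval (compile t) ρ) | ⟦ t ⟧ ρ | compile-value t ρ
       | proj₁ (eval (compile u) ρ) | ⟦ u ⟧ ρ | compile-value u ρ
  ... | as | .as | refl | b | .b | refl =
    traversal (degree t) (degree u) (degree v) (compile-time t ρ s) (compile-time u ρ s′) ≤-refl n≤N
      (≤-trans (foldListᵗ-time _ _ b (N ^ degree v) as (λ a b → compile-value v (a ∷ b ∷ ρ))
                 (λ zs a as′ eq → compile-time v _ (s″ zs a as′ eq)))
               (s≤s (*-monoʳ-≤ (length as) (n≤1+n _))))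
  compile-time (foldTree t u v) ρ (s , s′ , n≤N , s″)
    with proj₁ (eval (compile t) ρ) | ⟦ t ⟧ ρ | compile-value t ρ
       | proj₁ (eval (compile u) ρ) | ⟦ u ⟧ ρ | compile-value u ρ
  ... | T | .T | refl | b | .b | refl =
    traversal (degree t) (degree u) (degree v) (compile-time t ρ s) (compile-time u ρ s′) ≤-refl n≤N
      (foldTreeᵗ-time _ _ b (N ^ degree v) T (λ ℓ l r → compile-value v (ℓ ∷ l ∷ r ∷ ρ))
        (OnTree-map T (λ ℓ l r → compile-time v (ℓ ∷ l ∷ r ∷ ρ)) s″))

  time-bound : ∀ {A B} (t : Expr (A ∷ []) B) a → Small N t (a ∷ []) →
               time (compile t) a ≤ N ^ degree t
  time-bound t a = compile-time t (a ∷ [])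

output-value : ∀ {A B} (t : Expr (A ∷ []) B) a → output (compile t) a ≡ ⟦ t ⟧ (a ∷ [])
output-value t a = compile-value t (a ∷ [])

-- The dynamic program

-- A cell is a leaf strip (a , b) together with the rank of the last row
-- touching it: 0 if there is none, otherwise larger for later rows.
Cell : Set
Cell = Point × ℤ

State : Set
State = List Cell

Table : Set
Table = List (State × List Point)

lft rgt lvl : Cell → ℤ
lft g = proj₁ (proj₁ g)
rgt g = proj₂ (proj₁ g)
lvl g = proj₂ g

infix 5 _≤ᵇ_ _≡ᵇ_

_≤ᵇ_ _≡ᵇ_ : ℤ → ℤ → Bool
m ≤ᵇ n = ⌊ m ℤ.≤? n ⌋
m ≡ᵇ n = if m ≤ᵇ n then n ≤ᵇ m else false

-- These functions, and those that follow, are spelled with exactly the conditionals and folds that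
-- the programs denote, so that program and function agree by computation.
and or imp : Bool → Bool → Bool
and a b = if a then b else false
or  a b = if a then true else b
imp a b = if a then b else true

every some : ∀ {A : Set} → (A → Bool) → List A → Bool
every f = foldr (λ a b → and (f a) b) true
some  f = foldr (λ a b → or (f a) b) false

-- A fold meets the list from its end, so `p` starts in last place and moves forward past every
-- higher point.
insert : Point → List Point → List Point
insert p = foldr (λ a ys → caseList′ ys (a ∷ []) (λ y ys′ →
  if yc a ≤ᵇ yc y then a ∷ y ∷ ys′ else y ∷ a ∷ ys′)) (p ∷ [])

sort : List Point → List Point
sort = foldr insert []

-- The input carries only the inner lines of the tree; the two sides of the root strip have to be
-- recovered from `X`. The value on the empty list is arbitrary.
leftmost rightmost : List Point → ℤ
leftmost  X = caseList′ X (+ 0) (λ p ps → foldr (λ q m → if xc q ≤ᵇ m then xc q else m) (xc p) ps)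
rightmost X = caseList′ X (+ 0) (λ p ps → foldr (λ q m → if m ≤ᵇ xc q then xc q else m) (xc p) ps)

lines : Tree → List ℤ
lines = foldTree′ (λ ℓ l r → foldr _∷_ (ℓ ∷ r) l) []

-- The first component of the accumulator is the right side of the strip to be closed by the next
-- line.
cut : List ℤ → ℤ → ℤ × List Point
cut ls hi = foldr (λ ℓ b → ℓ , (ℓ , proj₁ b) ∷ proj₂ b) (hi , []) ls

levels : List Point → List ℤ
levels = foldr (λ _ ws → + 0 ∷ foldr (λ w acc → (w ℤ.+ + 1) ∷ acc) [] ws) (+ 0 ∷ + 1 ∷ [])

-- Levels go up to `length S` plus one. The mark of the current row lies just above all of them, so
-- a cell is touched in this row exactly if its level is at least `top S`.
top : List Point → ℤ
top = foldr (λ _ n → n ℤ.+ + 1) (+ 2)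

cart : ∀ {A : Set} → List (List A) → List (List A)
cart = foldr (λ xs rest → foldr (λ w acc → foldr (λ r acc′ → (w ∷ r) ∷ acc′) acc rest) [] xs) ([] ∷ [])

states : List ℤ → List Point → List State
states W S = cart (foldr (λ σ acc → foldr (λ w acc′ → (σ , w) ∷ acc′) [] W ∷ acc) [] S)

choices : ℤ → State → List State
choices t H = cart (foldr (λ g acc → (g ∷ (proj₁ g , t) ∷ []) ∷ acc) [] H)

full : ℤ → State → State
full t = foldr (λ g acc → (proj₁ g , t) ∷ acc) []

between : ℤ → ℤ → ℤ → Bool
between k a b = or (and (a ≤ᵇ k) (k ≤ᵇ b)) (and (b ≤ᵇ k) (k ≤ᵇ a))

valid : ℤ → State → State → ℤ → Bool
valid t H G x = every (λ g → and
  (imp (and (lft g ≤ᵇ x) (x ≤ᵇ rgt g)) (t ≤ᵇ lvl g))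
  (imp (t ≤ᵇ lvl g) (every (λ q → imp (+ 1 ≤ᵇ lvl q) (or (lft g ≡ᵇ lft q) (or
    (some (λ r → and (between (lft r) (lft q) (lft g))
                     (and (lvl q ≤ᵇ lvl r) (imp (lft r ≡ᵇ lft q) false))) H)
    (some (λ r → and (between (lft r) (lft q) (lft g))
                     (and (t ≤ᵇ lvl r) (imp (lft r ≡ᵇ lft g) false))) G)))) H))) G

-- One plus the number of cells of smaller level. Counting starts at 1 because level 0 is reserved
-- for strips never touched.
rank : State → ℤ → ℤ
rank G v = if v ≤ᵇ + 0 then + 0 else
  foldr (λ r n → if v ≤ᵇ lvl r then n else n ℤ.+ + 1) (+ 1) G

normalise : State → State
normalise G = foldr (λ g acc → (proj₁ g , rank G (lvl g)) ∷ acc) [] G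

subset : State → State → Bool
subset G H = every (λ g → some (λ q → and (lft g ≡ᵇ lft q) (lvl g ≡ᵇ lvl q)) H) G

find : Table → State → List Point
find tbl G = foldr (λ e acc → if subset G (proj₁ e) then proj₂ e else acc) [] tbl

double : ℤ → ℤ → State → List Point → List Point
double t y G s = foldr (λ g acc →
  if t ≤ᵇ lvl g then (lft g , y) ∷ (rgt g , y) ∷ acc else acc) s G

candidate : ℤ → Point → Table → State → List Point
candidate t p tbl G = double t (yc p) G (find tbl (normalise G))

len : List Point → ℤ
len = foldr (λ _ n → n ℤ.+ + 1) (+ 0)

shorter : List Point → List Point → List Point
shorter s s′ = if len s ≤ᵇ len s′ then s else s′

-- Touching every strip is always possible, which gives the initial solution.
best : ℤ → Point → Table → State → List Point
best t p tbl H = foldr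
  (λ G acc → if valid t H G (xc p) then shorter (candidate t p tbl G) acc else acc)
  (candidate t p tbl (full t H)) (choices t H)

-- Backward dynamic programming: the fold treats the highest row first, and the entry of `H`
-- completes all rows treated so far, starting from the state `H`. Every state is tabulated, whether
-- or not it can be reached.
table : ℤ → List State → List Point → Table
table t E = foldr (λ p tbl → foldr (λ H acc → (H , best t p tbl H) ∷ acc) [] E)
                  (foldr (λ H acc → (H , []) ∷ acc) [] E)

-- Adjacent strips share a line, so touching both in one row produces the point on that line twice.
dedup : List Point → List Point
dedup = foldr (λ p acc →
  if some (λ q → and (xc p ≡ᵇ xc q) (yc p ≡ᵇ yc q)) acc then acc else p ∷ acc) []

leafStrips : List Point → Tree → List Point
leafStrips X T = proj₂ (cut (leftmost X ∷ lines T) (rightmost X))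

blank : List Point → State
blank = foldr (λ σ acc → (σ , + 0) ∷ acc) []

solve : List Point → List Point → List Point
solve X S = dedup (find (table (top S) (states (levels S) S) (sort X)) (blank S))

-- The same functions as programs

private variable
  Γ : Ctx
  α β γ δ ε ζ η θ ι κ μ ν : Ty

v0 : Expr (α ∷ Γ) α
v0 = var (here refl)

v1 : Expr (α ∷ β ∷ Γ) β
v1 = var (there (here refl))

v2 : Expr (α ∷ β ∷ γ ∷ Γ) γ
v2 = var (there (there (here refl)))

v3 : Expr (α ∷ β ∷ γ ∷ δ ∷ Γ) δ
v3 = var (there (there (there (here refl))))

v4 : Expr (α ∷ β ∷ γ ∷ δ ∷ ε ∷ Γ) ε
v4 = var (there (there (there (there (here refl)))))

v6 : Expr (α ∷ β ∷ γ ∷ δ ∷ ε ∷ ζ ∷ η ∷ Γ) η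
v6 = var (there (there (there (there (there (there (here refl)))))))

shift⁶ : α ∈ Γ → α ∈ (β ∷ γ ∷ δ ∷ ε ∷ ζ ∷ η ∷ Γ)
shift⁶ i = there (there (there (there (there (there i)))))

v7 : Expr (α ∷ β ∷ γ ∷ δ ∷ ε ∷ ζ ∷ η ∷ θ ∷ Γ) θ
v7 = var (shift⁶ (there (here refl)))

v8 : Expr (α ∷ β ∷ γ ∷ δ ∷ ε ∷ ζ ∷ η ∷ θ ∷ ι ∷ Γ) ι
v8 = var (shift⁶ (there (there (here refl))))

v10 : Expr (α ∷ β ∷ γ ∷ δ ∷ ε ∷ ζ ∷ η ∷ θ ∷ ι ∷ κ ∷ μ ∷ Γ) μ
v10 = var (shift⁶ (there (there (there (there (here refl))))))

v11 : Expr (α ∷ β ∷ γ ∷ δ ∷ ε ∷ ζ ∷ η ∷ θ ∷ ι ∷ κ ∷ μ ∷ ν ∷ Γ) ν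
v11 = var (shift⁶ (there (there (there (there (there (here refl)))))))

cell : Ty
cell = point ⊗ int

state : Ty
state = list cell

entry : Ty
entry = state ⊗ list point

input : Ty
input = list point ⊗ tree

andE orE impE : Expr Γ bool → Expr Γ bool → Expr Γ bool
andE t u = ite t u ff
orE  t u = ite t tt u
impE t u = ite t u tt

eqE : Expr Γ int → Expr Γ int → Expr Γ bool
eqE t u = andE (leq t u) (leq u t)

everyE someE : Expr Γ (list α) → Expr (α ∷ bool ∷ Γ) bool → Expr Γ bool
everyE t u = foldList t tt (andE u v1)
someE  t u = foldList t ff (orE u v1)

mapE : Expr Γ (list α) → Expr (α ∷ list β ∷ Γ) β → Expr Γ (list β)
mapE t u = foldList t nil (cons u v1)

insertE : Expr (point ∷ list point ∷ Γ) (list point)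
insertE = foldList v1 (cons v0 nil) (caseList v1 (cons v0 nil)
  (ite (leq (snd v2) (snd v0)) (cons v2 (cons v0 v1)) (cons v0 (cons v2 v1))))

sortE : Expr Γ (list point) → Expr Γ (list point)
sortE t = foldList t nil insertE

leftmostE rightmostE : Expr Γ (list point) → Expr Γ int
leftmostE  t = caseList t (lit (+ 0)) (foldList v1 (fst v0) (ite (leq (fst v0) v1) (fst v0) v1))
rightmostE t = caseList t (lit (+ 0)) (foldList v1 (fst v0) (ite (leq v1 (fst v0)) (fst v0) v1))

linesE : Expr Γ tree → Expr Γ (list int)
linesE t = foldTree t nil (foldList v1 (cons v0 v2) (cons v0 v1))

leafStripsE : Expr Γ (list point) → Expr Γ tree → Expr Γ (list point)
leafStripsE t u = snd (foldList (cons (leftmostE t) (linesE u)) (pair (rightmostE t) nil)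
  (pair v0 (cons (pair v0 (fst v1)) (snd v1))))

levelsE : Expr Γ (list point) → Expr Γ (list int)
levelsE t = foldList t (cons (lit (+ 0)) (cons (lit (+ 1)) nil))
  (cons (lit (+ 0)) (mapE v1 (add v0 (lit (+ 1)))))

lengthE : ℤ → Expr Γ (list α) → Expr Γ int
lengthE n t = foldList t (lit n) (add v1 (lit (+ 1)))

cartE : Expr Γ (list (list α)) → Expr Γ (list (list α))
cartE t = foldList t (cons nil nil) (foldList v0 nil (foldList v3 v1 (cons (cons v2 v0) v1)))

statesE : Expr (list int ∷ α ∷ list point ∷ Γ) (list state)
statesE = cartE (mapE v2 (mapE v2 (pair v2 v0)))

findE : Expr Γ (list entry) → Expr (entry ∷ list point ∷ Γ) state → Expr Γ (list point)
findE t u = foldList t nil (ite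
  (bind u (everyE v0 (someE (fst v3)
    (andE (eqE (fst (fst v2)) (fst (fst v0))) (eqE (snd v2) (snd v0))))))
  (snd v0) v1)

betweenE : Expr Γ int → Expr Γ int → Expr Γ int → Expr Γ bool
betweenE k a b = orE (andE (leq a k) (leq k b)) (andE (leq b k) (leq k a))

-- The contexts below are  G ∷ best so far ∷ H ∷ _ ∷ p ∷ table ∷ _ ∷ _ ∷ top.
validE : Expr (state ∷ α ∷ state ∷ β ∷ point ∷ γ ∷ δ ∷ ε ∷ int ∷ Γ) bool
validE = everyE v0 (andE
  (impE (andE (leq (fst (fst v0)) (fst v6)) (leq (fst v6) (snd (fst v0)))) (leq v10 (snd v0)))
  (impE (leq v10 (snd v0)) (everyE v4 (impE (leq (lit (+ 1)) (snd v0))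
    (orE (eqE (fst (fst v2)) (fst (fst v0))) (orE
      (someE v6 (andE (betweenE (fst (fst v0)) (fst (fst v2)) (fst (fst v4)))
                      (andE (leq (snd v2) (snd v0)) (impE (eqE (fst (fst v0)) (fst (fst v2))) ff))))
      (someE v4 (andE (betweenE (fst (fst v0)) (fst (fst v2)) (fst (fst v4)))
                      (andE (leq v14 (snd v0)) (impE (eqE (fst (fst v0)) (fst (fst v4))) ff))))))))))
  where
  v14 = var (shift⁶ (shift⁶ (there (there (here refl)))))

rankE : Expr (cell ∷ α ∷ state ∷ Γ) int
rankE = ite (leq (snd v0) (lit (+ 0))) (lit (+ 0))
  (foldList v2 (lit (+ 1)) (ite (leq (snd v2) (snd v0)) v1 (add v1 (lit (+ 1)))))

candidateE : Expr (state ∷ α ∷ β ∷ γ ∷ point ∷ list entry ∷ δ ∷ ε ∷ int ∷ Γ) (list point)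
candidateE = bind (mapE v0 (pair (fst v0) rankE)) (foldList v1 (findE v6 v2)
  (ite (leq v11 (snd v0))
    (cons (pair (fst (fst v0)) (snd v7)) (cons (pair (snd (fst v0)) (snd v7)) v1)) v1))

bestE : Expr (state ∷ δ ∷ point ∷ list entry ∷ β ∷ γ ∷ int ∷ Γ) (list point)
bestE = foldList
  (cartE (mapE v0 (cons v0 (cons (pair (fst v0) v8) nil))))
  (bind (nil {A = point}) (bind (mapE v1 (pair (fst v0) v9)) candidateE))
  (ite validE (bind candidateE (ite (leq (lengthE (+ 0) v0) (lengthE (+ 0) v2)) v0 v2)) v1)
  where
  v9 = var (shift⁶ (there (there (there (here refl)))))

dedupE : Expr Γ (list point) → Expr Γ (list point)
dedupE t = foldList t nil
  (ite (someE v1 (andE (eqE (fst v2) (fst v0)) (eqE (snd v2) (snd v0)))) v1 (cons v0 v1))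

tableE : Expr (list state ∷ list int ∷ int ∷ list point ∷ input ∷ []) (list entry)
tableE = foldList (sortE (fst v4)) (mapE v0 (pair v0 nil)) (mapE v2 (pair v0 bestE))

outputE : Expr (list entry ∷ list state ∷ list int ∷ int ∷ list point ∷ Γ) (list point)
outputE = bind (mapE v4 (pair v0 (lit (+ 0)))) (dedupE (findE v1 v2))

fromStatesE : Expr (list state ∷ list int ∷ int ∷ list point ∷ input ∷ []) (list point)
fromStatesE = bind tableE outputE

fromLevelsE : Expr (list int ∷ int ∷ list point ∷ input ∷ []) (list point)
fromLevelsE = bind statesE fromStatesE

fromTopE : Expr (int ∷ list point ∷ input ∷ []) (list point)
fromTopE = bind (levelsE v1) fromLevelsE

-- Conversion checking must not unfold the value of solveE, which is huge.
opaque
  solveE : Expr (list point ∷ input ∷ []) (list point)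
  solveE = bind (lengthE (+ 2) v0) fromTopE

  solveE-value : ∀ X T S → ⟦ solveE ⟧ (S ∷ (X , T) ∷ []) ≡ solve X S
  solveE-value X T S = refl

algorithmE : Expr (input ∷ []) (list point)
algorithmE = bind (leafStripsE (fst v0) (snd v0)) solveE

leafStripsE-value : ∀ X T → ⟦ leafStripsE (fst v0) (snd v0) ⟧ ((X , T) ∷ []) ≡ leafStrips X T
leafStripsE-value X T = refl

algorithmE-value : ∀ X T → ⟦ algorithmE ⟧ ((X , T) ∷ []) ≡ solve X (leafStrips X T)
algorithmE-value X T = trans
  (cong (λ S → ⟦ solveE ⟧ (S ∷ (X , T) ∷ [])) (leafStripsE-value X T))
  (solveE-value X T (leafStrips X T))

-- Rectangles

Between : ℤ → ℤ → ℤ → Set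
Between k a b = (a ℤ.⊓ b ℤ.≤ k) × (k ℤ.≤ a ℤ.⊔ b)

≤⇒Between : ∀ {k a b} → a ℤ.≤ k → k ℤ.≤ b → Between k a b
≤⇒Between {k} {a} {b} p q = ℤ.≤-trans (ℤ.i⊓j≤i a b) p , ℤ.≤-trans q (ℤ.i≤j⊔i a b)

Between-sym : ∀ {k a b} → Between k a b → Between k b a
Between-sym {k} {a} {b} (p , q) =
  subst (ℤ._≤ k) (ℤ.⊓-comm a b) p , subst (k ℤ.≤_) (ℤ.⊔-comm a b) q

Between⇒≤ : ∀ {k a b} → Between k a b → (a ℤ.≤ k × k ℤ.≤ b) ⊎ (b ℤ.≤ k × k ℤ.≤ a)
Between⇒≤ {k} {a} {b} (p , q) with ℤ.≤-total a b
... | inj₁ a≤b = inj₁ (subst (ℤ._≤ k) (ℤ.i≤j⇒i⊓j≡i a≤b) p , subst (k ℤ.≤_) (ℤ.i≤j⇒i⊔j≡j a≤b) q)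
... | inj₂ b≤a = inj₂ (subst (ℤ._≤ k) (ℤ.i≥j⇒i⊓j≡j b≤a) p , subst (k ℤ.≤_) (ℤ.i≥j⇒i⊔j≡i b≤a) q)

Between-left : ∀ a b → Between a a b
Between-left a b = ℤ.i⊓j≤i a b , ℤ.i≤i⊔j a b

Between-right : ∀ a b → Between b a b
Between-right a b = ℤ.i⊓j≤j a b , ℤ.i≤j⊔i a b

Monotone : (ℤ → ℤ) → Set
Monotone f = ∀ {i j} → i ℤ.≤ j → f i ℤ.≤ f j

Between-mono : ∀ {f k a b} → Monotone f → Between k a b → Between (f k) (f a) (f b)
Between-mono mono k∈ with Between⇒≤ k∈
... | inj₁ (p , q) = ≤⇒Between (mono p) (mono q)
... | inj₂ (p , q) = Between-sym (≤⇒Between (mono p) (mono q))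

distance : ℤ → ℤ → ℕ
distance a b = ℤ.∣ a ℤ.- b ∣

distance-chain : ∀ {a k b} → a ℤ.≤ k → k ℤ.≤ b → distance b a ≡ distance b k + distance k a
distance-chain {a} {k} {b} a≤k k≤b = ℤ.+-injective (begin
  + distance b a                   ≡⟨ ℤ.0≤i⇒+∣i∣≡i (ℤ.i≤j⇒0≤j-i (ℤ.≤-trans a≤k k≤b)) ⟩
  b ℤ.- a                          ≡⟨ sym (ℤ.+-minus-telescope b k a) ⟩
  (b ℤ.- k) ℤ.+ (k ℤ.- a)          ≡⟨ sym (cong₂ ℤ._+_ (ℤ.0≤i⇒+∣i∣≡i (ℤ.i≤j⇒0≤j-i k≤b))
                                                       (ℤ.0≤i⇒+∣i∣≡i (ℤ.i≤j⇒0≤j-i a≤k))) ⟩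
  + distance b k ℤ.+ + distance k a ∎)
  where open ≡-Reasoning

distance-split : ∀ {k a b} → Between k a b → distance a b ≡ distance a k + distance k b
distance-split {k} {a} {b} k∈ with Between⇒≤ k∈
... | inj₁ (p , q) = trans (ℤ.∣i-j∣≡∣j-i∣ a b) (trans (distance-chain p q)
  (trans (+-comm (distance b k) _) (cong₂ _+_ (ℤ.∣i-j∣≡∣j-i∣ k a) (ℤ.∣i-j∣≡∣j-i∣ b k))))
... | inj₂ (p , q) = distance-chain p q

distance≡0 : ∀ {a b} → distance a b ≡ 0 → a ≡ b
distance≡0 {a} {b} eq = ℤ.i-j≡0⇒i≡j a b (ℤ.∣i∣≡0⇒i≡0 eq)

-- The L1 distance. It is additive through every point of the rectangle, so replacing one end of a
-- pair by another point of the rectangle decreases it.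
size : Point → Point → ℕ
size p q = distance (xc p) (xc q) + distance (yc p) (yc q)

size≡0 : ∀ {p q} → size p q ≡ 0 → p ≡ q
size≡0 {p} {q} eq = cong₂ _,_ (distance≡0 (m+n≡0⇒m≡0 _ eq))
                              (distance≡0 (m+n≡0⇒n≡0 (distance (xc p) (xc q)) eq))

size-split : ∀ {r p q} → r ∈□[ p , q ] → size p q ≡ size p r + size r q
size-split {r} {p} {q} (r∈x , r∈y) = trans (cong₂ _+_ (distance-split r∈x) (distance-split r∈y))
  (+-*-Solver.solve 4 (λ a b c d → (a :+ b) :+ (c :+ d) := (a :+ c) :+ (b :+ d)) refl
    (distance (xc p) (xc r)) (distance (xc r) (xc q)) (distance (yc p) (yc r)) (distance (yc r) (yc q)))
  where
  open +-*-Solver using (_:+_; _:=_)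

_≟ᵖ_ : DecidableEquality Point
_≟ᵖ_ = ≡-dec ℤ._≟_ ℤ._≟_

-- Among the preimages of a given pair take those at least distance: a
-- point satisfying them cannot be mapped onto either of the pair.
collapse-satisfied : ∀ {f g S} → Monotone f → Monotone g → Satisfied S →
                     Satisfied (map (λ p → f (xc p) , g (yc p)) S)
collapse-satisfied {f} {g} {S} f-mono g-mono sat p′ q′ p′∈ q′∈ nc
  with ∈-map⁻ _ p′∈ | ∈-map⁻ _ q′∈
... | p , p∈ , refl | q , q∈ , refl = go (suc (size p q)) p q p∈ q∈ refl refl ≤-refl
  where
  h : Point → Point
  h p = f (xc p) , g (yc p)

  go : ∀ n u v → u ∈ S → v ∈ S → h u ≡ h p → h v ≡ h q → size u v ℕ.< n →
       SatisfiedPair (map h S) (h p) (h q)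
  go (suc n) u v u∈ v∈ hu hv (s≤s lt) = found (sat u v u∈ v∈ nonCollinear)
    where
    nonCollinear : ¬ Collinear u v
    nonCollinear (inj₁ eq) = nc (inj₁ (trans (cong xc (sym hu)) (trans (cong f eq) (cong xc hv))))
    nonCollinear (inj₂ eq) = nc (inj₂ (trans (cong yc (sym hu)) (trans (cong g eq) (cong yc hv))))

    found : SatisfiedPair S u v → SatisfiedPair (map h S) (h p) (h q)
    found (r , r∈ , r≢u , r≢v , r∈□) with h r ≟ᵖ h p | h r ≟ᵖ h q
    ... | yes hr | _      = go n r v r∈ v∈ hr hv (≤-trans
          (m<n+m (size r v) (n≢0⇒n>0 (λ eq → r≢u (sym (size≡0 eq)))))
          (≤-trans (≤-reflexive (sym (size-split {r} {u} {v} r∈□))) lt))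
    ... | no _   | yes hr = go n u r u∈ r∈ hu hr (≤-trans
          (m<m+n (size u r) (n≢0⇒n>0 (λ eq → r≢v (size≡0 eq))))
          (≤-trans (≤-reflexive (sym (size-split {r} {u} {v} r∈□))) lt))
    ... | no np  | no nq  = h r , ∈-map⁺ h r∈ , np , nq ,
          subst₂ (λ a b → h r ∈□[ a , b ]) hu hv
            (Between-mono f-mono (proj₁ r∈□) , Between-mono g-mono (proj₂ r∈□))

SatisfiedPair-sym : ∀ {S p q} → SatisfiedPair S p q → SatisfiedPair S q p
SatisfiedPair-sym {p = p} {q} (r , r∈ , r≢p , r≢q , x∈ , y∈) =
  r , r∈ , r≢q , r≢p , Between-sym {xc r} x∈ , Between-sym {yc r} y∈

-- Strips

-- Both strips must have positive width. A root strip of width zero, which occurs if `X` has one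
-- active column, cannot be divided and is comparable to itself by equality only.
Before : Point → Point → Set
Before σ τ = proj₁ σ ℤ.< proj₂ σ × proj₁ τ ℤ.< proj₂ τ × proj₂ σ ℤ.≤ proj₁ τ

Comparable : Point → Point → Set
Comparable σ τ = σ ≡ τ ⊎ (Before σ τ ⊎ Before τ σ)

InStrip : Point → ℤ → Set
InStrip σ x = proj₁ σ ℤ.≤ x × x ℤ.≤ proj₂ σ

-- P lists points (a , y), standing for the strip with left line a in the
-- row y; Z has the points of P on both boundaries of their strips.
record Doubling (X Z P strips : PointList) : Set where
  field
    comparable : ∀ {σ τ} → σ ∈ strips → τ ∈ strips → Comparable σ τ
    satisfied  : Satisfied P
    strip      : ∀ {p} → p ∈ P → ∃[ σ ] σ ∈ strips × proj₁ σ ≡ xc p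
    covered    : ∀ {p} → p ∈ X → ∃[ σ ] σ ∈ strips × InStrip σ (xc p) × (proj₁ σ , yc p) ∈ P
    oneColumn  : ∀ {p q σ} → p ∈ X → q ∈ X → σ ∈ strips →
                 InStrip σ (xc p) → InStrip σ (xc q) → xc p ≡ xc q
    ordered    : ∀ {σ} → σ ∈ strips → proj₁ σ ℤ.≤ proj₂ σ
    origin     : ∀ {z} → z ∈ Z → ∃[ σ ] σ ∈ strips × (proj₁ σ , yc z) ∈ P ×
                 (xc z ≡ proj₁ σ ⊎ xc z ≡ proj₂ σ)
    boundary   : ∀ {σ y} → σ ∈ strips → (proj₁ σ , y) ∈ P →
                 (proj₁ σ , y) ∈ Z × (proj₂ σ , y) ∈ Z

  -- A point on a line shared by two strips does not determine its strip. What counts is some strip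
  -- containing the point and occupied in its row, since both boundaries of that strip then have a
  -- point of `Z` in this row.
  record Owner (e : Point) : Set where
    field
      σ        : Point
      σ∈       : σ ∈ strips
      occupied : (proj₁ σ , yc e) ∈ P
      inside   : InStrip σ (xc e)
      kind     : e ∈ X ⊎ (xc e ≡ proj₁ σ ⊎ xc e ≡ proj₂ σ)

  owner : ∀ {e} → e ∈ X ++ Z → Owner e
  owner e∈ with ∈-++⁻ X e∈
  ... | inj₁ e∈X with covered e∈X
  ...   | σ , σ∈ , i , o = record { σ = σ ; σ∈ = σ∈ ; occupied = o ; inside = i ; kind = inj₁ e∈X }
  owner e∈ | inj₂ e∈Z with origin e∈Z
  ... | σ , σ∈ , o , inj₁ refl = record { σ = σ ; σ∈ = σ∈ ; occupied = o
        ; inside = ℤ.≤-refl , ordered σ∈ ; kind = inj₂ (inj₁ refl) }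
  ... | σ , σ∈ , o , inj₂ refl = record { σ = σ ; σ∈ = σ∈ ; occupied = o
        ; inside = ordered σ∈ , ℤ.≤-refl ; kind = inj₂ (inj₂ refl) }

  module Rightward {p q : Point} (p∈ : p ∈ X ++ Z) (q∈ : q ∈ X ++ Z)
                   (x< : xc p ℤ.< xc q) (y≢ : yc p ≢ yc q) where
    open Owner (owner p∈) using () renaming (σ to σ; σ∈ to σ∈; occupied to oσ; inside to iσ; kind to kσ)
    open Owner (owner q∈) using () renaming (σ to τ; σ∈ to τ∈; occupied to oτ; inside to iτ; kind to kτ)

    a b a′ b′ : ℤ
    a  = proj₁ σ
    b  = proj₂ σ
    a′ = proj₁ τ
    b′ = proj₂ τ

    witness : ∀ r → r ∈ Z → r ≢ p → r ≢ q → xc p ℤ.≤ xc r → xc r ℤ.≤ xc q →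
              Between (yc r) (yc p) (yc q) → SatisfiedPair (X ++ Z) p q
    witness r r∈ r≢p r≢q l u y∈ = r , ∈-++⁺ʳ X r∈ , r≢p , r≢q , ≤⇒Between l u , y∈

    rightOf-p : xc p ℤ.< b → b ℤ.≤ xc q → SatisfiedPair (X ++ Z) p q
    rightOf-p lt le = witness (b , yc p) (proj₂ (boundary σ∈ oσ))
      (λ eq → ℤ.<-irrefl (cong xc (sym eq)) lt) (λ eq → y≢ (cong yc eq))
      (ℤ.<⇒≤ lt) le (Between-left (yc p) (yc q))

    leftOf-q : xc p ℤ.≤ a′ → a′ ℤ.< xc q → SatisfiedPair (X ++ Z) p q
    leftOf-q le lt = witness (a′ , yc q) (proj₁ (boundary τ∈ oτ))
      (λ eq → y≢ (cong yc (sym eq))) (λ eq → ℤ.<-irrefl (cong xc eq) lt)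
      le (ℤ.<⇒≤ lt) (Between-right (yc p) (yc q))

    sameStrip : σ ≡ τ → a ℤ.< xc p → xc q ℤ.< b → SatisfiedPair (X ++ Z) p q
    sameStrip eq lo hi with kσ | kτ
    ... | inj₂ (inj₁ e) | _ = ⊥-elim (ℤ.<-irrefl (sym e) lo)
    ... | inj₂ (inj₂ e) | _ = ⊥-elim (ℤ.<-irrefl e (ℤ.<-trans x< hi))
    ... | inj₁ _ | inj₂ (inj₁ e) = ⊥-elim (ℤ.<-irrefl (trans (cong proj₁ eq) (sym e)) (ℤ.<-trans lo x<))
    ... | inj₁ _ | inj₂ (inj₂ e) = ⊥-elim (ℤ.<-irrefl (trans e (cong proj₂ (sym eq))) hi)
    ... | inj₁ p∈X | inj₁ q∈X = ⊥-elim (ℤ.<-irrefl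
          (oneColumn p∈X q∈X σ∈ iσ (subst (λ s → InStrip s (xc q)) (sym eq) iτ)) x<)

    -- The points lie on facing sides, so their own strips offer no witness. The image supplies an
    -- occupied strip in some row `y`. If it is `σ` or `τ`, the facing side of that strip in row `y`
    -- works, as the image point differs from both ends; otherwise the strip lies between the two.
    distinctStrips : xc p ≡ b → xc q ≡ a′ → Before σ τ → SatisfiedPair (X ++ Z) p q
    distinctStrips p≡b q≡a′ (a<b , a′<b′ , b≤a′)
      with satisfied (a , yc p) (a′ , yc q) oσ oτ
             [ (λ e → ℤ.<-irrefl e (ℤ.<-≤-trans a<b b≤a′)) , y≢ ]′
    ... | (k , y) , r∈ , r≢σ , r≢τ , k∈ , y∈ with strip r∈
    ... | (.k , k′) , ρ∈ , refl = choose (Between⇒≤ k∈)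
      where
      b<a′ : b ℤ.< a′
      b<a′ = subst₂ ℤ._<_ p≡b q≡a′ x<

      kZ : (k , y) ∈ Z
      kZ = proj₁ (boundary ρ∈ r∈)

      k′Z : (k′ , y) ∈ Z
      k′Z = proj₂ (boundary ρ∈ r∈)

      at : ∀ l → (l , y) ∈ Z → (l , y) ≢ p → (l , y) ≢ q → b ℤ.≤ l → l ℤ.≤ a′ →
           SatisfiedPair (X ++ Z) p q
      at l l∈ l≢p l≢q lo hi = witness (l , y) l∈ l≢p l≢q
        (subst (ℤ._≤ l) (sym p≡b) lo) (subst (l ℤ.≤_) (sym q≡a′) hi) y∈

      strictly : b ℤ.≤ k → k ℤ.< k′ → k′ ℤ.≤ a′ → SatisfiedPair (X ++ Z) p q
      -- In the row of `p` the left side `k` may be `p` itself, so the right side is taken. In every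
      -- other row the left side is safe, since `k` is smaller than the abscissa of `q`.
      strictly b≤k k<k′ k′≤a′ with y ℤ.≟ yc p
      ... | yes refl = at k′ k′Z
            (λ eq → ℤ.<-irrefl (sym (trans (cong xc eq) p≡b)) (ℤ.≤-<-trans b≤k k<k′))
            (λ eq → y≢ (cong yc eq)) (ℤ.≤-trans b≤k (ℤ.<⇒≤ k<k′)) k′≤a′
      ... | no y≢p = at k kZ (λ eq → y≢p (cong yc eq))
            (λ eq → ℤ.<-irrefl (trans (cong xc eq) q≡a′) (ℤ.<-≤-trans k<k′ k′≤a′))
            b≤k (ℤ.≤-trans (ℤ.<⇒≤ k<k′) k′≤a′)

      choose : (a ℤ.≤ k × k ℤ.≤ a′) ⊎ (a′ ℤ.≤ k × k ℤ.≤ a) → SatisfiedPair (X ++ Z) p q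
      choose (inj₂ (l , u)) =
        ⊥-elim (ℤ.<-irrefl refl (ℤ.<-≤-trans (ℤ.<-≤-trans a<b b≤a′) (ℤ.≤-trans l u)))
      choose (inj₁ (l , u)) with comparable ρ∈ σ∈ | comparable ρ∈ τ∈
      ... | inj₁ refl | _ = at b k′Z (λ eq → r≢σ (cong (a ,_) (cong yc eq)))
            (λ eq → ℤ.<-irrefl (trans (cong xc eq) q≡a′) b<a′) ℤ.≤-refl b≤a′
      ... | inj₂ (inj₁ (k<k′ , _ , k′≤a)) | _ =
            ⊥-elim (ℤ.<-irrefl refl (ℤ.<-≤-trans k<k′ (ℤ.≤-trans k′≤a l)))
      ... | inj₂ (inj₂ _) | inj₁ refl =
            at a′ kZ (λ eq → ℤ.<-irrefl (trans (sym p≡b) (cong xc (sym eq))) b<a′)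
              (λ eq → r≢τ (cong (a′ ,_) (cong yc eq))) b≤a′ ℤ.≤-refl
      ... | inj₂ (inj₂ (_ , k<k′ , b≤k)) | inj₂ (inj₁ (_ , _ , k′≤a′)) = strictly b≤k k<k′ k′≤a′
      ... | inj₂ (inj₂ _) | inj₂ (inj₂ (a′<b′ , _ , b′≤k)) =
            ⊥-elim (ℤ.<-irrefl refl (ℤ.<-≤-trans a′<b′ (ℤ.≤-trans b′≤k u)))

    -- If `p` is not on the right side of its strip, that side in the row of `p` is a witness unless
    -- it lies beyond `q`; symmetrically for `q`. What remains is a pair on facing sides of two
    -- strips, or a pair strictly inside one strip, which must consist of points of `X` in the same
    -- column.
    pair-satisfied : SatisfiedPair (X ++ Z) p q
    pair-satisfied with comparable σ∈ τ∈ | ℤ.<-cmp (xc p) b | ℤ.<-cmp a′ (xc q)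
    ... | _ | tri> _ _ gt | _ = ⊥-elim (ℤ.<-irrefl refl (ℤ.<-≤-trans gt (proj₂ iσ)))
    ... | _ | _ | tri> _ _ gt = ⊥-elim (ℤ.<-irrefl refl (ℤ.<-≤-trans gt (proj₁ iτ)))
    ... | inj₂ (inj₂ (_ , _ , b′≤a)) | _ | _ = ⊥-elim (ℤ.<-irrefl refl
          (ℤ.<-≤-trans x< (ℤ.≤-trans (proj₂ iτ) (ℤ.≤-trans b′≤a (proj₁ iσ)))))
    ... | inj₂ (inj₁ (_ , _ , b≤a′)) | tri< lt _ _ | _ = rightOf-p lt (ℤ.≤-trans b≤a′ (proj₁ iτ))
    ... | inj₂ (inj₁ (_ , _ , b≤a′)) | _ | tri< lt _ _ = leftOf-q (ℤ.≤-trans (proj₂ iσ) b≤a′) lt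
    ... | inj₂ (inj₁ bf) | tri≈ _ p≡b _ | tri≈ _ q≡a′ _ = distinctStrips p≡b (sym q≡a′) bf
    ... | inj₁ eq | tri≈ _ p≡b _ | _ = ⊥-elim (ℤ.<-irrefl refl
          (ℤ.<-≤-trans x< (ℤ.≤-trans (proj₂ iτ) (ℤ.≤-reflexive (trans (cong proj₂ (sym eq)) (sym p≡b))))))
    ... | inj₁ eq | _ | tri≈ _ q≡a′ _ = ⊥-elim (ℤ.<-irrefl refl
          (ℤ.<-≤-trans x< (ℤ.≤-trans (ℤ.≤-reflexive (trans (sym q≡a′) (cong proj₁ (sym eq)))) (proj₁ iσ))))
    ... | inj₁ eq | tri< lt _ _ | tri< lt′ _ _ with ℤ.<-cmp a (xc p) | ℤ.<-cmp (xc q) b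
    ...   | tri> _ _ gt | _ = ⊥-elim (ℤ.<-irrefl refl (ℤ.<-≤-trans gt (proj₁ iσ)))
    ...   | tri≈ _ a≡p _ | _ =
            leftOf-q (ℤ.≤-reflexive (trans (sym a≡p) (cong proj₁ eq))) lt′
    ...   | tri< _ _ _ | tri≈ _ q≡b _ = rightOf-p lt (ℤ.≤-reflexive (sym q≡b))
    ...   | tri< _ _ _ | tri> _ _ gt = rightOf-p lt (ℤ.<⇒≤ gt)
    ...   | tri< lo _ _ | tri< hi _ _ = sameStrip eq lo hi

  doubling-satisfied : Satisfied (X ++ Z)
  doubling-satisfied p q p∈ q∈ nc with ℤ.<-cmp (xc p) (xc q)
  ... | tri< lt _ _ = Rightward.pair-satisfied p∈ q∈ lt (λ e → nc (inj₂ e))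
  ... | tri≈ _ eq _ = ⊥-elim (nc (inj₁ eq))
  ... | tri> _ _ gt = SatisfiedPair-sym (Rightward.pair-satisfied q∈ p∈ gt (λ e → nc (inj₂ (sym e))))

-- Leaf strips of a partitioning tree

strips : ℤ → ℤ → Tree → List Point
strips lo hi leaf         = (lo , hi) ∷ []
strips lo hi (node ℓ l r) = strips lo ℓ l ++ strips ℓ hi r

foldr-∷ : ∀ {A : Set} (xs ys : List A) → foldr _∷_ ys xs ≡ xs ++ ys
foldr-∷ []       ys = refl
foldr-∷ (x ∷ xs) ys = cong (x ∷_) (foldr-∷ xs ys)

-- The general accumulator is needed because the right subtree is finished first. It hands over `ℓ`,
-- which is both the left side of its first strip and the right side of the strip of the left
-- subtree.
cut-lines : ∀ lo hi T acc → foldr (λ ℓ b → ℓ , (ℓ , proj₁ b) ∷ proj₂ b) (hi , acc) (lo ∷ lines T) ≡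
            (lo , strips lo hi T ++ acc)
cut-lines lo hi leaf         acc = refl
cut-lines lo hi (node ℓ l r) acc = begin
  foldr f (hi , acc) (lo ∷ foldr _∷_ (ℓ ∷ lines r) (lines l))
    ≡⟨ cong (λ z → foldr f (hi , acc) (lo ∷ z)) (foldr-∷ (lines l) _) ⟩
  foldr f (hi , acc) ((lo ∷ lines l) ++ ℓ ∷ lines r)
    ≡⟨ foldr-++ f (hi , acc) (lo ∷ lines l) (ℓ ∷ lines r) ⟩
  foldr f (foldr f (hi , acc) (ℓ ∷ lines r)) (lo ∷ lines l)
    ≡⟨ cong (λ z → foldr f z (lo ∷ lines l)) (cut-lines ℓ hi r acc) ⟩
  foldr f (ℓ , strips ℓ hi r ++ acc) (lo ∷ lines l)
    ≡⟨ cut-lines lo ℓ l (strips ℓ hi r ++ acc) ⟩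
  lo , strips lo ℓ l ++ strips ℓ hi r ++ acc
    ≡⟨ cong (lo ,_) (sym (++-assoc (strips lo ℓ l) _ acc)) ⟩
  lo , (strips lo ℓ l ++ strips ℓ hi r) ++ acc ∎
  where
  open ≡-Reasoning
  f : ℤ → ℤ × List Point → ℤ × List Point
  f ℓ b = ℓ , (ℓ , proj₁ b) ∷ proj₂ b

leftmost-bound : ∀ m ps → let n = foldr (λ q m → if xc q ≤ᵇ m then xc q else m) m ps in
  n ℤ.≤ m × (∀ {q} → q ∈ ps → n ℤ.≤ xc q) × (n ≡ m ⊎ (∃[ q ] q ∈ ps × xc q ≡ n))
leftmost-bound m []       = ℤ.≤-refl , (λ ()) , inj₁ refl
leftmost-bound m (q ∷ ps) with leftmost-bound m ps
... | ≤m , ≤ps , att with xc q ℤ.≤? foldr (λ q m → if xc q ≤ᵇ m then xc q else m) m ps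
...   | yes le = ℤ.≤-trans le ≤m
               , (λ { (here refl) → ℤ.≤-refl ; (there i) → ℤ.≤-trans le (≤ps i) })
               , inj₂ (q , here refl , refl)
...   | no nle = ≤m
               , (λ { (here refl) → ℤ.<⇒≤ (ℤ.≰⇒> nle) ; (there i) → ≤ps i })
               , [ inj₁ , (λ (q , i , e) → inj₂ (q , there i , e)) ]′ att

rightmost-bound : ∀ m ps → let n = foldr (λ q m → if m ≤ᵇ xc q then xc q else m) m ps in
  m ℤ.≤ n × (∀ {q} → q ∈ ps → xc q ℤ.≤ n) × (n ≡ m ⊎ (∃[ q ] q ∈ ps × xc q ≡ n))
rightmost-bound m []       = ℤ.≤-refl , (λ ()) , inj₁ refl
rightmost-bound m (q ∷ ps) with rightmost-bound m ps
... | ≤m , ≤ps , att with foldr (λ q m → if m ≤ᵇ xc q then xc q else m) m ps ℤ.≤? xc q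
...   | yes le = ℤ.≤-trans ≤m le
               , (λ { (here refl) → ℤ.≤-refl ; (there i) → ℤ.≤-trans (≤ps i) le })
               , inj₂ (q , here refl , refl)
...   | no nle = ≤m
               , (λ { (here refl) → ℤ.<⇒≤ (ℤ.≰⇒> nle) ; (there i) → ≤ps i })
               , [ inj₁ , (λ (q , i , e) → inj₂ (q , there i , e)) ]′ att

leftmost-correct : ∀ {X lo hi} → BoundingStrip X lo hi → leftmost X ≡ lo
leftmost-correct {[]}     ((_ , () , _) , _)
leftmost-correct {p ∷ ps} ((q , q∈ , refl) , _ , inside) with leftmost-bound (xc p) ps
... | ≤p , ≤ps , att = ℤ.≤-antisym (below q∈) (above att)
  where
  n = leftmost (p ∷ ps)
  below : ∀ {q} → q ∈ p ∷ ps → n ℤ.≤ xc q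
  below (here refl) = ≤p
  below (there i)   = ≤ps i
  above : (n ≡ xc p ⊎ (∃[ r ] r ∈ ps × xc r ≡ n)) → xc q ℤ.≤ n
  above (inj₁ eq)            = subst (xc q ℤ.≤_) (sym eq) (proj₁ (inside p (here refl)))
  above (inj₂ (r , r∈ , eq)) = subst (xc q ℤ.≤_) eq (proj₁ (inside r (there r∈)))

rightmost-correct : ∀ {X lo hi} → BoundingStrip X lo hi → rightmost X ≡ hi
rightmost-correct {[]}     ((_ , () , _) , _)
rightmost-correct {p ∷ ps} (_ , (q , q∈ , refl) , inside) with rightmost-bound (xc p) ps
... | ≤p , ≤ps , att = ℤ.≤-antisym (above att) (below q∈)
  where
  n = rightmost (p ∷ ps)
  below : ∀ {q} → q ∈ p ∷ ps → xc q ℤ.≤ n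
  below (here refl) = ≤p
  below (there i)   = ≤ps i
  above : (n ≡ xc p ⊎ (∃[ r ] r ∈ ps × xc r ≡ n)) → n ℤ.≤ xc q
  above (inj₁ eq)            = subst (ℤ._≤ xc q) (sym eq) (proj₂ (inside p (here refl)))
  above (inj₂ (r , r∈ , eq)) = subst (ℤ._≤ xc q) eq (proj₂ (inside r (there r∈)))

leafStrips-correct : ∀ {X lo hi} T → BoundingStrip X lo hi → leafStrips X T ≡ strips lo hi T
leafStrips-correct {X} {lo} {hi} T B = begin
  proj₂ (cut (leftmost X ∷ lines T) (rightmost X))
    ≡⟨ cong₂ (λ a b → proj₂ (cut (a ∷ lines T) b)) (leftmost-correct B) (rightmost-correct B) ⟩
  proj₂ (cut (lo ∷ lines T) hi) ≡⟨ cong proj₂ (cut-lines lo hi T []) ⟩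
  strips lo hi T ++ []          ≡⟨ ++-identityʳ _ ⟩
  strips lo hi T ∎
  where open ≡-Reasoning

bounding-≤ : ∀ {X lo hi} → BoundingStrip X lo hi → lo ℤ.≤ hi
bounding-≤ (_ , (q , q∈ , refl) , inside) = proj₁ (inside q q∈)

strip-bounds : ∀ {X lo hi T σ} → lo ℤ.≤ hi → Partitions X lo hi T → σ ∈ strips lo hi T →
  lo ℤ.≤ proj₁ σ × proj₁ σ ℤ.≤ proj₂ σ × proj₂ σ ℤ.≤ hi
strip-bounds lo≤hi (leaf _) (here refl) = ℤ.≤-refl , lo≤hi , ℤ.≤-refl
strip-bounds {lo = lo} lo≤hi (node {ℓ} {l} _ lo<ℓ ℓ<hi pl pr) σ∈ with ∈-++⁻ (strips lo ℓ l) σ∈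
... | inj₁ i with strip-bounds (ℤ.<⇒≤ lo<ℓ) pl i
...   | u , v , w = u , v , ℤ.≤-trans w (ℤ.<⇒≤ ℓ<hi)
strip-bounds lo≤hi (node _ lo<ℓ ℓ<hi pl pr) σ∈ | inj₂ i with strip-bounds (ℤ.<⇒≤ ℓ<hi) pr i
...   | u , v , w = ℤ.≤-trans (ℤ.<⇒≤ lo<ℓ) u , v , w

strip-nondegenerate : ∀ {X lo hi T σ} → lo ℤ.< hi → Partitions X lo hi T → σ ∈ strips lo hi T →
  proj₁ σ ℤ.< proj₂ σ
strip-nondegenerate lo<hi (leaf _) (here refl) = lo<hi
strip-nondegenerate {lo = lo} lo<hi (node {ℓ} {l} _ lo<ℓ ℓ<hi pl pr) σ∈ with ∈-++⁻ (strips lo ℓ l) σ∈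
... | inj₁ i = strip-nondegenerate lo<ℓ pl i
... | inj₂ i = strip-nondegenerate ℓ<hi pr i

left-before-right : ∀ {X lo ℓ hi l r σ τ} → lo ℤ.< ℓ → ℓ ℤ.< hi →
  Partitions X lo ℓ l → Partitions X ℓ hi r →
  σ ∈ strips lo ℓ l → τ ∈ strips ℓ hi r → Before σ τ
left-before-right lo<ℓ ℓ<hi pl pr i j =
  strip-nondegenerate lo<ℓ pl i , strip-nondegenerate ℓ<hi pr j ,
  ℤ.≤-trans (proj₂ (proj₂ (strip-bounds (ℤ.<⇒≤ lo<ℓ) pl i))) (proj₁ (strip-bounds (ℤ.<⇒≤ ℓ<hi) pr j))

strips-comparable : ∀ {X lo hi T σ τ} → Partitions X lo hi T →
  σ ∈ strips lo hi T → τ ∈ strips lo hi T → Comparable σ τ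
strips-comparable (leaf _) (here refl) (here refl) = inj₁ refl
strips-comparable {lo = lo} (node {ℓ} {l} _ lo<ℓ ℓ<hi pl pr) σ∈ τ∈
  with ∈-++⁻ (strips lo ℓ l) σ∈ | ∈-++⁻ (strips lo ℓ l) τ∈
... | inj₁ i | inj₁ j = strips-comparable pl i j
... | inj₂ i | inj₂ j = strips-comparable pr i j
... | inj₁ i | inj₂ j = inj₂ (inj₁ (left-before-right lo<ℓ ℓ<hi pl pr i j))
... | inj₂ i | inj₁ j = inj₂ (inj₂ (left-before-right lo<ℓ ℓ<hi pl pr j i))

strips-unique : ∀ {X lo hi T} → Partitions X lo hi T → Unique (map proj₁ (strips lo hi T))
strips-unique (leaf _) = [] ∷ []
strips-unique {lo = lo} {hi} (node {ℓ} {l} {r} _ lo<ℓ ℓ<hi pl pr) =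
  subst Unique (sym (map-++ proj₁ (strips lo ℓ l) (strips ℓ hi r)))
    (Unique.++⁺ (strips-unique pl) (strips-unique pr) disjoint)
  where
  disjoint : ∀ {a} → ¬ (a ∈ map proj₁ (strips lo ℓ l) × a ∈ map proj₁ (strips ℓ hi r))
  disjoint (i , j) with ∈-map⁻ _ i | ∈-map⁻ _ j
  ... | σ , σ∈ , refl | τ , τ∈ , eq with left-before-right lo<ℓ ℓ<hi pl pr σ∈ τ∈
  ...   | a<b , _ , b≤a′ = ℤ.<-irrefl eq (ℤ.<-≤-trans a<b b≤a′)

strip-boundaryLine : ∀ {lo hi T σ} → σ ∈ strips lo hi T → Strip lo hi T (proj₁ σ) (proj₂ σ)
strip-boundaryLine {T = leaf}       (here refl) = here
strip-boundaryLine {lo} {T = node ℓ l r} σ∈ with ∈-++⁻ (strips lo ℓ l) σ∈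
... | inj₁ i = left (strip-boundaryLine i)
... | inj₂ i = right (strip-boundaryLine i)

strip-column : ∀ {X lo hi T σ} → Partitions X lo hi T → σ ∈ strips lo hi T →
  ∀ {x y} → ActiveColumn X x → ActiveColumn X y → InStrip σ x → InStrip σ y → x ≡ y
strip-column (leaf (z , _ , only)) (here refl) ax ay (p , q) (r , s) =
  trans (sym (only (ax , p , q))) (only (ay , r , s))
strip-column {lo = lo} (node {ℓ} {l} _ _ _ pl pr) σ∈ with ∈-++⁻ (strips lo ℓ l) σ∈
... | inj₁ i = strip-column pl i
... | inj₂ i = strip-column pr i

-- The left line of the strip containing x; abscissas outside the root
-- strip go to the first or the last strip.
locate : ℤ → Tree → ℤ → ℤ
locate lo leaf         x = lo
locate lo (node ℓ l r) x = if x ≤ᵇ ℓ then locate lo l x else locate ℓ r x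

locate-strip : ∀ lo hi T x → ∃[ σ ] σ ∈ strips lo hi T × proj₁ σ ≡ locate lo T x
locate-strip lo hi leaf         x = (lo , hi) , here refl , refl
locate-strip lo hi (node ℓ l r) x with x ℤ.≤? ℓ
... | yes _ with locate-strip lo ℓ l x
...   | σ , i , eq = σ , ∈-++⁺ˡ i , eq
locate-strip lo hi (node ℓ l r) x | no _ with locate-strip ℓ hi r x
...   | σ , i , eq = σ , ∈-++⁺ʳ (strips lo ℓ l) i , eq

locate-bounds : ∀ {X lo hi T} → lo ℤ.≤ hi → Partitions X lo hi T → ∀ x →
  lo ℤ.≤ locate lo T x × locate lo T x ℤ.≤ hi
locate-bounds {lo = lo} {hi} {T} lo≤hi P x with locate-strip lo hi T x
... | σ , i , eq with strip-bounds lo≤hi P i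
...   | u , v , w = subst (lo ℤ.≤_) eq u , subst (ℤ._≤ hi) eq (ℤ.≤-trans v w)

-- Across a line the order is kept because the left subtree only yields values up to `ℓ` and the
-- right subtree only values from `ℓ` on.
locate-mono : ∀ {X lo hi T} → Partitions X lo hi T → Monotone (locate lo T)
locate-mono (leaf _) i≤j = ℤ.≤-refl
locate-mono {lo = lo} {hi} (node {ℓ} {l} {r} _ lo<ℓ ℓ<hi pl pr) {i} {j} i≤j with i ℤ.≤? ℓ | j ℤ.≤? ℓ
... | yes _ | yes _ = locate-mono pl i≤j
... | no _  | no _  = locate-mono pr i≤j
... | yes _ | no _  = ℤ.≤-trans (proj₂ (locate-bounds (ℤ.<⇒≤ lo<ℓ) pl i)) (proj₁ (locate-bounds (ℤ.<⇒≤ ℓ<hi) pr j))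
... | no n  | yes q = ⊥-elim (n (ℤ.≤-trans i≤j q))

locate-inStrip : ∀ {X lo hi T x} → Partitions X lo hi T → lo ℤ.≤ x → x ℤ.≤ hi →
  ∃[ σ ] σ ∈ strips lo hi T × InStrip σ x
locate-inStrip {lo = lo} {hi} (leaf _) l u = (lo , hi) , here refl , l , u
locate-inStrip {lo = lo} {x = x} (node {ℓ} {tl} _ _ _ pl pr) l u with ℤ.≤-total x ℓ
... | inj₁ le with locate-inStrip pl l le
...   | σ , i , s = σ , ∈-++⁺ˡ i , s
locate-inStrip {lo = lo} (node {ℓ} {tl} _ _ _ pl pr) l u | inj₂ ge with locate-inStrip pr ge u
...   | σ , i , s = σ , ∈-++⁺ʳ (strips lo ℓ tl) i , s

-- Integer points have even abscissas in half-units, hence avoid the lines.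
locate-exact : ∀ {X lo hi T x σ} → lo ℤ.≤ hi → Partitions X lo hi T → + 2 ∣ x →
  σ ∈ strips lo hi T → InStrip σ x → locate lo T x ≡ proj₁ σ
locate-exact lo≤hi (leaf _) ev (here refl) s = refl
locate-exact {lo = lo} {x = x} lo≤hi (node {ℓ} {tl} (half , _) lo<ℓ ℓ<hi pl pr) ev σ∈ s
  with x ℤ.≤? ℓ | ∈-++⁻ (strips lo ℓ tl) σ∈
... | yes _  | inj₁ i = locate-exact (ℤ.<⇒≤ lo<ℓ) pl ev i s
... | no _   | inj₂ i = locate-exact (ℤ.<⇒≤ ℓ<hi) pr ev i s
... | no nle | inj₁ i = ⊥-elim (nle (ℤ.≤-trans (proj₂ s) (proj₂ (proj₂ (strip-bounds (ℤ.<⇒≤ lo<ℓ) pl i)))))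
... | yes le | inj₂ i = ⊥-elim (half (subst (+ 2 ∣_)
      (ℤ.≤-antisym le (ℤ.≤-trans (proj₁ (strip-bounds (ℤ.<⇒≤ ℓ<hi) pr i)) (proj₁ s))) ev))

-- The number of leaf strips against the number of active columns

unique-⊆-length : ∀ {A : Set} {xs ys : List A} → Unique xs → (∀ {x} → x ∈ xs → x ∈ ys) →
                  length xs ≤ length ys
unique-⊆-length {xs = []}     u inc = z≤n
unique-⊆-length {xs = x ∷ xs} (x∉ ∷ u) inc with ∈-∃++ (inc (here refl))
... | as , bs , refl = begin
  suc (length xs)             ≤⟨ s≤s (unique-⊆-length u skip) ⟩
  suc (length (as ++ bs))     ≡⟨ cong suc (length-++ as) ⟩
  suc (length as + length bs) ≡⟨ sym (+-suc (length as) (length bs)) ⟩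
  length as + length (x ∷ bs) ≡⟨ sym (length-++ as) ⟩
  length (as ++ x ∷ bs)       ∎
  where
  open ≤-Reasoning
  skip : ∀ {y} → y ∈ xs → y ∈ as ++ bs
  skip y∈ with ∈-++⁻ as (inc (there y∈))
  ... | inj₁ i         = ∈-++⁺ˡ i
  ... | inj₂ (here e)  = ⊥-elim (All.lookup x∉ y∈ (sym e))
  ... | inj₂ (there i) = ∈-++⁺ʳ as i

columns : ∀ {X lo hi T} → Partitions X lo hi T → List ℤ
columns (leaf (x , _))      = x ∷ []
columns (node _ _ _ pl pr)  = columns pl ++ columns pr

columns-length : ∀ {X lo hi T} (P : Partitions X lo hi T) → length (columns P) ≡ length (strips lo hi T)
columns-length (leaf _) = refl
columns-length {lo = lo} (node {ℓ} {l} _ _ _ pl pr) = trans (length-++ (columns pl))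
  (trans (cong₂ _+_ (columns-length pl) (columns-length pr)) (sym (length-++ (strips lo ℓ l))))

columns-active : ∀ {X lo hi T} (P : Partitions X lo hi T) → lo ℤ.≤ hi → ∀ {x} → x ∈ columns P →
  ActiveColumn X x × lo ℤ.≤ x × x ℤ.≤ hi
columns-active (leaf (_ , a , _)) _ (here refl) = a
columns-active (node _ lo<ℓ ℓ<hi pl pr) _ x∈ with ∈-++⁻ (columns pl) x∈
... | inj₁ i with columns-active pl (ℤ.<⇒≤ lo<ℓ) i
...   | a , l , u = a , l , ℤ.≤-trans u (ℤ.<⇒≤ ℓ<hi)
columns-active (node _ lo<ℓ ℓ<hi pl pr) _ x∈ | inj₂ i with columns-active pr (ℤ.<⇒≤ ℓ<hi) i
...   | a , l , u = a , ℤ.≤-trans (ℤ.<⇒≤ lo<ℓ) l , u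

columns-unique : ∀ {X lo hi T} → All IntegerPoint X → (P : Partitions X lo hi T) → lo ℤ.≤ hi →
  Unique (columns P)
columns-unique ev (leaf _) _ = [] ∷ []
columns-unique {X} ev (node {ℓ} (half , _) lo<ℓ ℓ<hi pl pr) _ =
  Unique.++⁺ (columns-unique ev pl (ℤ.<⇒≤ lo<ℓ)) (columns-unique ev pr (ℤ.<⇒≤ ℓ<hi)) disjoint
  where
  disjoint : ∀ {x} → ¬ (x ∈ columns pl × x ∈ columns pr)
  disjoint (i , j) with columns-active pl (ℤ.<⇒≤ lo<ℓ) i | columns-active pr (ℤ.<⇒≤ ℓ<hi) j
  ... | (p , p∈ , refl) , _ , u | _ , l , _ =
    half (subst (+ 2 ∣_) (ℤ.≤-antisym u l) (All.lookup ev p∈))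

-- Every leaf strip has an active column, and no column serves two leaves: it would lie on a line
-- separating them, which is half-integral.
strips-length : ∀ {X lo hi T} → All IntegerPoint X → Partitions X lo hi T → lo ℤ.≤ hi →
  length (strips lo hi T) ≤ #columns X
strips-length {X} ev P lo≤hi = subst (_≤ #columns X) (columns-length P)
  (unique-⊆-length (columns-unique ev P lo≤hi) active)
  where
  active : ∀ {x} → x ∈ columns P → x ∈ deduplicate ℤ._≟_ (map xc X)
  active x∈ with columns-active P lo≤hi x∈
  ... | (p , p∈ , refl) , _ = ∈-deduplicate⁺ ℤ._≟_ (∈-map⁺ xc p∈)

nodes-strips : ∀ lo hi T → suc (#nodes T) ≡ length (strips lo hi T)
nodes-strips lo hi leaf         = refl
nodes-strips lo hi (node ℓ l r) = begin
  suc (suc (#nodes l + #nodes r))     ≡⟨ cong suc (sym (+-suc (#nodes l) (#nodes r))) ⟩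
  suc (#nodes l) + suc (#nodes r)     ≡⟨ cong₂ _+_ (nodes-strips lo ℓ l) (nodes-strips ℓ hi r) ⟩
  length (strips lo ℓ l) + length (strips ℓ hi r) ≡⟨ sym (length-++ (strips lo ℓ l)) ⟩
  length (strips lo ℓ l ++ strips ℓ hi r) ∎
  where open ≡-Reasoning

-- Boolean tests

≤-reflects : ∀ m n → Reflects (m ℤ.≤ n) (m ≤ᵇ n)
≤-reflects m n with m ℤ.≤? n
... | yes p = ofʸ p
... | no p  = ofⁿ p

module _ {P Q : Set} where

  and-reflects : ∀ {a b} → Reflects P a → Reflects Q b → Reflects (P × Q) (and a b)
  and-reflects (ofʸ p) (ofʸ q) = ofʸ (p , q)
  and-reflects (ofʸ _) (ofⁿ n) = ofⁿ (n ∘ proj₂)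
  and-reflects (ofⁿ n) _       = ofⁿ (n ∘ proj₁)

  or-reflects : ∀ {a b} → Reflects P a → Reflects Q b → Reflects (P ⊎ Q) (or a b)
  or-reflects (ofʸ p) _       = ofʸ (inj₁ p)
  or-reflects (ofⁿ _) (ofʸ q) = ofʸ (inj₂ q)
  or-reflects (ofⁿ m) (ofⁿ n) = ofⁿ [ m , n ]′

  imp-reflects : ∀ {a b} → Reflects P a → Reflects Q b → Reflects (P → Q) (imp a b)
  imp-reflects (ofʸ _) (ofʸ q) = ofʸ (λ _ → q)
  imp-reflects (ofʸ p) (ofⁿ n) = ofⁿ (λ f → n (f p))
  imp-reflects (ofⁿ n) _       = ofʸ (λ p → ⊥-elim (n p))

  reflects-map : ∀ {a} → (P → Q) → (Q → P) → Reflects P a → Reflects Q a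
  reflects-map f g (ofʸ p) = ofʸ (f p)
  reflects-map f g (ofⁿ n) = ofⁿ (n ∘ g)

reflects-true : ∀ {P : Set} {b} → Reflects P b → b ≡ true → P
reflects-true (ofʸ p) _ = p

true-reflects : ∀ {P : Set} {b} → Reflects P b → P → b ≡ true
true-reflects (ofʸ _) _ = refl
true-reflects (ofⁿ n) p = ⊥-elim (n p)

≡-reflects : ∀ m n → Reflects (m ≡ n) (m ≡ᵇ n)
≡-reflects m n = reflects-map (λ (p , q) → ℤ.≤-antisym p q) (λ { refl → ℤ.≤-refl , ℤ.≤-refl })
  (and-reflects (≤-reflects m n) (≤-reflects n m))

module _ {A : Set} {P : A → Set} {f : A → Bool} (r : ∀ a → Reflects (P a) (f a)) where

  every-reflects : ∀ xs → Reflects (∀ {a} → a ∈ xs → P a) (every f xs)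
  every-reflects []       = ofʸ (λ ())
  every-reflects (x ∷ xs) =
    reflects-map extend restrict (and-reflects (r x) (every-reflects xs))
    where
    extend : P x × (∀ {a} → a ∈ xs → P a) → ∀ {a} → a ∈ x ∷ xs → P a
    extend (p , q) (here refl) = p
    extend (p , q) (there i)   = q i

    restrict : (∀ {a} → a ∈ x ∷ xs → P a) → P x × (∀ {a} → a ∈ xs → P a)
    restrict h = h (here refl) , λ i → h (there i)

  some-reflects : ∀ xs → Reflects (∃[ a ] a ∈ xs × P a) (some f xs)
  some-reflects []       = ofⁿ (λ { (_ , () , _) })
  some-reflects (x ∷ xs) = reflects-map
    (λ { (inj₁ p) → x , here refl , p ; (inj₂ (a , i , p)) → a , there i , p })
    (λ { (a , here refl , p) → inj₁ p ; (a , there i , p) → inj₂ (a , i , p) })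
    (or-reflects (r x) (some-reflects xs))

InBetween : ℤ → ℤ → ℤ → Set
InBetween k a b = (a ℤ.≤ k × k ℤ.≤ b) ⊎ (b ℤ.≤ k × k ℤ.≤ a)

between-reflects : ∀ k a b → Reflects (InBetween k a b) (between k a b)
between-reflects k a b = or-reflects (and-reflects (≤-reflects a k) (≤-reflects k b))
                                     (and-reflects (≤-reflects b k) (≤-reflects k a))

-- The pair of a touched cell g of the new row and the last point of
-- another column is satisfied, by an older point or by one of the new row.
SupportedBy : ℤ → State → State → Cell → Cell → Set
SupportedBy t H G g q = lft g ≡ lft q ⊎
  ((∃[ r ] r ∈ H × InBetween (lft r) (lft q) (lft g) × lvl q ℤ.≤ lvl r × lft r ≢ lft q) ⊎
   (∃[ r ] r ∈ G × InBetween (lft r) (lft q) (lft g) × t ℤ.≤ lvl r × lft r ≢ lft g))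

Valid : ℤ → State → State → ℤ → Set
Valid t H G x = ∀ {g} → g ∈ G →
  (InStrip (proj₁ g) x → t ℤ.≤ lvl g) ×
  (t ℤ.≤ lvl g → ∀ {q} → q ∈ H → + 1 ℤ.≤ lvl q → SupportedBy t H G g q)

valid-reflects : ∀ t H G x → Reflects (Valid t H G x) (valid t H G x)
valid-reflects t H G x = every-reflects (λ g → and-reflects
  (imp-reflects (and-reflects (≤-reflects (lft g) x) (≤-reflects x (rgt g))) (≤-reflects t (lvl g)))
  (imp-reflects (≤-reflects t (lvl g)) (every-reflects (λ q →
    imp-reflects (≤-reflects (+ 1) (lvl q)) (or-reflects (≡-reflects (lft g) (lft q)) (or-reflects
      (some-reflects (λ r → and-reflects (between-reflects (lft r) (lft q) (lft g))
        (and-reflects (≤-reflects (lvl q) (lvl r)) (imp-reflects (≡-reflects (lft r) (lft q)) (ofⁿ λ ())))) H)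
      (some-reflects (λ r → and-reflects (between-reflects (lft r) (lft q) (lft g))
        (and-reflects (≤-reflects t (lvl r)) (imp-reflects (≡-reflects (lft r) (lft g)) (ofⁿ λ ())))) G)))) H))) G

-- Sorting and removing duplicates

insert-↭ : ∀ p ps → insert p ps ↭ p ∷ ps
insert-↭ p []       = ↭-refl
insert-↭ p (a ∷ ps) with insert p ps | insert-↭ p ps
... | []     | perm with () ← ↭-length perm
... | y ∷ ys | perm with yc a ℤ.≤? yc y
...   | yes _ = ↭-trans (↭-prep a perm) (↭-swap a p ↭-refl)
...   | no _  = ↭-trans (↭-swap y a ↭-refl) (↭-trans (↭-prep a perm) (↭-swap a p ↭-refl))

sort-↭ : ∀ X → sort X ↭ X
sort-↭ []      = ↭-refl
sort-↭ (p ∷ X) = ↭-trans (insert-↭ p (sort X)) (↭-prep p (sort-↭ X))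

Lower : Point → Point → Set
Lower p q = yc p ℤ.≤ yc q

insert-sorted : ∀ p {ps} → AllPairs Lower ps → AllPairs Lower (insert p ps)
insert-sorted p {[]}     [] = [] ∷ []
insert-sorted p {a ∷ ps} (a≤ ∷ s) with insert p ps | insert-↭ p ps | insert-sorted p s
... | []     | perm | _ with () ← ↭-length perm
... | y ∷ ys | perm | y≤ ∷ ss with yc a ℤ.≤? yc y
...   | yes le = (le ∷ All.map (ℤ.≤-trans le) y≤) ∷ y≤ ∷ ss
...   | no nle = (ya ∷ y≤) ∷ a≤ys ∷ ss
  where
  ya = ℤ.<⇒≤ (ℤ.≰⇒> nle)
  -- Only the inserted point can be lower than `a`, since all of `ps` lies at or above `a`.
  y≡p : y ≡ p
  y≡p with ∈-resp-↭ perm (here refl)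
  ... | here eq = eq
  ... | there i = ⊥-elim (nle (All.lookup a≤ i))
  a≤ys : All (Lower a) ys
  a≤ys = All-resp-↭ (↭-sym (drop-∷ (subst (λ z → z ∷ ys ↭ p ∷ ps) y≡p perm))) a≤

sort-sorted : ∀ X → AllPairs Lower (sort X)
sort-sorted []      = []
sort-sorted (p ∷ X) = insert-sorted p (sort-sorted X)

StrictlyLower : Point → Point → Set
StrictlyLower p q = yc p ℤ.< yc q

rows-unique : ∀ {X} → Unique X → SemiPermutation X → Unique (map yc X)
rows-unique {X} u semi = go u (λ i → i)
  where
  go : ∀ {Y} → Unique Y → (∀ {p} → p ∈ Y → p ∈ X) → Unique (map yc Y)
  go []       inc = []
  go {p ∷ Y} (p∉ ∷ u) inc = All.tabulate fresh ∷ go u (inc ∘ there)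
    where
    fresh : ∀ {y} → y ∈ map yc Y → yc p ≢ y
    fresh y∈ eq with ∈-map⁻ yc y∈
    ... | q , q∈ , refl with semi (yc p) (p , inc (here refl) , refl)
    ...   | z , _ , only = All.lookup p∉ q∈
            (trans (sym (only (inc (here refl) , refl))) (only (inc (there q∈) , sym eq)))

-- Strictness means that every entry of the sorted list opens a new row, so one step of the dynamic
-- program settles exactly one row.
sort-strict : ∀ {X} → Unique X → SemiPermutation X → AllPairs StrictlyLower (sort X)
sort-strict {X} u semi = AllPairs.zipWith (λ (p , q) → ℤ.≤∧≢⇒< p q)
  (sort-sorted X , AllPairs.map⁻ (↭ₛ.Unique-resp-↭ (setoid ℤ)
    (↭⇒↭ₛ (↭.map⁺ yc (↭-sym (sort-↭ X)))) (rows-unique u semi)))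

point-reflects : ∀ p q → Reflects (p ≡ q) (and (xc p ≡ᵇ xc q) (yc p ≡ᵇ yc q))
point-reflects p q = reflects-map (λ (e , f) → cong₂ _,_ e f) (λ { refl → refl , refl })
  (and-reflects (≡-reflects (xc p) (xc q)) (≡-reflects (yc p) (yc q)))

member : Point → List Point → Bool
member p = some (λ q → and (xc p ≡ᵇ xc q) (yc p ≡ᵇ yc q))

member-reflects : ∀ p s → Reflects (p ∈ s) (member p s)
member-reflects p s = reflects-map (λ { (_ , i , refl) → i }) (λ i → p , i , refl)
  (some-reflects (point-reflects p) s)

dedup-∈⁻ : ∀ {s p} → p ∈ dedup s → p ∈ s
dedup-∈⁻ {q ∷ s} p∈ with member q (dedup s)
... | true = there (dedup-∈⁻ p∈)
dedup-∈⁻ {q ∷ s} (here refl) | false = here refl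
dedup-∈⁻ {q ∷ s} (there p∈)  | false = there (dedup-∈⁻ p∈)

dedup-∈⁺ : ∀ {s p} → p ∈ s → p ∈ dedup s
dedup-∈⁺ {q ∷ s} p∈ with member q (dedup s) | member-reflects q (dedup s)
dedup-∈⁺ {q ∷ s} (here refl) | true  | ofʸ i = i
dedup-∈⁺ {q ∷ s} (there p∈)  | true  | _     = dedup-∈⁺ p∈
dedup-∈⁺ {q ∷ s} (here refl) | false | _     = here refl
dedup-∈⁺ {q ∷ s} (there p∈)  | false | _     = there (dedup-∈⁺ p∈)

dedup-unique : ∀ s → Unique (dedup s)
dedup-unique []      = []
dedup-unique (q ∷ s) with member q (dedup s) | member-reflects q (dedup s)
... | true  | _     = dedup-unique s
... | false | ofⁿ n = All.tabulate (λ { i refl → n i }) ∷ dedup-unique s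

dedup-length : ∀ s → length (dedup s) ≤ length s
dedup-length s = unique-⊆-length (dedup-unique s) (dedup-∈⁻ {s})

-- States

cart-product : ∀ {A : Set} (xs : List A) rest →
  foldr (λ w acc → foldr (λ r acc′ → (w ∷ r) ∷ acc′) acc rest) [] xs ≡
  cartesianProductWith List._∷_ xs rest
cart-product []       rest = refl
cart-product (x ∷ xs) rest = trans (append rest _) (cong (map (x ∷_) rest ++_) (cart-product xs rest))
  where
  append : ∀ rs acc → foldr (λ r acc′ → (x ∷ r) ∷ acc′) acc rs ≡ map (x ∷_) rs ++ acc
  append []       acc = refl
  append (r ∷ rs) acc = cong ((x ∷ r) ∷_) (append rs acc)

∈-cart⁺ : ∀ {A : Set} {xs : List A} {xss} → Pointwise _∈_ xs xss → xs ∈ cart xss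
∈-cart⁺ []       = here refl
∈-cart⁺ (_∷_ {y = ys} {ys = yss} p ps) =
  subst (_ ∈_) (sym (cart-product ys (cart yss))) (∈-cartesianProductWith⁺ List._∷_ p (∈-cart⁺ ps))

∈-cart⁻ : ∀ {A : Set} {xs : List A} xss → xs ∈ cart xss → Pointwise _∈_ xs xss
∈-cart⁻ []         (here refl) = []
∈-cart⁻ (ys ∷ xss) xs∈
  with ∈-cartesianProductWith⁻ List._∷_ ys (cart xss) (subst (_ ∈_) (cart-product ys (cart xss)) xs∈)
... | _ , _ , p , ps , refl = p ∷ ∈-cart⁻ xss ps

foldr-map : ∀ {A B : Set} (f : A → B) xs → foldr (λ x acc → f x ∷ acc) [] xs ≡ map f xs
foldr-map f xs = sym (map-is-foldr xs)

-- States are reasoned about as functions from left lines to levels. Comparing two states then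
-- becomes comparing functions on the strips.
graph : List Point → (ℤ → ℤ) → State
graph S h = map (λ σ → σ , h (proj₁ σ)) S

∈-graph : ∀ {S h g} → g ∈ graph S h → proj₁ g ∈ S × lvl g ≡ h (lft g)
∈-graph g∈ with ∈-map⁻ _ g∈
... | _ , σ∈ , refl = σ∈ , refl

graph-cong : ∀ S {h k} → (∀ {σ} → σ ∈ S → h (proj₁ σ) ≡ k (proj₁ σ)) → graph S h ≡ graph S k
graph-cong S eq = map-cong-local (All.tabulate (λ σ∈ → cong (_ ,_) (eq σ∈)))

override : ℤ → ℤ → (ℤ → ℤ) → ℤ → ℤ
override a v h k = if ⌊ k ℤ.≟ a ⌋ then v else h k

override-here : ∀ a {v h} → override a v h a ≡ v
override-here a with a ℤ.≟ a
... | yes _ = refl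
... | no n  = ⊥-elim (n refl)

override-there : ∀ {a v h k} → a ≢ k → override a v h k ≡ h k
override-there {a} {k = k} a≢k with k ℤ.≟ a
... | yes e = ⊥-elim (a≢k (sym e))
... | no _  = refl

-- Distinct left lines ensure that overriding one value leaves the other cells alone. Away from the
-- strips the function is arbitrary.
keyed-graph : ∀ {S} → Unique (map proj₁ S) → ∀ G → map proj₁ G ≡ S → ∃[ h ] G ≡ graph S h
keyed-graph u        []            refl = (λ k → k) , refl
keyed-graph (a∉ ∷ u) ((σ , v) ∷ G) refl with keyed-graph u G refl
... | h , eq = override (proj₁ σ) v h ,
  cong₂ _∷_ (cong (σ ,_) (sym (override-here (proj₁ σ) {v} {h})))
    (trans eq (graph-cong (map proj₁ G)
      (λ τ∈ → sym (override-there {v = v} {h} (All.lookup a∉ (∈-map⁺ proj₁ τ∈))))))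

cells : ∀ (W : List ℤ) (S : List Point) →
  foldr (λ σ acc → foldr (λ w acc′ → (σ , w) ∷ acc′) [] W ∷ acc) [] S ≡
  map (λ σ → map (σ ,_) W) S
cells W []      = refl
cells W (σ ∷ S) = cong₂ _∷_ (foldr-map (σ ,_) W) (cells W S)

graph∈states : ∀ {W S h} → (∀ {σ} → σ ∈ S → h (proj₁ σ) ∈ W) → graph S h ∈ states W S
graph∈states {W} {S} {h} range = ∈-cart⁺ (subst (Pointwise _∈_ (graph S h)) (sym (cells W S)) (go S range))
  where
  go : ∀ S → (∀ {σ} → σ ∈ S → h (proj₁ σ) ∈ W) → Pointwise _∈_ (graph S h) (map (λ σ → map (σ ,_) W) S)
  go []      range = []
  go (σ ∷ S) range = ∈-map⁺ (σ ,_) (range (here refl)) ∷ go S (λ i → range (there i))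

states⇒graph : ∀ {W S H} → Unique (map proj₁ S) → H ∈ states W S →
  ∃[ h ] H ≡ graph S h × (∀ {σ} → σ ∈ S → h (proj₁ σ) ∈ W)
states⇒graph {W} {S} {H} u H∈
  with go S (subst (Pointwise _∈_ H) (cells W S) (∈-cart⁻ _ H∈))
  where
  go : ∀ S {H} → Pointwise _∈_ H (map (λ σ → map (σ ,_) W) S) →
       map proj₁ H ≡ S × (∀ {g} → g ∈ H → lvl g ∈ W)
  go []      []       = refl , λ ()
  go (σ ∷ S) (p ∷ ps) with ∈-map⁻ (σ ,_) p | go S ps
  ... | w , w∈ , refl | eq , range = cong (σ ∷_) eq , λ { (here refl) → w∈ ; (there i) → range i }
... | keys , range with keyed-graph u H keys
...   | h , refl = h , refl , λ σ∈ → range (∈-map⁺ _ σ∈)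

touch : (ℤ → Bool) → ℤ → (ℤ → ℤ) → ℤ → ℤ
touch A t h a = if A a then t else h a

keepOrTouch : ℤ → Cell → List Cell
keepOrTouch t g = g ∷ (proj₁ g , t) ∷ []

options : ∀ t (H : State) → foldr (λ g acc → keepOrTouch t g ∷ acc) [] H ≡ map (keepOrTouch t) H
options t H = foldr-map _ H

touch∈choices : ∀ {t} S h A → graph S (touch A t h) ∈ choices t (graph S h)
touch∈choices {t} S h A =
  ∈-cart⁺ (subst (Pointwise _∈_ (graph S (touch A t h))) (sym (options t (graph S h))) (go S))
  where
  go : ∀ S → Pointwise _∈_ (graph S (touch A t h)) (map (keepOrTouch t) (graph S h))
  go []      = []
  go (σ ∷ S) = here-or-there ∷ go S
    where
    here-or-there : (σ , touch A t h (proj₁ σ)) ∈ (σ , h (proj₁ σ)) ∷ (σ , t) ∷ []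
    here-or-there with A (proj₁ σ)
    ... | true  = there (here refl)
    ... | false = here refl

-- All old levels are below `t`, so the set of touched strips can be read off the levels of `G`.
choices⇒touch : ∀ {t S h G} → Unique (map proj₁ S) → (∀ {σ} → σ ∈ S → h (proj₁ σ) ℤ.< t) →
  G ∈ choices t (graph S h) → ∃[ A ] G ≡ graph S (touch A t h)
choices⇒touch {t} {S} {h} {G} u small G∈
  with go S {G} small (subst (Pointwise _∈_ G) (options t (graph S h)) (∈-cart⁻ _ G∈))
  where
  go : ∀ S {G} → (∀ {σ} → σ ∈ S → h (proj₁ σ) ℤ.< t) →
       Pointwise _∈_ G (map (keepOrTouch t) (graph S h)) →
       map proj₁ G ≡ S × (∀ {g} → g ∈ G → lvl g ≡ (if t ≤ᵇ lvl g then t else h (lft g)))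
  go []      small []       = refl , λ ()
  go (σ ∷ S) small (p ∷ ps) with go S (small ∘ there) ps
  go (σ ∷ S) small (here refl ∷ ps) | eq , lv = cong (σ ∷_) eq , λ { (here refl) → kept ; (there i) → lv i }
    where
    kept : h (proj₁ σ) ≡ (if t ≤ᵇ h (proj₁ σ) then t else h (proj₁ σ))
    kept with t ℤ.≤? h (proj₁ σ)
    ... | yes le = ⊥-elim (ℤ.<⇒≱ (small (here refl)) le)
    ... | no _   = refl
  go (σ ∷ S) small (there (here refl) ∷ ps) | eq , lv = cong (σ ∷_) eq , λ { (here refl) → touched ; (there i) → lv i }
    where
    touched : t ≡ (if t ≤ᵇ t then t else h (proj₁ σ))
    touched with t ℤ.≤? t
    ... | yes _ = refl
    ... | no n  = ⊥-elim (n ℤ.≤-refl)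
... | keys , lv with keyed-graph u G keys
...   | g , refl = (λ a → t ≤ᵇ g a) , graph-cong S {g} (λ σ∈ → lv (∈-map⁺ _ σ∈))

full-graph : ∀ t S h → full t (graph S h) ≡ graph S (touch (λ _ → true) t h)
full-graph t S h = trans (foldr-map (λ g → proj₁ g , t) (graph S h)) (sym (map-∘ S))

normalise-graph : ∀ S g → normalise (graph S g) ≡ graph S (λ a → rank (graph S g) (g a))
normalise-graph S g = trans (foldr-map _ (graph S g)) (sym (map-∘ S))

blank-graph : ∀ S → blank S ≡ graph S (λ _ → + 0)
blank-graph S = foldr-map _ S

-- Optimality of the table

levels-∈⁺ : ∀ S {n} → n ≤ suc (length S) → + n ∈ levels S
levels-∈⁺ []      z≤n       = here refl
levels-∈⁺ []      (s≤s z≤n) = there (here refl)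
levels-∈⁺ (_ ∷ S) z≤n       = here refl
levels-∈⁺ (_ ∷ S) {suc n} (s≤s le) = there (subst₂ _∈_ (cong +_ (+-comm n 1))
  (sym (foldr-map (ℤ._+ + 1) (levels S))) (∈-map⁺ (ℤ._+ + 1) (levels-∈⁺ S le)))

levels-∈⁻ : ∀ S {w} → w ∈ levels S → ∃[ n ] n ≤ suc (length S) × w ≡ + n
levels-∈⁻ []      (here refl)         = 0 , z≤n , refl
levels-∈⁻ []      (there (here refl)) = 1 , ≤-refl , refl
levels-∈⁻ (_ ∷ S) (here refl)         = 0 , z≤n , refl
levels-∈⁻ (_ ∷ S) (there w∈)
  with ∈-map⁻ (ℤ._+ + 1) (subst (_ ∈_) (foldr-map (ℤ._+ + 1) (levels S)) w∈)
... | v , v∈ , refl with levels-∈⁻ S v∈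
...   | n , le , refl = suc n , s≤s le , cong +_ (+-comm n 1)

increments : ∀ {A : Set} k (xs : List A) → foldr (λ _ n → n ℤ.+ + 1) (+ k) xs ≡ + (k + length xs)
increments k []       = cong +_ (sym (+-identityʳ k))
increments k (x ∷ xs) = trans (cong (ℤ._+ + 1) (increments k xs))
  (cong +_ (trans (+-comm (k + length xs) 1) (sym (+-suc k (length xs)))))

below-top : ∀ S {w} → w ∈ levels S → w ℤ.< top S
below-top S w∈ with levels-∈⁻ S w∈
... | n , le , refl = subst (+ n ℤ.<_) (sym (increments 2 S)) (ℤ.+<+ (s≤s le))

above : State → ℤ → ℤ
above G v = foldr (λ r n → if v ≤ᵇ lvl r then n else n ℤ.+ + 1) (+ 1) G

above-range : ∀ G v → ∃[ n ] n ≤ length G × above G v ≡ + suc n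
above-range []      v = 0 , z≤n , refl
above-range (r ∷ G) v with v ≤ᵇ lvl r | above-range G v
... | true  | n , le , eq = n , m≤n⇒m≤1+n le , eq
... | false | n , le , eq = suc n , s≤s le , trans (cong (ℤ._+ + 1) eq) (cong +_ (+-comm (suc n) 1))

1≤above : ∀ G v → + 1 ℤ.≤ above G v
1≤above G v with above-range G v
... | n , _ , eq = subst (+ 1 ℤ.≤_) (sym eq) (ℤ.+≤+ (s≤s z≤n))

+1-mono : ∀ {i j} → i ℤ.≤ j → i ℤ.+ + 1 ℤ.≤ j ℤ.+ + 1
+1-mono = ℤ.+-monoˡ-≤ (+ 1)

i≤i+1 : ∀ i → i ℤ.≤ i ℤ.+ + 1
i≤i+1 i = ℤ.i≤i+j i (+ 1)

i<i+1 : ∀ i → i ℤ.< i ℤ.+ + 1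
i<i+1 i = subst (ℤ._< i ℤ.+ + 1) (ℤ.+-identityʳ i) (ℤ.+-monoʳ-< i (ℤ.+<+ (s≤s z≤n)))

above-mono : ∀ G {v w} → v ℤ.≤ w → above G v ℤ.≤ above G w
above-mono []      le = ℤ.≤-refl
above-mono (r ∷ G) {v} {w} le with v ℤ.≤? lvl r | w ℤ.≤? lvl r
... | yes _ | yes _ = above-mono G le
... | yes _ | no _  = ℤ.≤-trans (above-mono G le) (i≤i+1 _)
... | no n  | yes q = ⊥-elim (n (ℤ.≤-trans le q))
... | no _  | no _  = +1-mono (above-mono G le)

-- The cell `r` is counted for `w` but not for its own level.
above-strict : ∀ {G r w} → r ∈ G → lvl r ℤ.< w → above G (lvl r) ℤ.< above G w
above-strict {r ∷ G} {w = w} (here refl) lt with lvl r ℤ.≤? lvl r | w ℤ.≤? lvl r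
... | yes _ | no _  = ℤ.≤-<-trans (above-mono G (ℤ.<⇒≤ lt)) (i<i+1 _)
... | no n  | _     = ⊥-elim (n ℤ.≤-refl)
... | yes _ | yes q = ⊥-elim (ℤ.<⇒≱ lt q)
above-strict {q ∷ G} {r} {w} (there r∈) lt with lvl r ℤ.≤? lvl q | w ℤ.≤? lvl q
... | yes _ | yes _ = above-strict r∈ lt
... | yes _ | no _  = ℤ.<-trans (above-strict r∈ lt) (i<i+1 _)
... | no n  | yes q = ⊥-elim (n (ℤ.≤-trans (ℤ.<⇒≤ lt) q))
... | no _  | no _  = ℤ.+-monoˡ-< (+ 1) (above-strict r∈ lt)

rank-positive : ∀ G {v} → + 1 ℤ.≤ v → rank G v ≡ above G v
rank-positive G {v} le with v ℤ.≤? + 0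
... | yes q = ⊥-elim (ℤ.<⇒≱ {+ 0} {+ 1} (ℤ.+<+ (s≤s z≤n)) (ℤ.≤-trans le q))
... | no _  = refl

positive-rank : ∀ G {v} → + 1 ℤ.≤ rank G v → + 1 ℤ.≤ v
positive-rank G {v} le with v ℤ.≤? + 0
... | yes _ = ⊥-elim (ℤ.<⇒≱ {+ 0} {+ 1} (ℤ.+<+ (s≤s z≤n)) le)
... | no n  = ℤ.i<j⇒suc[i]≤j (ℤ.≰⇒> n)

rank-level : ∀ {S G} v → length G ≡ length S → rank G v ∈ levels S
rank-level {S} {G} v eq with v ℤ.≤? + 0
... | yes _ = levels-∈⁺ S z≤n
... | no _ with above-range G v
...   | n , le , e = subst (_∈ levels S) (sym e) (levels-∈⁺ S (s≤s (subst (n ≤_) eq le)))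

-- For every older column the rectangle has its corner in the new row, and this corner is touched
-- too.
full-valid : ∀ t H x → Valid t H (full t H) x
full-valid t H x {g} g∈ = (λ _ → touched) , λ _ {q} q∈ _ → supported q∈
  where
  full-map : full t H ≡ map (λ g → proj₁ g , t) H
  full-map = foldr-map _ H

  touched : t ℤ.≤ lvl g
  touched with ∈-map⁻ _ (subst (g ∈_) full-map g∈)
  ... | _ , _ , refl = ℤ.≤-refl

  supported : ∀ {q} → q ∈ H → SupportedBy t H (full t H) g q
  supported {q} q∈ with lft g ℤ.≟ lft q
  ... | yes eq = inj₁ eq
  ... | no neq = inj₂ (inj₂ ((proj₁ q , t) , subst (_ ∈_) (sym full-map) (∈-map⁺ _ q∈) ,
        inBetween , ℤ.≤-refl , (λ e → neq (sym e))))
    where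
    inBetween : InBetween (lft q) (lft q) (lft g)
    inBetween with ℤ.≤-total (lft q) (lft g)
    ... | inj₁ le = inj₁ (ℤ.≤-refl , le)
    ... | inj₂ ge = inj₂ (ge , ℤ.≤-refl)

-- A run of the dynamic program with its choices left open. It separates optimisation from geometry:
-- the table yields a shortest plan, every plan describes a satisfied set, and every satisfied set
-- on the grid that covers the rows yields a plan.
data Plan (t : ℤ) : List Point → State → List Point → Set where
  []   : ∀ {H} → Plan t [] H []
  next : ∀ {p ps G H s} → G ∈ choices t H → Valid t H G (xc p) →
         Plan t ps (normalise G) s → Plan t (p ∷ ps) H (double t (yc p) G s)

Matches : Cell → Cell → Set
Matches g q = lft g ≡ lft q × lvl g ≡ lvl q

subset-reflects : ∀ G H →
  Reflects (∀ {g} → g ∈ G → ∃[ q ] q ∈ H × Matches g q) (subset G H)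
subset-reflects G H = every-reflects (λ g → some-reflects (λ q →
  and-reflects (≡-reflects (lft g) (lft q)) (≡-reflects (lvl g) (lvl q))) H) G

subset-graph : ∀ S {h k} → subset (graph S h) (graph S k) ≡ true → graph S h ≡ graph S k
subset-graph S {h} {k} eq = graph-cong S agree
  where
  inc = reflects-true (subset-reflects (graph S h) (graph S k)) eq
  agree : ∀ {σ} → σ ∈ S → h (proj₁ σ) ≡ k (proj₁ σ)
  agree σ∈ with inc (∈-map⁺ _ σ∈)
  ... | q , q∈ , e , f with ∈-graph {S} {k} q∈
  ...   | _ , lv = trans f (trans lv (cong k (sym e)))

-- The one-sided test `subset` is equality between graphs over the same strips, so the first hit is
-- an entry for the wanted state.
find-graph : ∀ {S E} (F : State → List Point) h → (∀ {H} → H ∈ E → ∃[ k ] H ≡ graph S k) →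
  graph S h ∈ E → find (map (λ H → H , F H) E) (graph S h) ≡ F (graph S h)
find-graph {S} {e ∷ E} F h graphs h∈ with subset (graph S h) e in eq
find-graph {S} {e ∷ E} F h graphs h∈ | true with graphs (here refl)
... | k , refl = cong F (sym (subset-graph S {h} {k} eq))
find-graph {S} {e ∷ E} F h graphs (there h∈)  | false = find-graph F h (λ i → graphs (there i)) h∈
find-graph {S} {e ∷ E} F h graphs (here refl) | false with trans (sym eq)
    (true-reflects (subset-reflects (graph S h) (graph S h)) (λ {g} i → g , i , refl , refl))
... | ()

-- The principle of optimality: what a row adds does not depend on the completion, so a shorter
-- completion never does harm.
double-mono : ∀ t y G {s s′} → length s ≤ length s′ →
  length (double t y G s) ≤ length (double t y G s′)
double-mono t y []      le = le
double-mono t y (g ∷ G) le with t ≤ᵇ lvl g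
... | true  = s≤s (s≤s (double-mono t y G le))
... | false = double-mono t y G le

shorter-≤ : ∀ s s′ → length (shorter s s′) ≤ length s × length (shorter s s′) ≤ length s′ ×
  (shorter s s′ ≡ s ⊎ shorter s s′ ≡ s′)
shorter-≤ s s′ with len s ℤ.≤? len s′
... | yes le = ≤-refl ,
      ℤ.drop‿+≤+ (subst₂ ℤ._≤_ (increments 0 s) (increments 0 s′) le) , inj₁ refl
... | no nle = ℤ.drop‿+≤+ (subst₂ ℤ._≤_ (increments 0 s′) (increments 0 s) (ℤ.<⇒≤ (ℤ.≰⇒> nle))) ,
      ≤-refl , inj₂ refl

-- The starting value belongs to the valid choice `F`, so whatever the fold returns comes from a
-- valid choice.
shortest : ∀ (c : State → List Point) (v : State → Bool) F Gs → v F ≡ true → F ∈ Gs →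
  let b = foldr (λ G acc → if v G then shorter (c G) acc else acc) (c F) Gs in
  (∃[ G ] G ∈ Gs × v G ≡ true × b ≡ c G) × (∀ {G} → G ∈ Gs → v G ≡ true → length b ≤ length (c G))
shortest c v F Gs vF F∈ with go Gs
  where
  b : List State → List Point
  b = foldr (λ G acc → if v G then shorter (c G) acc else acc) (c F)
  go : ∀ Gs → (b Gs ≡ c F ⊎ (∃[ G ] G ∈ Gs × v G ≡ true × b Gs ≡ c G)) ×
              (∀ {G} → G ∈ Gs → v G ≡ true → length (b Gs) ≤ length (c G))
  go []       = inj₁ refl , λ ()
  go (G ∷ Gs) with v G in eq | go Gs
  ... | false | att , le = [ inj₁ , (λ (G′ , i , e) → inj₂ (G′ , there i , e)) ]′ att ,
        λ { (here refl) vG → ⊥-elim (false≢true (trans (sym eq) vG)) ; (there i) vG → le i vG }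
    where
    false≢true : false ≢ true
    false≢true ()
  ... | true | att , le with shorter-≤ (c G) (b Gs)
  ...   | l , r , which = attained which ,
          λ { (here refl) _ → l ; (there i) vG → ≤-trans r (le i vG) }
    where
    attained : shorter (c G) (b Gs) ≡ c G ⊎ shorter (c G) (b Gs) ≡ b Gs →
      shorter (c G) (b Gs) ≡ c F ⊎
      (∃[ G′ ] G′ ∈ G ∷ Gs × v G′ ≡ true × shorter (c G) (b Gs) ≡ c G′)
    attained (inj₁ e) = inj₂ (G , here refl , eq , e)
    attained (inj₂ e) = [ (λ f → inj₁ (trans e f))
                        , (λ (G′ , i , vG′ , f) → inj₂ (G′ , there i , vG′ , trans e f)) ]′ att
... | inj₁ e , le = (F , F∈ , vF , e) , le
... | inj₂ a , le = a , le

module Optimality (S : List Point) (u : Unique (map proj₁ S)) where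

  private
    t = top S
    E = states (levels S) S

  solution : List Point → State → List Point
  solution []       H = []
  solution (p ∷ ps) H = best t p (table t E ps) H

  table-solution : ∀ ps → table t E ps ≡ map (λ H → H , solution ps H) E
  table-solution []       = foldr-map _ E
  table-solution (p ∷ ps) = foldr-map _ E

  InRange : (ℤ → ℤ) → Set
  InRange h = ∀ {σ} → σ ∈ S → h (proj₁ σ) ∈ levels S

  find-solution : ∀ ps {h} → InRange h → find (table t E ps) (graph S h) ≡ solution ps (graph S h)
  find-solution ps {h} range = trans (cong (λ z → find z (graph S h)) (table-solution ps))
    (find-graph (solution ps) h (λ i → let k , eq , _ = states⇒graph {levels S} u i in k , eq)
      (graph∈states {h = h} range))

  rank-range : ∀ g → InRange (λ a → rank (graph S g) (g a))
  rank-range g {σ} _ = rank-level {S} {graph S g} (g (proj₁ σ)) (length-map _ S)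

  candidate-solution : ∀ p ps g → candidate t p (table t E ps) (graph S g) ≡
    double t (yc p) (graph S g) (solution ps (normalise (graph S g)))
  candidate-solution p ps g = cong (double t (yc p) (graph S g))
    (subst (λ z → find (table t E ps) z ≡ solution ps z) (sym (normalise-graph S g))
      (find-solution ps (rank-range g)))

  -- Normalisation brings the state after each choice back among the tabulated ones. Hence the
  -- lookup succeeds and the induction hypothesis applies to that state.
  optimal : ∀ ps {h} → InRange h → Plan t ps (graph S h) (solution ps (graph S h)) ×
    (∀ {s} → Plan t ps (graph S h) s → length (solution ps (graph S h)) ≤ length s)
  optimal []       range = [] , λ { [] → z≤n }
  optimal (p ∷ ps) {h} range with shortest (candidate t p (table t E ps)) (λ G → valid t H G (xc p))
      (full t H) (choices t H) (true-reflects (valid-reflects t H (full t H) (xc p)) (full-valid t H (xc p)))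
      (subst (_∈ choices t H) (sym (full-graph t S h)) (touch∈choices S h (λ _ → true)))
    where H = graph S h
  ... | (G , G∈ , vG , eq) , minimal = plan , least
    where
    H = graph S h

    ofChoice : ∀ {G} → G ∈ choices t H → ∃[ g ] G ≡ graph S g
    ofChoice G∈ with choices⇒touch {t} {S} {h} u (λ i → below-top S (range i)) G∈
    ... | A , refl = touch A t h , refl

    step-optimal : ∀ {G} → G ∈ choices t H → Plan t ps (normalise G) (solution ps (normalise G)) ×
      (∀ {s} → Plan t ps (normalise G) s → length (solution ps (normalise G)) ≤ length s) ×
      candidate t p (table t E ps) G ≡ double t (yc p) G (solution ps (normalise G))
    step-optimal G∈ with ofChoice G∈
    ... | g , refl with subst
           (λ z → Plan t ps z (solution ps z) × (∀ {s} → Plan t ps z s → length (solution ps z) ≤ length s))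
           (sym (normalise-graph S g)) (optimal ps (rank-range g))
    ...   | pl , le = pl , le , candidate-solution p ps g

    plan : Plan t (p ∷ ps) H (solution (p ∷ ps) H)
    plan with step-optimal G∈
    ... | pl , _ , c = subst (Plan t (p ∷ ps) H) (sym (trans eq c))
          (next G∈ (reflects-true (valid-reflects t H G (xc p)) vG) pl)

    least : ∀ {s} → Plan t (p ∷ ps) H s → length (solution (p ∷ ps) H) ≤ length s
    least (next {G = G′} G′∈ v pl) with step-optimal G′∈
    ... | _ , le , c = ≤-trans (minimal G′∈ (true-reflects (valid-reflects t H G′ (xc p)) v))
          (≤-trans (≤-reflexive (cong length c)) (double-mono t (yc p) G′ (le pl)))

-- States and histories

Last : List Point → ℤ → ℤ → Set
Last P a y = (a , y) ∈ P × (∀ {z} → (a , z) ∈ P → z ℤ.≤ y)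

RowsBelow : List Point → ℤ → Set
RowsBelow P y = ∀ {e} → e ∈ P → yc e ℤ.< y

∈-double⁻ : ∀ t y G {s z} → z ∈ double t y G s → z ∈ s ⊎
  (∃[ g ] g ∈ G × t ℤ.≤ lvl g × yc z ≡ y × (xc z ≡ lft g ⊎ xc z ≡ rgt g))
∈-double⁻ t y []      z∈ = inj₁ z∈
∈-double⁻ t y (g ∷ G) z∈ with t ℤ.≤? lvl g
∈-double⁻ t y (g ∷ G) (here refl)         | yes le = inj₂ (g , here refl , le , refl , inj₁ refl)
∈-double⁻ t y (g ∷ G) (there (here refl)) | yes le = inj₂ (g , here refl , le , refl , inj₂ refl)
∈-double⁻ t y (g ∷ G) (there (there z∈))  | yes _ with ∈-double⁻ t y G z∈
... | inj₁ i             = inj₁ i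
... | inj₂ (q , q∈ , rest) = inj₂ (q , there q∈ , rest)
∈-double⁻ t y (g ∷ G) z∈ | no _ with ∈-double⁻ t y G z∈
... | inj₁ i             = inj₁ i
... | inj₂ (q , q∈ , rest) = inj₂ (q , there q∈ , rest)

∈-double-tail : ∀ t y G {s z} → z ∈ s → z ∈ double t y G s
∈-double-tail t y []      z∈ = z∈
∈-double-tail t y (g ∷ G) z∈ with t ≤ᵇ lvl g
... | true  = there (there (∈-double-tail t y G z∈))
... | false = ∈-double-tail t y G z∈

∈-double⁺ : ∀ t y {G s g} → g ∈ G → t ℤ.≤ lvl g →
  (lft g , y) ∈ double t y G s × (rgt g , y) ∈ double t y G s
∈-double⁺ t y {g ∷ G} (here refl) le with t ℤ.≤? lvl g
... | yes _ = here refl , there (here refl)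
... | no n  = ⊥-elim (n le)
∈-double⁺ t y {q ∷ G} (there g∈) le with t ≤ᵇ lvl q | ∈-double⁺ t y g∈ le
... | true  | i , j = there (there i) , there (there j)
... | false | i , j = i , j

module History (S : List Point) (u : Unique (map proj₁ S)) where

  open Optimality S u public

  private
    t = top S
    C = map proj₁ S

  1≤t : + 1 ℤ.≤ t
  1≤t = subst (+ 1 ℤ.≤_) (sym (increments 2 S)) (ℤ.+≤+ (s≤s z≤n))

  ∈C⇒strip : ∀ {a} → a ∈ C → ∃[ σ ] σ ∈ S × a ≡ proj₁ σ
  ∈C⇒strip = ∈-map⁻ proj₁

  row : (ℤ → Bool) → ℤ → List Point
  row A y = map (_, y) (filter (λ a → A a Bool.≟ true) C)

  ∈-row⁺ : ∀ {A y a} → a ∈ C → A a ≡ true → (a , y) ∈ row A y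
  ∈-row⁺ {A} {y} a∈ eq = ∈-map⁺ (_, y) (∈-filter⁺ (λ a → A a Bool.≟ true) a∈ eq)

  ∈-row⁻ : ∀ {A y e} → e ∈ row A y → xc e ∈ C × A (xc e) ≡ true × yc e ≡ y
  ∈-row⁻ {A} {y} e∈ with ∈-map⁻ (_, y) e∈
  ... | a , a∈ , refl with ∈-filter⁻ (λ a → A a Bool.≟ true) {xs = C} a∈
  ...   | i , eq = i , eq , refl

  row-unique : ∀ A y → Unique (row A y)
  row-unique A y = Unique.map⁺ (cong proj₁) (Unique.filter⁺ (λ a → A a Bool.≟ true) u)

  -- The levels of h order the columns touched by P as their last points.
  record Tracks (h : ℤ → ℤ) (P : List Point) : Set where
    field
      column   : ∀ {a y} → (a , y) ∈ P → a ∈ C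
      positive : ∀ {a y} → (a , y) ∈ P → + 1 ℤ.≤ h a
      last     : ∀ {a} → a ∈ C → + 1 ℤ.≤ h a → ∃[ y ] Last P a y
      order    : ∀ {a b y z} → Last P a y → Last P b z → h a ℤ.≤ h b → y ℤ.≤ z
      order⁻   : ∀ {a b y z} → Last P a y → Last P b z → y ℤ.≤ z → h a ℤ.≤ h b

  blank-tracks : Tracks (λ _ → + 0) []
  blank-tracks = record
    { column   = λ ()
    ; positive = λ ()
    ; last     = λ { _ (ℤ.+≤+ ()) }
    ; order    = λ { (() , _) }
    ; order⁻   = λ { (() , _) }
    }

  SmallLevels : (ℤ → ℤ) → Set
  SmallLevels h = ∀ {a} → a ∈ C → h a ℤ.< t

  smallLevels : ∀ {h} → InRange h → SmallLevels h
  smallLevels range a∈ with ∈C⇒strip a∈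
  ... | σ , σ∈ , refl = below-top S (range σ∈)

  touch-true : ∀ {A h a} → A a ≡ true → touch A t h a ≡ t
  touch-true eq rewrite eq = refl

  touched : ∀ {A h a} → SmallLevels h → a ∈ C → t ℤ.≤ touch A t h a → A a ≡ true
  touched {A} {a = a} small a∈ le with A a
  ... | true  = refl
  ... | false = ⊥-elim (ℤ.<⇒≱ (small a∈) le)

  module _ {h : ℤ → ℤ} {P : List Point} {A : ℤ → Bool} {y : ℤ} (T : Tracks h P) (below : RowsBelow P y) (small : SmallLevels h) where
    open Tracks T

    private
      h′ = touch A t h
      P′ = row A y ++ P

    last-cases : ∀ {a z} → Last P′ a z → (h′ a ≡ t × z ≡ y) ⊎ (h′ a ≡ h a × Last P a z × a ∈ C)
    last-cases {a} {z} (z∈ , max) with A a in eq | ∈-++⁻ (row A y) z∈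
    ... | true  | inj₁ i = inj₁ (refl , proj₂ (proj₂ (∈-row⁻ {A} i)))
    ... | true  | inj₂ i = ⊥-elim (ℤ.<⇒≱ (below i) (max (∈-++⁺ˡ (∈-row⁺ {A} (column i) eq))))
    ... | false | inj₂ i = inj₂ (refl , (i , λ j → max (∈-++⁺ʳ (row A y) j)) , column i)
    ... | false | inj₁ i with trans (sym eq) (proj₁ (proj₂ (∈-row⁻ {A} i)))
    ...   | ()

    touch-tracks : Tracks h′ P′
    touch-tracks = record
      { column = col ; positive = pos ; last = lst ; order = ord ; order⁻ = ord⁻ }
      where
      col : ∀ {a z} → (a , z) ∈ P′ → a ∈ C
      col i with ∈-++⁻ (row A y) i
      ... | inj₁ j = proj₁ (∈-row⁻ {A} j)
      ... | inj₂ j = column j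

      pos : ∀ {a z} → (a , z) ∈ P′ → + 1 ℤ.≤ h′ a
      pos {a} i with A a in eq | ∈-++⁻ (row A y) i
      ... | true  | _      = 1≤t
      ... | false | inj₂ j = positive j
      ... | false | inj₁ j with trans (sym eq) (proj₁ (proj₂ (∈-row⁻ {A} j)))
      ...   | ()

      lst : ∀ {a} → a ∈ C → + 1 ℤ.≤ h′ a → ∃[ z ] Last P′ a z
      lst {a} a∈ le with A a in eq
      ... | true  = y , ∈-++⁺ˡ (∈-row⁺ {A} a∈ eq) , max
        where
        max : ∀ {z} → (a , z) ∈ P′ → z ℤ.≤ y
        max i with ∈-++⁻ (row A y) i
        ... | inj₁ j = ℤ.≤-reflexive (proj₂ (proj₂ (∈-row⁻ {A} j)))
        ... | inj₂ j = ℤ.<⇒≤ (below j)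
      ... | false with last a∈ le
      ...   | z , z∈ , max′ = z , ∈-++⁺ʳ (row A y) z∈ , max
        where
        max : ∀ {w} → (a , w) ∈ P′ → w ℤ.≤ z
        max i with ∈-++⁻ (row A y) i
        ... | inj₂ j = max′ j
        ... | inj₁ j with trans (sym eq) (proj₁ (proj₂ (∈-row⁻ {A} j)))
        ...   | ()

      ord : ∀ {a b w z} → Last P′ a w → Last P′ b z → h′ a ℤ.≤ h′ b → w ℤ.≤ z
      ord la lb le with last-cases la | last-cases lb
      ... | inj₁ (_ , refl)    | inj₁ (_ , refl)    = ℤ.≤-refl
      ... | inj₁ (e , refl)    | inj₂ (f , _ , b∈)  = ⊥-elim (ℤ.<⇒≱ (small b∈) (subst₂ ℤ._≤_ e f le))
      ... | inj₂ (_ , ka , _)  | inj₁ (_ , refl)    = ℤ.<⇒≤ (below (proj₁ ka))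
      ... | inj₂ (e , ka , _)  | inj₂ (f , kb , _)  = order ka kb (subst₂ ℤ._≤_ e f le)

      ord⁻ : ∀ {a b w z} → Last P′ a w → Last P′ b z → w ℤ.≤ z → h′ a ℤ.≤ h′ b
      ord⁻ la lb le with last-cases la | last-cases lb
      ... | inj₁ (e , refl)    | inj₁ (f , refl)    = ℤ.≤-reflexive (trans e (sym f))
      ... | inj₁ (e , refl)    | inj₂ (f , kb , _)  = ⊥-elim (ℤ.<⇒≱ (below (proj₁ kb)) le)
      ... | inj₂ (e , _ , a∈)  | inj₁ (f , refl)    = subst₂ ℤ._≤_ (sym e) (sym f) (ℤ.<⇒≤ (small a∈))
      ... | inj₂ (e , ka , _)  | inj₂ (f , kb , _)  = subst₂ ℤ._≤_ (sym e) (sym f) (order⁻ ka kb le)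

    -- If `q` is not the last point of its column, the last one is a witness. Otherwise validity
    -- names a supporting cell, either touched in the new row or last touched no earlier than `q`;
    -- `order` turns the comparison of levels into one of rows.
    cross-satisfied : ∀ {x} → Valid t (graph S h) (graph S h′) x →
      ∀ {p q} → p ∈ row A y → q ∈ P → xc p ≢ xc q → SatisfiedPair P′ p q
    cross-satisfied v {a , w} {b , s} i j a≢b with ∈-row⁻ {A} i
    ... | a∈ , Aa , refl with last (column j) (positive j) | ∈C⇒strip a∈ | ∈C⇒strip (column j)
    ...   | s′ , s′∈ , max | σ , σ∈ , refl | τ , τ∈ , refl with ℤ.<-cmp s s′
    ...     | tri> _ _ gt = ⊥-elim (ℤ.<⇒≱ gt (max j))
    ...     | tri< lt _ _ = (b , s′) , ∈-++⁺ʳ (row A y) s′∈ , (λ e → a≢b (sym (cong xc e))) ,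
              (λ e → ℤ.<-irrefl (sym (cong yc e)) lt) , Between-right a b ,
              Between-sym {s′} (≤⇒Between (ℤ.<⇒≤ lt) (ℤ.<⇒≤ (below s′∈)))
    ...     | tri≈ _ refl _ = support (proj₂ (v (∈-map⁺ _ σ∈)) (ℤ.≤-reflexive (sym (touch-true {A} {h} Aa)))
                                (∈-map⁺ _ τ∈) (positive j))
      where
      toBetween : ∀ {k} → InBetween k b a → Between k a b
      toBetween {k} (inj₁ (l , r)) = Between-sym {k} (≤⇒Between l r)
      toBetween     (inj₂ (l , r)) = ≤⇒Between l r

      support : SupportedBy t (graph S h) (graph S h′) (σ , h′ a) (τ , h b) → SatisfiedPair P′ (a , y) (b , s)
      support (inj₁ e) = ⊥-elim (a≢b e)
      support (inj₂ (inj₁ (r , r∈ , k∈ , le , k≢b))) with ∈-graph {S} {h} r∈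
      ... | ρ∈ , lv with last (∈-map⁺ proj₁ ρ∈)
                           (ℤ.≤-trans (positive j) (ℤ.≤-trans le (ℤ.≤-reflexive lv)))
      ...   | z , z∈ , zmax = (lft r , z) , ∈-++⁺ʳ (row A y) z∈ ,
              (λ e → ℤ.<-irrefl (cong yc e) (below z∈)) , (λ e → k≢b (cong xc e)) , toBetween k∈ ,
              Between-sym {z} (≤⇒Between (order (j , max) (z∈ , zmax) (subst (h b ℤ.≤_) lv le))
                                         (ℤ.<⇒≤ (below z∈)))
      support (inj₂ (inj₂ (r , r∈ , k∈ , le , k≢a))) with ∈-graph {S} {h′} r∈
      ... | ρ∈ , lv = (lft r , y) , ∈-++⁺ˡ (∈-row⁺ {A} (∈-map⁺ proj₁ ρ∈)
                (touched {A} {h} small (∈-map⁺ proj₁ ρ∈) (subst (t ℤ.≤_) lv le))) ,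
              (λ e → k≢a (cong xc e)) , (λ e → ℤ.<-irrefl (sym (cong yc e)) (below j)) ,
              toBetween k∈ , Between-left y s

    touch-satisfied : ∀ {x} → Satisfied P → Valid t (graph S h) (graph S h′) x → Satisfied P′
    touch-satisfied {x} sat v p q p∈ q∈ nc with ∈-++⁻ (row A y) p∈ | ∈-++⁻ (row A y) q∈
    ... | inj₁ i | inj₁ j =
          ⊥-elim (nc (inj₂ (trans (proj₂ (proj₂ (∈-row⁻ {A} i))) (sym (proj₂ (proj₂ (∈-row⁻ {A} j)))))))
    ... | inj₁ i | inj₂ j = cross-satisfied {x} v i j (λ e → nc (inj₁ e))
    ... | inj₂ i | inj₁ j = SatisfiedPair-sym (cross-satisfied {x} v j i (λ e → nc (inj₁ (sym e))))
    ... | inj₂ i | inj₂ j with sat p q i j nc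
    ...   | r , r∈ , rest = r , ∈-++⁺ʳ (row A y) r∈ , rest

-- Correspondence of plans and satisfied sets on the grid

module Execution (S : List Point) (u : Unique (map proj₁ S)) where

  open History S u public

  private
    t = top S
    C = map proj₁ S

  -- Ranks keep positivity and, in both directions, the comparison of levels of occupied columns.
  -- Nothing else about a level is recorded, which is why finitely many states suffice for
  -- arbitrarily many rows.
  normalise-tracks : ∀ {g P} → Tracks g P → Tracks (λ a → rank (graph S g) (g a)) P
  normalise-tracks {g} {P} T = record
    { column   = column
    ; positive = λ i → subst (+ 1 ℤ.≤_) (sym (rank-positive G (positive i))) (1≤above G _)
    ; last     = λ a∈ le → last a∈ (positive-rank G le)
    ; order    = ord
    ; order⁻   = λ la lb le → subst₂ ℤ._≤_ (sym (rank-positive G (positive (proj₁ la))))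
                   (sym (rank-positive G (positive (proj₁ lb)))) (above-mono G (order⁻ la lb le))
    }
    where
    open Tracks T
    G = graph S g

    ord : ∀ {a b y z} → Last P a y → Last P b z → rank G (g a) ℤ.≤ rank G (g b) → y ℤ.≤ z
    ord {a} {b} la lb le with g a ℤ.≤? g b | ∈C⇒strip (column (proj₁ lb))
    ... | yes ga≤gb | _ = order la lb ga≤gb
    ... | no n      | τ , τ∈ , refl = ⊥-elim (ℤ.<⇒≱
          (above-strict {G} {τ , g b} (∈-map⁺ _ τ∈) (ℤ.≰⇒> n))
          (subst₂ ℤ._≤_ (rank-positive G (positive (proj₁ la))) (rank-positive G (positive (proj₁ lb))) le))

  normalise-plan : ∀ {ps g s} → Plan t ps (normalise (graph S g)) s →
                   Plan t ps (graph S (λ a → rank (graph S g) (g a))) s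
  normalise-plan {ps} {g} {s} = subst (λ z → Plan t ps z s) (normalise-graph S g)

  -- `P` is the history before the rows `ps`, `P′` the history after them, and `s` the doubled
  -- points placed on the way. Starting from the empty history, the last three fields become those
  -- required for `Doubling`.
  record Outcome (ps P s P′ : List Point) : Set where
    field
      satisfied : Satisfied P′
      column    : ∀ {e} → e ∈ P′ → xc e ∈ C
      extends   : ∀ {e} → e ∈ P → e ∈ P′
      covered   : ∀ {p σ} → p ∈ ps → σ ∈ S → InStrip σ (xc p) → (proj₁ σ , yc p) ∈ P′
      origin    : ∀ {z} → z ∈ s → (∃[ p ] p ∈ ps × yc z ≡ yc p) ×
                  (∃[ σ ] σ ∈ S × (proj₁ σ , yc z) ∈ P′ × (xc z ≡ proj₁ σ ⊎ xc z ≡ proj₂ σ))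
      boundary  : ∀ {σ y} → σ ∈ S → (proj₁ σ , y) ∈ P′ → (proj₁ σ , y) ∈ P ⊎
                  ((proj₁ σ , y) ∈ s × (proj₂ σ , y) ∈ s)

  row-below : ∀ {A y z P} → RowsBelow P y → y ℤ.< z → RowsBelow (row A y ++ P) z
  row-below {A} {y} below lt i with ∈-++⁻ (row A y) i
  ... | inj₂ j = ℤ.<-trans (below j) lt
  ... | inj₁ j = subst (ℤ._< _) (sym (proj₂ (proj₂ (∈-row⁻ {A} j)))) lt

  -- The rows ascend, so each touch joins a new top row to a satisfied history, and only pairs
  -- between this row and older rows need the validity of the choice.
  sound : ∀ {ps h P s} → Plan t ps (graph S h) s → InRange h → Tracks h P → Satisfied P →
    AllPairs StrictlyLower ps → All (λ p → RowsBelow P (yc p)) ps → ∃[ P′ ] Outcome ps P s P′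
  sound {P = P} [] range T sat _ _ = P , record
    { satisfied = sat ; column = Tracks.column T ; extends = λ i → i ; covered = λ ()
    ; origin = λ () ; boundary = λ _ → inj₁ }
  sound {p ∷ ps} {h} {P} (next {G = G} {s = s} G∈ v pl) range T sat (p< ∷ ps<) (below ∷ _)
    with choices⇒touch {t} {S} {h} u (λ i → below-top S (range i)) G∈
  ... | A , refl with sound (normalise-plan {g = touch A t h} pl) (rank-range (touch A t h))
      (normalise-tracks (touch-tracks T below (smallLevels range)))
      (touch-satisfied T below (smallLevels range) {xc p} sat v) ps<
      (All.map (λ {q} lt {e} → row-below {A} {yc p} {yc q} below lt {e}) p<)
  ...   | P′ , O = P′ , record
    { satisfied = O.satisfied
    ; column    = O.column
    ; extends   = λ i → O.extends (∈-++⁺ʳ (row A (yc p)) i)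
    ; covered   = cov
    ; origin    = orig
    ; boundary  = bnd
    }
    where
    module O = Outcome O

    cov : ∀ {q σ} → q ∈ p ∷ ps → σ ∈ S → InStrip σ (xc q) → (proj₁ σ , yc q) ∈ P′
    cov (there i)   σ∈ x∈ = O.covered i σ∈ x∈
    cov (here refl) σ∈ x∈ = O.extends (∈-++⁺ˡ (∈-row⁺ {A} (∈-map⁺ proj₁ σ∈)
      (touched {A} {h} (smallLevels range) (∈-map⁺ proj₁ σ∈) (proj₁ (v (∈-map⁺ _ σ∈)) x∈))))

    touchedRow : ∀ {σ} → σ ∈ S → t ℤ.≤ touch A t h (proj₁ σ) → (proj₁ σ , yc p) ∈ P′
    touchedRow σ∈ le = O.extends (∈-++⁺ˡ (∈-row⁺ {A} (∈-map⁺ proj₁ σ∈)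
      (touched {A} {h} (smallLevels range) (∈-map⁺ proj₁ σ∈) le)))

    orig : ∀ {z} → z ∈ double t (yc p) (graph S (touch A t h)) s → (∃[ q ] q ∈ p ∷ ps × yc z ≡ yc q) ×
      (∃[ σ ] σ ∈ S × (proj₁ σ , yc z) ∈ P′ × (xc z ≡ proj₁ σ ⊎ xc z ≡ proj₂ σ))
    orig z∈ with ∈-double⁻ t (yc p) (graph S (touch A t h)) z∈
    ... | inj₁ i with O.origin i
    ...   | (q , q∈ , eq) , rest = (q , there q∈ , eq) , rest
    orig z∈ | inj₂ (g , g∈ , le , refl , side) with ∈-graph {S} {touch A t h} g∈
    ... | σ∈ , lv = (p , here refl , refl) ,
          (proj₁ g , σ∈ , touchedRow σ∈ (subst (t ℤ.≤_) lv le) , side)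

    bnd : ∀ {σ y} → σ ∈ S → (proj₁ σ , y) ∈ P′ → (proj₁ σ , y) ∈ P ⊎
      ((proj₁ σ , y) ∈ double t (yc p) (graph S (touch A t h)) s ×
       (proj₂ σ , y) ∈ double t (yc p) (graph S (touch A t h)) s)
    bnd {σ} σ∈ i with O.boundary σ∈ i
    ... | inj₂ (j , k) = inj₂ (∈-double-tail t (yc p) (graph S (touch A t h)) j , ∈-double-tail t (yc p) (graph S (touch A t h)) k)
    ... | inj₁ j with ∈-++⁻ (row A (yc p)) j
    ...   | inj₂ k = inj₁ k
    ...   | inj₁ k with ∈-row⁻ {A} k
    ...     | _ , Aa , refl = inj₂ (∈-double⁺ t (yc p) {graph S (touch A t h)} {s} (∈-map⁺ _ σ∈)
              (ℤ.≤-reflexive (sym (touch-true {A} {h} Aa))))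

  double-length : ∀ {h} A y s → SmallLevels h →
    length (double t y (graph S (touch A t h)) s) ≡ 2 * length (row A y) + length s
  double-length {h} A y s small = trans (go S small) (cong (λ n → 2 * n + length s) (sym (length-map (_, y) (filter (λ a → A a Bool.≟ true) C))))
    where
    go : ∀ S′ → (∀ {a} → a ∈ map proj₁ S′ → h a ℤ.< t) →
      length (double t y (graph S′ (touch A t h)) s) ≡
      2 * length (filter (λ a → A a Bool.≟ true) (map proj₁ S′)) + length s
    go []       small = refl
    go (σ ∷ S′) small with A (proj₁ σ)
    ... | true  with t ℤ.≤? t
    ...   | yes _ = trans (cong (λ n → 2 + n) (go S′ (small ∘ there)))
                      (cong (_+ length s) (sym (*-suc 2 _)))
    ...   | no n  = ⊥-elim (n ℤ.≤-refl)
    go (σ ∷ S′) small | false with t ℤ.≤? h (proj₁ σ)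
    ...   | yes le = ⊥-elim (ℤ.<⇒≱ (small (here refl)) le)
    ...   | no _   = go S′ (small ∘ there)

  module Completeness {M : List Point} (sat : Satisfied M) (inC : ∀ {e} → e ∈ M → xc e ∈ C) where

    mark : ℤ → ℤ → Bool
    mark y a = ⌊ _∈?_ _≟ᵖ_ (a , y) M ⌋

    mark⁺ : ∀ {a y} → (a , y) ∈ M → mark y a ≡ true
    mark⁺ {a} {y} i with _∈?_ _≟ᵖ_ (a , y) M
    ... | yes _ = refl
    ... | no n  = ⊥-elim (n i)

    mark⁻ : ∀ {a y} → mark y a ≡ true → (a , y) ∈ M
    mark⁻ {a} {y} eq with _∈?_ _≟ᵖ_ (a , y) M
    ... | yes i = i

    -- Converse of the row step: the point of `M` satisfying the new point and a last point lies
    -- either in the new row or in the history. In the second case the last touch of its column is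
    -- at least as high, so its level is large enough.
    mark-valid : ∀ {h P p} → Tracks h P → RowsBelow P (yc p) → SmallLevels h →
      (∀ {e} → e ∈ P → e ∈ M) → (∀ {e} → e ∈ M → yc e ℤ.< yc p → e ∈ P) →
      (∀ {σ} → σ ∈ S → InStrip σ (xc p) → (proj₁ σ , yc p) ∈ M) →
      Valid t (graph S h) (graph S (touch (mark (yc p)) t h)) (xc p)
    mark-valid {h} {P} {p} T below small P⊆M M⊆P cov {g} g∈ with ∈-graph {S} {touch (mark (yc p)) t h} g∈
    ... | σ∈ , lv = (λ x∈ → ℤ.≤-reflexive (sym (trans lv (touch-true {A} {h} (mark⁺ (cov σ∈ x∈)))))) ,
                    λ le q∈ 1≤ → support le q∈ 1≤
      where
      open Tracks T
      y = yc p
      A = mark y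

      fromBetween : ∀ {k a b} → Between k a b → InBetween k b a
      fromBetween k∈ = [ inj₂ , inj₁ ]′ (Between⇒≤ k∈)

      support : t ℤ.≤ lvl g → ∀ {q} → q ∈ graph S h → + 1 ℤ.≤ lvl q →
        SupportedBy t (graph S h) (graph S (touch A t h)) g q
      support le {q} q∈ 1≤ with ∈-graph {S} {h} q∈
      ... | τ∈ , lvq with last (∈-map⁺ proj₁ τ∈) (subst (+ 1 ℤ.≤_) lvq 1≤) | lft g ℤ.≟ lft q
      ...   | _ | yes eq = inj₁ eq
      ...   | s , s∈ , max | no a≢b = found (sat (lft g , y) (lft q , s)
              (mark⁻ (touched {A} {h} small (∈-map⁺ proj₁ σ∈) (subst (t ℤ.≤_) lv le))) (P⊆M s∈)
              [ a≢b , (λ e → ℤ.<-irrefl (sym e) (below s∈)) ]′)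
        where
        found : SatisfiedPair M (lft g , y) (lft q , s) →
          SupportedBy t (graph S h) (graph S (touch A t h)) g q
        found ((k , z) , r∈ , r≢g , r≢q , k∈ , z∈) with ∈C⇒strip (inC r∈) | Between⇒≤ z∈
        ... | _ | inj₁ (y≤z , z≤s) = ⊥-elim (ℤ.<⇒≱ (below s∈) (ℤ.≤-trans y≤z z≤s))
        ... | ρ , ρ∈ , refl | inj₂ (s≤z , z≤y) with z ℤ.≟ y
        ...   | yes refl = inj₂ (inj₂ ((ρ , touch A t h k) , ∈-map⁺ _ ρ∈ , fromBetween k∈ ,
                  ℤ.≤-reflexive (sym (touch-true {A} {h} (mark⁺ r∈))) , (λ e → r≢g (cong (_, y) e))))
        ...   | no z≢y = inj₂ (inj₁ ((ρ , h k) , ∈-map⁺ _ ρ∈ , fromBetween k∈ ,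
                  subst (ℤ._≤ h k) (sym lvq) older , k≢b))
          where
          z∈P : (k , z) ∈ P
          z∈P = M⊆P r∈ (ℤ.≤∧≢⇒< z≤y z≢y)

          older : h (lft q) ℤ.≤ h k
          older with last (∈-map⁺ proj₁ ρ∈) (positive z∈P)
          ... | z′ , z′∈ , zmax = order⁻ (s∈ , max) (z′∈ , zmax) (ℤ.≤-trans s≤z (zmax z∈P))

          -- A point of the same column cannot be above its last point, so it would be that last
          -- point itself.
          k≢b : k ≢ lft q
          k≢b refl = r≢q (cong (k ,_) (ℤ.≤-antisym (max z∈P) s≤z))

    -- The plan touches in each row exactly the strips marked by `M`. As `M` may list a point
    -- repeatedly, the touched points are collected without repetition in `Q`, whose length measures
    -- the cost.
    complete : ∀ ps {h P} → InRange h → Tracks h P → AllPairs StrictlyLower ps →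
      All (λ p → RowsBelow P (yc p)) ps → (∀ {e} → e ∈ P → e ∈ M) →
      (∀ {e} → e ∈ M → e ∈ P ⊎ (∃[ p ] p ∈ ps × yc e ≡ yc p)) →
      (∀ {p σ} → p ∈ ps → σ ∈ S → InStrip σ (xc p) → (proj₁ σ , yc p) ∈ M) →
      ∃[ s ] Plan t ps (graph S h) s × (∃[ Q ] length s ≡ 2 * length Q × Unique Q ×
        (∀ {e} → e ∈ Q → e ∈ M × (∃[ p ] p ∈ ps × yc e ≡ yc p)))
    complete [] range T _ _ _ _ _ = [] , [] , [] , refl , [] , λ ()
    complete (p ∷ ps) {h} {P} range T (p< ∷ ps<) (below ∷ _) P⊆M M⊆ cov
      with complete ps (rank-range (touch A t h))
        (normalise-tracks (touch-tracks T below (smallLevels range))) ps<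
        (All.map (λ {q} lt {e} → row-below {A} {yc p} {yc q} below lt {e}) p<) P′⊆M M⊆P′
        (λ i → cov (there i))
      where
      A = mark (yc p)
      P′⊆M : ∀ {e} → e ∈ row A (yc p) ++ P → e ∈ M
      P′⊆M i with ∈-++⁻ (row A (yc p)) i
      ... | inj₂ j = P⊆M j
      ... | inj₁ j with ∈-row⁻ {A} j
      ...   | _ , Aa , refl = mark⁻ Aa
      M⊆P′ : ∀ {e} → e ∈ M → e ∈ row A (yc p) ++ P ⊎ (∃[ q ] q ∈ ps × yc e ≡ yc q)
      M⊆P′ i with M⊆ i
      ... | inj₁ j                      = inj₁ (∈-++⁺ʳ (row A (yc p)) j)
      ... | inj₂ (q , there j , eq)     = inj₂ (q , j , eq)
      ... | inj₂ (_ , here refl , refl) = inj₁ (∈-++⁺ˡ (∈-row⁺ {A} (inC i) (mark⁺ i)))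
    ... | s , pl , Q , len , uQ , Q⊆ =
      double t (yc p) (graph S (touch A t h)) s ,
      next (touch∈choices S h A)
        (mark-valid T below (smallLevels range) P⊆M M⊆P (λ σ∈ → cov (here refl) σ∈))
        (subst (λ z → Plan t ps z s) (sym (normalise-graph S (touch A t h))) pl) ,
      row A (yc p) ++ Q , size-Q , Unique.++⁺ (row-unique A (yc p)) uQ disjoint , Q′⊆
      where
      A = mark (yc p)

      M⊆P : ∀ {e} → e ∈ M → yc e ℤ.< yc p → e ∈ P
      M⊆P i lt with M⊆ i
      ... | inj₁ j                      = j
      ... | inj₂ (_ , here refl , eq)   = ⊥-elim (ℤ.<-irrefl eq lt)
      ... | inj₂ (q , there j , eq)     = ⊥-elim (ℤ.<-irrefl eq (ℤ.<-trans lt (All.lookup p< j)))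

      size-Q : length (double t (yc p) (graph S (touch A t h)) s) ≡ 2 * length (row A (yc p) ++ Q)
      size-Q = trans (double-length A (yc p) s (smallLevels range))
        (trans (cong (λ z → 2 * length (row A (yc p)) + z) len)
          (trans (sym (*-distribˡ-+ 2 (length (row A (yc p))) _))
            (cong (2 *_) (sym (length-++ (row A (yc p)))))))

      disjoint : ∀ {e} → ¬ (e ∈ row A (yc p) × e ∈ Q)
      disjoint (i , j) with ∈-row⁻ {A} i | Q⊆ j
      ... | _ , _ , e | _ , q , q∈ , f = ℤ.<-irrefl (trans (sym e) f) (All.lookup p< q∈)

      Q′⊆ : ∀ {e} → e ∈ row A (yc p) ++ Q → e ∈ M × (∃[ q ] q ∈ p ∷ ps × yc e ≡ yc q)
      Q′⊆ i with ∈-++⁻ (row A (yc p)) i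
      ... | inj₂ j with Q⊆ j
      ...   | m , q , q∈ , eq = m , q , there q∈ , eq
      Q′⊆ i | inj₁ j with ∈-row⁻ {A} j
      ... | _ , Aa , refl = mark⁻ Aa , p , here refl , refl

-- Correctness

floorRow : ℤ → List Point → ℤ → ℤ
floorRow y₀ []       y = y₀
floorRow y₀ (p ∷ ps) y = if yc p ≤ᵇ y then floorRow (yc p) ps y else y₀

-- The last row of the sorted list not above y, or its first row.
rowOf : List Point → ℤ → ℤ
rowOf []       y = y
rowOf (p ∷ ps) y = floorRow (yc p) ps y

floorRow-≥ : ∀ {p ps} → AllPairs StrictlyLower (p ∷ ps) → ∀ y → yc p ℤ.≤ floorRow (yc p) ps y
floorRow-≥ {ps = []}     _                     y = ℤ.≤-refl
floorRow-≥ {ps = q ∷ ps} ((p<q ∷ _) ∷ sorted) y with yc q ℤ.≤? y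
... | yes _ = ℤ.≤-trans (ℤ.<⇒≤ p<q) (floorRow-≥ sorted y)
... | no _  = ℤ.≤-refl

floorRow-mono : ∀ {p ps} → AllPairs StrictlyLower (p ∷ ps) → Monotone (floorRow (yc p) ps)
floorRow-mono {ps = []}     _             le = ℤ.≤-refl
floorRow-mono {ps = q ∷ ps} ((p<q ∷ _) ∷ sorted) {y} {z} le with yc q ℤ.≤? y | yc q ℤ.≤? z
... | yes _ | yes _ = floorRow-mono sorted le
... | yes i | no n  = ⊥-elim (n (ℤ.≤-trans i le))
... | no _  | yes _ = ℤ.≤-trans (ℤ.<⇒≤ p<q) (floorRow-≥ sorted z)
... | no _  | no _  = ℤ.≤-refl

rowOf-mono : ∀ {ps} → AllPairs StrictlyLower ps → Monotone (rowOf ps)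
rowOf-mono {[]}     _      le = le
rowOf-mono {p ∷ ps} sorted le = floorRow-mono sorted le

floorRow-row : ∀ p ps y → ∃[ q ] q ∈ p ∷ ps × floorRow (yc p) ps y ≡ yc q
floorRow-row p []       y = p , here refl , refl
floorRow-row p (q ∷ ps) y with yc q ℤ.≤? y
... | no _ = p , here refl , refl
... | yes _ with floorRow-row q ps y
...   | r , r∈ , eq = r , there r∈ , eq

rowOf-row : ∀ {p ps} → p ∈ ps → ∀ y → ∃[ q ] q ∈ ps × rowOf ps y ≡ yc q
rowOf-row {ps = p ∷ ps} _ y = floorRow-row p ps y

rowOf-fixed : ∀ {ps p} → AllPairs StrictlyLower ps → p ∈ ps → rowOf ps (yc p) ≡ yc p
rowOf-fixed {p ∷ []}     _ (here refl) = refl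
rowOf-fixed {p ∷ q ∷ ps} ((p<q ∷ _) ∷ _) (here refl) with yc q ℤ.≤? yc p
... | yes le = ⊥-elim (ℤ.<⇒≱ p<q le)
... | no _   = refl
rowOf-fixed {q ∷ r ∷ ps} {p} (_ ∷ sorted) (there p∈) with yc r ℤ.≤? yc p
... | yes _ = rowOf-fixed sorted p∈
... | no n  = ⊥-elim (n (first p∈ sorted))
  where
  first : p ∈ r ∷ ps → AllPairs StrictlyLower (r ∷ ps) → yc r ℤ.≤ yc p
  first (here refl) _        = ℤ.≤-refl
  first (there i)   (lt ∷ _) = ℤ.<⇒≤ (All.lookup lt i)

module Correctness {X : PointList} {lo hi : ℤ} {T : Tree} (uX : Unique X) (even : All IntegerPoint X) (semi : SemiPermutation X)
                   (box : BoundingStrip X lo hi) (part : Partitions X lo hi T) where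

  private
    S = strips lo hi T
    R = sort X

  lo≤hi : lo ℤ.≤ hi
  lo≤hi = bounding-≤ box

  open Execution S (strips-unique part)

  sorted : AllPairs StrictlyLower R
  sorted = sort-strict uX semi

  blank-range : InRange (λ _ → + 0)
  blank-range _ = levels-∈⁺ S z≤n

  plan : List Point
  plan = solution R (graph S (λ _ → + 0))

  solve-plan : solve X S ≡ dedup plan
  solve-plan = cong dedup (trans (cong (find (table (top S) (states (levels S) S) R)) (blank-graph S))
                                 (find-solution R blank-range))

  noHistory : All (λ p → RowsBelow [] (yc p)) R
  noHistory = All.tabulate (λ _ ())

  outcome : ∃[ P ] Outcome R [] plan P
  outcome = sound (proj₁ (optimal R blank-range)) blank-range blank-tracks (λ _ _ ()) sorted noHistory

  P = proj₁ outcome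
  module O = Outcome (proj₂ outcome)

  doubling : Doubling X (dedup plan) P S
  doubling = record
    { comparable = strips-comparable part
    ; satisfied  = O.satisfied
    ; strip      = λ p∈ → let σ , σ∈ , eq = ∈C⇒strip (O.column p∈) in σ , σ∈ , sym eq
    ; covered    = λ p∈ → let l , u = proj₂ (proj₂ box) _ p∈
                              σ , σ∈ , s = locate-inStrip part l u
                          in σ , σ∈ , s , O.covered (∈-resp-↭ (↭-sym (sort-↭ X)) p∈) σ∈ s
    ; oneColumn  = λ p∈ q∈ σ∈ → strip-column part σ∈ (_ , p∈ , refl) (_ , q∈ , refl)
    ; ordered    = λ σ∈ → proj₁ (proj₂ (strip-bounds lo≤hi part σ∈))
    ; origin     = λ z∈ → proj₂ (O.origin (dedup-∈⁻ z∈))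
    ; boundary   = λ σ∈ i → [ (λ ()) , (λ (j , k) → dedup-∈⁺ j , dedup-∈⁺ k) ]′ (O.boundary σ∈ i)
    }

  feasible : Feasible X (dedup plan)
  feasible = dedup-unique plan , Doubling.doubling-satisfied doubling

  special : Special X lo hi T (dedup plan)
  special z z∈ with O.origin (dedup-∈⁻ z∈)
  ... | (p , p∈ , eq) , σ , σ∈ , _ , side =
    (p , ∈-resp-↭ (sort-↭ X) p∈ , sym eq) , proj₁ σ , proj₂ σ , strip-boundaryLine σ∈ , side

  module Comparison {Y : PointList} (sat : Satisfied (X ++ Y)) where

    M : List Point
    M = map (λ p → locate lo T (xc p) , rowOf R (yc p)) (X ++ Y)

    M-column : ∀ {e} → e ∈ M → xc e ∈ map proj₁ S
    M-column e∈ with ∈-map⁻ _ e∈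
    ... | p , _ , refl with locate-strip lo hi T (xc p)
    ...   | σ , σ∈ , eq = subst (_∈ map proj₁ S) eq (∈-map⁺ proj₁ σ∈)

    M-row : ∀ {e} → e ∈ M → ∃[ p ] p ∈ R × yc e ≡ yc p
    M-row e∈ with ∈-map⁻ _ e∈ | proj₁ box
    ... | p , _ , refl | q , q∈ , _ = rowOf-row (∈-resp-↭ (↭-sym (sort-↭ X)) q∈) (yc p)

    -- An integer abscissa avoids all dividing lines and rows of `X` are fixed by `rowOf`, so the
    -- collapse moves a point of `X` only to the left side of its own strip.
    M-covered : ∀ {p σ} → p ∈ R → σ ∈ S → InStrip σ (xc p) → (proj₁ σ , yc p) ∈ M
    M-covered {p} {σ} p∈ σ∈ s = subst (_∈ M)
      (cong₂ _,_ (locate-exact lo≤hi part (All.lookup even p∈X) σ∈ s) (rowOf-fixed sorted p∈))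
      (∈-map⁺ _ (∈-++⁺ˡ p∈X))
      where p∈X = ∈-resp-↭ (sort-↭ X) p∈

    open Completeness {M} (collapse-satisfied {locate lo T} {rowOf R} (locate-mono part) (rowOf-mono sorted) sat) M-column

    cost : length (dedup plan) ≤ 2 * length X + 2 * length Y
    cost with complete R blank-range blank-tracks sorted noHistory (λ ()) (λ i → inj₂ (M-row i)) M-covered
    ... | s , pl , Q , eq , uQ , Q⊆ = begin
      length (dedup plan)       ≤⟨ dedup-length plan ⟩
      length plan               ≤⟨ proj₂ (optimal R blank-range) pl ⟩
      length s                  ≡⟨ eq ⟩
      2 * length Q              ≤⟨ *-monoʳ-≤ 2 (unique-⊆-length uQ (λ i → proj₁ (Q⊆ i))) ⟩
      2 * length M              ≡⟨ cong (2 *_) (trans (length-map _ (X ++ Y)) (length-++ X)) ⟩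
      2 * (length X + length Y) ≡⟨ *-distribˡ-+ 2 (length X) (length Y) ⟩
      2 * length X + 2 * length Y ∎
      where open ≤-Reasoning

  solve-feasible : Feasible X (solve X S)
  solve-feasible = subst (Feasible X) (sym solve-plan) feasible

  solve-special : Special X lo hi T (solve X S)
  solve-special = subst (Special X lo hi T) (sym solve-plan) special

  solve-cost : ∀ {n} → IsOpt X n → length (solve X S) ≤ 2 * length X + 2 * n
  solve-cost ((Y , (_ , sat) , refl) , _) =
    subst (λ z → length z ≤ 2 * length X + 2 * length Y) (sym solve-plan) (Comparison.cost sat)

-- Running time

length-product : ∀ {A : Set} (xs : List A) rest →
  length (cartesianProductWith List._∷_ xs rest) ≡ length xs * length rest
length-product []       rest = refl
length-product (x ∷ xs) rest = trans (length-++ (map (x ∷_) rest))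
  (cong₂ _+_ (length-map (x ∷_) rest) (length-product xs rest))

cart-length : ∀ {A : Set} {w} (xss : List (List A)) → (∀ {xs} → xs ∈ xss → length xs ≤ w) →
  length (cart xss) ≤ w ^ length xss
cart-length []         le = ≤-refl
cart-length {w = w} (xs ∷ xss) le = begin
  length (cart (xs ∷ xss))         ≡⟨ cong length (cart-product xs (cart xss)) ⟩
  length (cartesianProductWith List._∷_ xs (cart xss)) ≡⟨ length-product xs (cart xss) ⟩
  length xs * length (cart xss)    ≤⟨ *-mono-≤ (le (here refl)) (cart-length xss (λ i → le (there i))) ⟩
  w ^ length (xs ∷ xss)            ∎
  where open ≤-Reasoning

suffix-∈ : ∀ {A : Set} zs {a : A} {as} → a ∈ zs ++ a ∷ as
suffix-∈ zs = ∈-++⁺ʳ zs (here refl)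

suffix-length : ∀ {A : Set} zs {a : A} {as} → length as ≤ length (zs ++ a ∷ as)
suffix-length zs = ≤-trans (n≤1+n _) (≤-trans (m≤n+m _ (length zs)) (≤-reflexive (sym (length-++ zs))))

suffix-≤ : ∀ {A : Set} {n} zs {a : A} {as xs} → xs ≡ zs ++ a ∷ as → length xs ≤ n → length as ≤ n
suffix-≤ zs refl le = ≤-trans (suffix-length zs) le

∈-suffix : ∀ {A : Set} zs {a b : A} {as xs} → xs ≡ zs ++ a ∷ as → b ∈ as → b ∈ xs
∈-suffix zs refl i = ∈-++⁺ʳ zs (there i)

head-∈ : ∀ {A : Set} zs {a : A} {as xs} → xs ≡ zs ++ a ∷ as → a ∈ xs
head-∈ zs refl = suffix-∈ zs

levels-length : ∀ S → length (levels S) ≡ 2 + length S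
levels-length []      = refl
levels-length (_ ∷ S) = cong suc (trans (cong length (foldr-map (ℤ._+ + 1) (levels S)))
  (trans (length-map _ (levels S)) (levels-length S)))

lines-length : ∀ T → length (lines T) ≡ #nodes T
lines-length leaf         = refl
lines-length (node ℓ l r) = trans (cong length (foldr-∷ (lines l) _)) (trans (length-++ (lines l))
  (trans (+-suc (length (lines l)) _) (cong suc (cong₂ _+_ (lines-length l) (lines-length r)))))

double-bound : ∀ t y G s → length (double t y G s) ≤ 2 * length G + length s
double-bound t y []      s = ≤-refl
double-bound t y (g ∷ G) s with t ≤ᵇ lvl g
... | true  = ≤-trans (s≤s (s≤s (double-bound t y G s)))
                (≤-reflexive (cong (_+ length s) (sym (*-suc 2 (length G)))))
... | false = ≤-trans (double-bound t y G s) (+-monoˡ-≤ (length s) (*-monoʳ-≤ 2 (n≤1+n (length G))))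

find-bound : ∀ {L} tbl G → (∀ {e} → e ∈ tbl → length (proj₂ e) ≤ L) → length (find tbl G) ≤ L
find-bound []        G le = z≤n
find-bound (e ∷ tbl) G le with subset G (proj₁ e)
... | true  = le (here refl)
... | false = find-bound tbl G (λ i → le (there i))

candidate-bound : ∀ {L} t p tbl G → (∀ {e} → e ∈ tbl → length (proj₂ e) ≤ L) →
  length (candidate t p tbl G) ≤ 2 * length G + L
candidate-bound t p tbl G le = ≤-trans (double-bound t (yc p) G _)
  (+-monoʳ-≤ (2 * length G) (find-bound tbl (normalise G) le))

choice-length : ∀ {t H G} → G ∈ choices t H → length G ≡ length H
choice-length {t} {H} G∈ = trans
  (Pointwise.Pointwise-length (subst (Pointwise _∈_ _) (options t H) (∈-cart⁻ _ G∈)))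
  (length-map (keepOrTouch t) H)

state-length : ∀ {W S H} → H ∈ states W S → length H ≡ length S
state-length {W} {S} H∈ = trans
  (Pointwise.Pointwise-length (subst (Pointwise _∈_ _) (cells W S) (∈-cart⁻ _ H∈))) (length-map _ S)

full-length : ∀ t H → length (full t H) ≡ length H
full-length t H = trans (cong length (foldr-map _ H)) (length-map _ H)

-- The accumulators that occur in the fold of `best`. Each is traversed when its length is compared,
-- so each needs a bound.
partial-best : ℤ → Point → Table → State → List State → List Point
partial-best t p tbl H = foldr
  (λ G acc → if valid t H G (xc p) then shorter (candidate t p tbl G) acc else acc)
  (candidate t p tbl (full t H))

partial-best-bound : ∀ {L} t p tbl H Gs → (∀ {e} → e ∈ tbl → length (proj₂ e) ≤ L) →
  length (partial-best t p tbl H Gs) ≤ 2 * length H + L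
partial-best-bound {L} t p tbl H []       le =
  subst (λ n → length (candidate t p tbl (full t H)) ≤ 2 * n + L) (full-length t H)
    (candidate-bound t p tbl (full t H) le)
partial-best-bound t p tbl H (G ∷ Gs) le with valid t H G (xc p)
... | true  = ≤-trans (proj₁ (proj₂ (shorter-≤ (candidate t p tbl G) (partial-best t p tbl H Gs))))
                      (partial-best-bound t p tbl H Gs le)
... | false = partial-best-bound t p tbl H Gs le

table-length : ∀ t E ps → length (table t E ps) ≡ length E
table-length t E []       = trans (cong length (foldr-map _ E)) (length-map _ E)
table-length t E (p ∷ ps) = trans (cong length (foldr-map _ E)) (length-map _ E)

-- A row adds at most two points per strip, which keeps the stored solutions linear in the number of
-- rows.
table-entry : ∀ {c} t E ps → (∀ {H} → H ∈ E → length H ≤ c) → ∀ {e} → e ∈ table t E ps →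
  length (proj₁ e) ≤ c × length (proj₂ e) ≤ length ps * (2 * c)
table-entry t E []       le e∈ with ∈-map⁻ _ (subst (_ ∈_) (foldr-map (λ H → H , []) E) e∈)
... | H , H∈ , refl = le H∈ , z≤n
table-entry {c} t E (p ∷ ps) le e∈
  with ∈-map⁻ _ (subst (_ ∈_) (foldr-map (λ H → H , best t p (table t E ps) H) E) e∈)
... | H , H∈ , refl = le H∈ , ≤-trans
  (partial-best-bound t p (table t E ps) H (choices t H) (λ i → proj₂ (table-entry t E ps le i)))
  (+-monoˡ-≤ (length ps * (2 * c)) (*-monoʳ-≤ 2 (le H∈)))

-- Bounds for all lists traversed by the algorithm

module Smallness {N : ℕ} where

  -- The products over suffixes are traversed as well. Since `1 ≤ w`, the power bounding the full
  -- product also bounds these.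
  small-cart : ∀ {Γ A w} {ρ : Env Γ} (t : Expr Γ (list (list A))) → 1 ≤ w → w ≤ N →
    Small N t ρ → length (⟦ t ⟧ ρ) ≤ N → (∀ {xs} → xs ∈ ⟦ t ⟧ ρ → length xs ≤ w) →
    w ^ length (⟦ t ⟧ ρ) ≤ N → Small N (cartE t) ρ
  small-cart {w = w} t 1≤w w≤N st len le pow = st , _ , len , λ zs xs as eq →
    _ , _ , ≤-trans (le (head-∈ zs eq)) w≤N , λ _ _ _ _ →
    _ , _ , ≤-trans (cart-length as (λ i → le (∈-suffix zs eq i)))
      (≤-trans (^-monoʳ-≤ w {{ℕ.>-nonZero 1≤w}} (suffix-≤ zs eq ≤-refl)) pow) , λ _ _ _ _ → _

  small-find : ∀ {Γ} {ρ : Env Γ} (t : Expr Γ (list entry)) (u : Expr (entry ∷ list point ∷ Γ) state) →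
    Small N t ρ → length (⟦ t ⟧ ρ) ≤ N →
    (∀ e acc → Small N u (e ∷ acc ∷ ρ) × length (⟦ u ⟧ (e ∷ acc ∷ ρ)) ≤ N) →
    (∀ {e} → e ∈ ⟦ t ⟧ ρ → length (proj₁ e) ≤ N) → Small N (findE t u) ρ
  small-find t u st len su le = st , _ , len , λ zs e as eq →
    (proj₁ (su e _) , _ , _ , proj₂ (su e _) , λ _ _ _ _ →
      (_ , _ , le (head-∈ zs eq) , λ _ _ _ _ → _) , _) , _

  small-candidate : ∀ {Γ A B C D E} {ρ : Env Γ} G {a b c} p tbl {d e t} → length G ≤ N →
    length tbl ≤ N → (∀ {e} → e ∈ tbl → length (proj₁ e) ≤ N) →
    Small N (candidateE {α = A} {B} {C} {D} {E}) (G ∷ a ∷ b ∷ c ∷ p ∷ tbl ∷ d ∷ e ∷ t ∷ ρ)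
  small-candidate {ρ = ρ} G {a} {b} {c} p tbl {d} {e} {t} lenG len le =
    (_ , _ , lenG , λ _ _ _ _ → (_ , _ , _ , _ , _ , lenG , λ _ _ _ _ → _) , _) ,
    _ , small-find {ρ = normalise G ∷ G ∷ a ∷ b ∷ c ∷ p ∷ tbl ∷ d ∷ e ∷ t ∷ ρ} v6 v2 _ len (λ _ _ → _ , ≤-trans (≤-reflexive
      (trans (cong length (foldr-map _ G)) (length-map _ G))) lenG) le , lenG , λ _ _ _ _ → _

  small-valid : ∀ {Γ A B C D E} {ρ : Env Γ} G {a} H {b p c d e t} → length G ≤ N → length H ≤ N →
    Small N (validE {α = A} {B} {C} {D} {E}) (G ∷ a ∷ H ∷ b ∷ p ∷ c ∷ d ∷ e ∷ t ∷ ρ)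
  small-valid G H lenG lenH = _ , _ , lenG , λ _ _ _ _ →
    (_ , (_ , (_ , _ , lenH , λ _ _ _ _ →
      (_ , (_ , _ , (_ , _ , lenH , λ _ _ _ _ → _) , _ , _ , _ , lenG , λ _ _ _ _ → _) , _) , _) , _) , _) , _

  -- `n` bounds the number of strips and `L` the stored completions: there are at most `2 ^ n`
  -- choices, and no candidate exceeds `2 * n + L`.
  small-best : ∀ {Γ A B C} {ρ : Env Γ} H {a} p tbl {b c t n L} → length H ≤ n →
    2 ≤ N → 2 ^ n ≤ N → 2 * n + L ≤ N → length tbl ≤ N → n ≤ N →
    (∀ {e} → e ∈ tbl → length (proj₁ e) ≤ n × length (proj₂ e) ≤ L) →
    Small N (bestE {δ = A} {B} {C}) (H ∷ a ∷ p ∷ tbl ∷ b ∷ c ∷ t ∷ ρ)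
  small-best {Γ} {A} {B} {C} {ρ} H {a} p tbl {b} {c} {t} {n} {L} lenH 2≤N pow bound len n≤N le =
    small-cart {ρ = H ∷ a ∷ p ∷ tbl ∷ b ∷ c ∷ t ∷ ρ} (mapE v0 (cons v0 (cons (pair (fst v0) v8) nil))) (s≤s z≤n) 2≤N
      (_ , _ , H≤N , λ _ _ _ _ → _)
      (subst (_≤ N) (sym lenO) H≤N) two
      (≤-trans (^-monoʳ-≤ 2 (subst (_≤ n) (sym lenO) lenH)) pow) ,
    (_ , (_ , _ , H≤N , λ _ _ _ _ → _) ,
      small-candidate {Γ} {list point} {state} {A} {B} {C} {ρ} (full t H) {[]} {H} {a} p tbl {b} {c} {t} (subst (_≤ N) (sym (full-length t H)) H≤N) len e≤N) ,
    choices-small , λ zs G as eq →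
      let G≤N = subst (_≤ N) (sym (choice-length {t} {H} (head-∈ zs eq))) H≤N in
      small-valid {Γ} {list point} {A} {list entry} {B} {C} {ρ} G {acc as} H {a} {p} {tbl} {b} {c} {t} G≤N H≤N ,
      (small-candidate {Γ} {list point} {state} {A} {B} {C} {ρ} G {acc as} {H} {a} p tbl {b} {c} {t} G≤N len e≤N ,
       ((_ , _ , ≤-trans (candidate-bound t p tbl G (λ i → proj₂ (le i)))
                   (≤-trans (+-monoˡ-≤ L (*-monoʳ-≤ 2
                     (≤-trans (≤-reflexive (choice-length {t} {H} (head-∈ zs eq))) lenH))) bound) ,
         λ _ _ _ _ → _) ,
        (_ , _ , ≤-trans (partial-best-bound t p tbl H as (λ i → proj₂ (le i)))
                   (≤-trans (+-monoˡ-≤ L (*-monoʳ-≤ 2 lenH)) bound) ,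
         λ _ _ _ _ → _)) , _) , _
    where
    H≤N = ≤-trans lenH n≤N
    acc = partial-best t p tbl H

    e≤N : ∀ {e} → e ∈ tbl → length (proj₁ e) ≤ N
    e≤N i = ≤-trans (proj₁ (le i)) n≤N

    lenO : length (foldr (λ g acc → keepOrTouch t g ∷ acc) [] H) ≡ length H
    lenO = trans (cong length (options t H)) (length-map (keepOrTouch t) H)

    two : ∀ {xs} → xs ∈ foldr (λ g acc → keepOrTouch t g ∷ acc) [] H → length xs ≤ 2
    two i with ∈-map⁻ (keepOrTouch t) (subst (_ ∈_) (options t H) i)
    ... | _ , _ , refl = ≤-refl

    choices-small : length (choices t H) ≤ N
    choices-small = ≤-trans (cart-length _ two)
      (≤-trans (^-monoʳ-≤ 2 (subst (_≤ n) (sym lenO) lenH)) pow)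

  -- The bound value is replaced by a variable with an equation, so each phase is treated without
  -- unfolding the values of the earlier ones.
  small-bind : ∀ {Γ A B} (t : Expr Γ A) (u : Expr (A ∷ Γ) B) (ρ : Env Γ) → Small N t ρ →
    (∀ v → v ≡ ⟦ t ⟧ ρ → Small N u (v ∷ ρ)) → Small N (bind t u) ρ
  small-bind t u ρ s f = s , f _ refl

  small-sort : ∀ {Γ} {ρ : Env Γ} (t : Expr Γ (list point)) → Small N t ρ → length (⟦ t ⟧ ρ) ≤ N →
    Small N (sortE t) ρ
  small-sort t st len = st , _ , len , λ zs p as eq →
    _ , _ , ≤-trans (≤-reflexive (↭-length (sort-↭ as))) (suffix-≤ zs eq len) , λ _ _ _ _ →
    _ , _ , λ _ _ _ → _

  small-leafStrips : ∀ X T → length X ≤ N → suc (#nodes T) ≤ N →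
    Small N (leafStripsE (fst v0) (snd v0)) ((X , T) ∷ [])
  small-leafStrips X T X≤N T≤N =
    ((_ , _ , λ a as eq → _ , _ , suffix-≤ [] eq X≤N , λ _ _ _ _ → _) ,
     (_ , _ , <⇒≤ T≤N , appends T (<⇒≤ T≤N))) ,
    ((_ , _ , λ a as eq → _ , _ , suffix-≤ [] eq X≤N , λ _ _ _ _ → _) , _) ,
    subst (λ n → suc n ≤ N) (sym (lines-length T)) T≤N , λ _ _ _ _ → _
    where
    appends : ∀ U → #nodes U ≤ N → OnTree
      (λ ℓ l r → Small N (foldList v1 (cons v0 v2) (cons v0 v1)) (ℓ ∷ l ∷ r ∷ (X , T) ∷ []))
      (λ ℓ l r → foldr _∷_ (ℓ ∷ r) l) [] U
    appends leaf         _  = _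
    appends (node ℓ l r) le =
      appends l l≤N , appends r (≤-trans (m≤n+m (#nodes r) (suc (#nodes l))) le) ,
      _ , _ , subst (_≤ N) (sym (lines-length l)) l≤N , λ _ _ _ _ → _
      where l≤N = ≤-trans (m≤m+n (#nodes l) (#nodes r)) (≤-trans (n≤1+n _) le)

  module _ {c : ℕ} (c≤N : 2 + c ≤ N) (pow : (2 + c) ^ c ≤ N) where

    Output-bounded : Table → Set
    Output-bounded tbl = length tbl ≤ N × (∀ {e} → e ∈ tbl → length (proj₁ e) ≤ N × length (proj₂ e) ≤ N)

    bounded : ∀ {n} → n ≤ c → n ≤ N
    bounded le = ≤-trans le (≤-trans (m≤n+m c 2) c≤N)

    levels-bound : ∀ {n} S → length S ≤ c → n ≡ length (levels S) → n ≤ 2 + c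
    levels-bound S S≤c refl = ≤-trans (≤-reflexive (levels-length S)) (+-monoʳ-≤ 2 S≤c)

    small-levels : ∀ t S I → length S ≤ c →
      Small {int ∷ list point ∷ input ∷ []} N (levelsE v1) (t ∷ S ∷ I ∷ [])
    small-levels t S I S≤c = _ , _ , bounded S≤c , λ zs a as eq → _ , _ , _ ,
      ≤-trans (levels-bound as (suffix-≤ zs eq S≤c) refl) c≤N , λ _ _ _ _ → _

    module _ {S : List Point} {W : List ℤ} (S≤c : length S ≤ c) (W≤c : length W ≤ 2 + c) where

      private
        strip-cells : List State
        strip-cells = foldr (λ σ acc → foldr (λ w acc′ → (σ , w) ∷ acc′) [] W ∷ acc) [] S

        cells-length : ∀ {xs} → xs ∈ strip-cells → length xs ≤ 2 + c
        cells-length i with ∈-map⁻ _ (subst (_ ∈_) (cells W S) i)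
        ... | σ , _ , refl = ≤-trans (≤-reflexive (length-map (σ ,_) W)) W≤c

        #cells : length strip-cells ≡ length S
        #cells = trans (cong length (cells W S)) (length-map _ S)

        power≤N : (2 + c) ^ length strip-cells ≤ N
        power≤N = subst (λ n → (2 + c) ^ n ≤ N) (sym #cells) (≤-trans (^-monoʳ-≤ (2 + c) S≤c) pow)

      small-states : ∀ t I → Small {list int ∷ int ∷ list point ∷ input ∷ []} N statesE (W ∷ t ∷ S ∷ I ∷ [])
      small-states t I = small-cart {list int ∷ int ∷ list point ∷ input ∷ []} {ρ = W ∷ t ∷ S ∷ I ∷ []} (mapE v2 (mapE v2 (pair v2 v0))) (s≤s z≤n) c≤N
        (_ , _ , bounded S≤c , λ _ _ _ _ → (_ , _ , ≤-trans W≤c c≤N , λ _ _ _ _ → _) , _)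
        (subst (_≤ N) (sym #cells) (bounded S≤c)) cells-length power≤N

      #states : length (states W S) ≤ N
      #states = ≤-trans (cart-length _ cells-length) power≤N

    module _ {E : List State} (E≤N : length E ≤ N) (E≤c : ∀ {H} → H ∈ E → length H ≤ c)
             {X : List Point} (X≤N : length X ≤ N) (bound : 2 * c + length X * (2 * c) ≤ N) where

      rows-bound : ∀ {n} → n ≤ length (sort X) → n * (2 * c) ≤ length X * (2 * c)
      rows-bound le = *-monoˡ-≤ (2 * c) (≤-trans le (≤-reflexive (↭-length (sort-↭ X))))

      small-table : ∀ W t S T → Small N tableE (E ∷ W ∷ t ∷ S ∷ (X , T) ∷ [])
      small-table W t S T =
        small-sort {list state ∷ list int ∷ int ∷ list point ∷ input ∷ []} {E ∷ W ∷ t ∷ S ∷ (X , T) ∷ []} (fst v4) _ X≤N ,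
        (_ , _ , E≤N , λ _ _ _ _ → _) ,
        subst (_≤ N) (sym (↭-length (sort-↭ X))) X≤N ,
        λ zs p as eq → _ , _ , E≤N , λ zs′ H as′ eq′ →
          (_ , small-best {A = list entry} {B = list state} {C = list int} {ρ = S ∷ (X , T) ∷ []} H
                 {foldr (λ H acc → (H , best t p (table t E as) H) ∷ acc) [] as′} p (table t E as)
                 {b = E} {c = W} {t = t} {n = c} {L = length as * (2 * c)}
                 (E≤c (head-∈ zs′ eq′)) (≤-trans (m≤m+n 2 c) c≤N) (≤-trans (^-monoˡ-≤ c (m≤m+n 2 c)) pow)
                 (≤-trans (+-monoʳ-≤ (2 * c) (rows-bound (suffix-≤ zs eq ≤-refl))) bound)
                 (≤-trans (≤-reflexive (table-length t E as)) E≤N) (bounded ≤-refl)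
                 (table-entry t E as E≤c)) , _

      tableE-bounds : ∀ W t S T → let tbl = ⟦ tableE ⟧ (E ∷ W ∷ t ∷ S ∷ (X , T) ∷ []) in
        Output-bounded tbl
      tableE-bounds W t S T = ≤-trans (≤-reflexive (table-length t E (sort X))) E≤N ,
        λ i → let e , s = table-entry t E (sort X) E≤c i in
          bounded e , ≤-trans s (≤-trans (rows-bound ≤-refl) (≤-trans (m≤n+m _ (2 * c)) bound))

    small-output : ∀ (tbl : Table) E W t (S : List Point) I → length S ≤ c →
      Output-bounded tbl →
      Small {list entry ∷ list state ∷ list int ∷ int ∷ list point ∷ input ∷ []} N outputE (tbl ∷ E ∷ W ∷ t ∷ S ∷ I ∷ [])
    small-output tbl E W t S I S≤c (tbl≤N , entries) =
      (_ , _ , bounded S≤c , λ _ _ _ _ → _) ,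
      small-find {state ∷ list entry ∷ list state ∷ list int ∷ int ∷ list point ∷ input ∷ []} {blank S ∷ tbl ∷ E ∷ W ∷ t ∷ S ∷ I ∷ []} v1 v2 _ tbl≤N
        (λ _ _ → _ , ≤-trans (≤-reflexive (trans (cong length (blank-graph S)) (length-map _ S))) (bounded S≤c))
        (λ i → proj₁ (entries i)) ,
      _ , found≤N , λ zs p as eq →
        (_ , _ , ≤-trans (dedup-length as) (suffix-≤ zs eq found≤N) , λ _ _ _ _ → _) , _
      where
      found≤N : length (find tbl (blank S)) ≤ N
      found≤N = find-bound tbl (blank S) (λ i → proj₂ (entries i))

    module _ {X S : List Point} {T : Tree} (S≤c : length S ≤ c) (X≤N : length X ≤ N)
             (bound : 2 * c + length X * (2 * c) ≤ N) where

      small-fromStates : ∀ E W t → length E ≤ N → (∀ {H} → H ∈ E → length H ≤ c) →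
        Small N fromStatesE (E ∷ W ∷ t ∷ S ∷ (X , T) ∷ [])
      small-fromStates E W t E≤N E≤c = small-bind tableE outputE (E ∷ W ∷ t ∷ S ∷ (X , T) ∷ [])
        (small-table {E} E≤N E≤c {X} X≤N bound W t S T)
        λ tbl tbl≡ → small-output tbl E W t S (X , T) S≤c
          (subst Output-bounded (sym tbl≡) (tableE-bounds {E} E≤N E≤c {X} X≤N bound W t S T))

      small-fromLevels : ∀ W t → length W ≤ 2 + c → Small N fromLevelsE (W ∷ t ∷ S ∷ (X , T) ∷ [])
      small-fromLevels W t W≤c = small-bind statesE fromStatesE (W ∷ t ∷ S ∷ (X , T) ∷ [])
        (small-states {S} {W} S≤c W≤c t (X , T))
        λ E E≡ → small-fromStates E W t
          (subst (λ E → length E ≤ N) (sym E≡) (#states {S} {W} S≤c W≤c))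
          (λ {H} i → ≤-trans (≤-reflexive (state-length {W} {S} {H} (subst (H ∈_) E≡ i))) S≤c)

      small-fromTop : ∀ t → Small N fromTopE (t ∷ S ∷ (X , T) ∷ [])
      small-fromTop t = small-bind (levelsE v1) fromLevelsE (t ∷ S ∷ (X , T) ∷ []) (small-levels t S (X , T) S≤c)
        λ W W≡ → small-fromLevels W t (levels-bound S S≤c (cong length W≡))

      opaque
        unfolding solveE

        small-solve : Small N solveE (S ∷ (X , T) ∷ [])
        small-solve = small-bind (lengthE (+ 2) v0) fromTopE (S ∷ (X , T) ∷ [])
          (_ , _ , bounded S≤c , λ _ _ _ _ → _) λ t _ → small-fromTop t

-- A single number above every size that occurs: the `m` rows, the 2 + c levels, the (2 + c)^c
-- states and the at most 2c + 2mc points of a solution. The factor 4 pays for the solutions and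
-- ensures the lower bound 4.
capacity : ℕ → ℕ → ℕ
capacity m c = 4 * (m * (2 + c) ^ (2 + c))

-- For c at least 2, 2 + c is at most 2c and hence at most the square of c. For c = 1 the power of c
-- is 1, so the value 3 ^ 3 = 27 has to become a constant factor.
shifted-power : ∀ c → 1 ≤ c → (2 + c) ^ (2 + c) ≤ 27 * c ^ (4 * c)
shifted-power 1             _ = ≤-refl
shifted-power c@(suc (suc d)) _ = begin
  (2 + c) ^ (2 + c)   ≤⟨ ^-monoʳ-≤ (2 + c) 2+c≤2c ⟩
  (2 + c) ^ (2 * c)   ≤⟨ ^-monoˡ-≤ (2 * c) (≤-trans 2+c≤2c (*-monoˡ-≤ c {2} {c} (s≤s (s≤s z≤n)))) ⟩
  (c * c) ^ (2 * c)   ≡⟨ cong (λ z → (c * z) ^ (2 * c)) (sym (*-identityʳ c)) ⟩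
  (c ^ 2) ^ (2 * c)   ≡⟨ ^-*-assoc c 2 (2 * c) ⟩
  c ^ (2 * (2 * c))   ≡⟨ cong (c ^_) (sym (*-assoc 2 2 c)) ⟩
  c ^ (4 * c)         ≤⟨ m≤n*m (c ^ (4 * c)) 27 ⟩
  27 * c ^ (4 * c)    ∎
  where
  open ≤-Reasoning
  2+c≤2c : 2 + c ≤ 2 * c
  2+c≤2c = ≤-trans (+-monoˡ-≤ c {2} {c} (s≤s (s≤s z≤n))) (≤-reflexive (cong (λ z → c + z) (sym (+-identityʳ c))))

*-power : ∀ m n D → (m * n) ^ D ≡ m ^ D * n ^ D
*-power m n zero    = refl
*-power m n (suc D) = trans (cong (m * n *_) (*-power m n D))
  (+-*-Solver.solve 4 (λ m n p q → m :* n :* (p :* q) := m :* p :* (n :* q)) refl m n (m ^ D) (n ^ D))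
  where
  open +-*-Solver using (_:*_; _:=_)

capacity-power : ∀ m c D → 1 ≤ c → capacity m c ^ D ≤ 108 ^ D * m ^ D * c ^ (4 * D * c)
capacity-power m c D 1≤c = begin
  capacity m c ^ D
    ≤⟨ ^-monoˡ-≤ D (*-monoʳ-≤ 4 (*-monoʳ-≤ m (shifted-power c 1≤c))) ⟩
  (4 * (m * (27 * c ^ (4 * c)))) ^ D
    ≡⟨ cong (_^ D) (+-*-Solver.solve 2 (λ m p → con 4 :* (m :* (con 27 :* p)) := con 108 :* m :* p)
         refl m (c ^ (4 * c))) ⟩
  (108 * m * c ^ (4 * c)) ^ D
    ≡⟨ *-power (108 * m) (c ^ (4 * c)) D ⟩
  (108 * m) ^ D * (c ^ (4 * c)) ^ D
    ≡⟨ cong₂ _*_ (*-power 108 m D) (^-*-assoc c (4 * c) D) ⟩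
  108 ^ D * m ^ D * c ^ (4 * c * D)
    ≡⟨ cong (λ z → 108 ^ D * m ^ D * c ^ z) (+-*-Solver.solve 2 (λ c D → con 4 :* c :* D := con 4 :* D :* c) refl c D) ⟩
  108 ^ D * m ^ D * c ^ (4 * D * c) ∎
  where
  open ≤-Reasoning
  open +-*-Solver using (con; _:*_; _:=_)

module Capacity {m c : ℕ} (1≤m : 1 ≤ m) where

  private
    k = 2 + c
    N = capacity m c

  power≤ : k ^ k ≤ N
  power≤ = ≤-trans (m≤n*m (k ^ k) m {{ℕ.>-nonZero 1≤m}}) (m≤n*m _ 4)

  1≤power′ : 1 ≤ k ^ k
  1≤power′ = m^n>0 k k

  4≤capacity : 4 ≤ N
  4≤capacity = *-monoʳ-≤ 4 (*-mono-≤ 1≤m 1≤power′)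

  m≤capacity : m ≤ N
  m≤capacity = ≤-trans (m≤m*n m (k ^ k) {{ℕ.>-nonZero 1≤power′}}) (m≤n*m _ 4)

  k≤power : k ≤ k ^ k
  k≤power = m≤m*n k (k ^ suc c) {{ℕ.>-nonZero (m^n>0 k (suc c))}}

  k≤capacity : k ≤ N
  k≤capacity = ≤-trans k≤power power≤

  states≤capacity : k ^ c ≤ N
  states≤capacity = ≤-trans (^-monoʳ-≤ k (m≤n+m c 2)) power≤

  solutions≤capacity : 2 * c + m * (2 * c) ≤ N
  solutions≤capacity = begin
    2 * c + m * (2 * c)           ≤⟨ +-monoˡ-≤ (m * (2 * c)) (m≤n*m (2 * c) m {{ℕ.>-nonZero 1≤m}}) ⟩
    m * (2 * c) + m * (2 * c)     ≡⟨ +-*-Solver.solve 2 (λ m c → m :* (con 2 :* c) :+ m :* (con 2 :* c) :=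
                                       con 4 :* (m :* c)) refl m c ⟩
    4 * (m * c)                   ≤⟨ *-monoʳ-≤ 4 (*-monoʳ-≤ m (≤-trans (m≤n+m c 2) k≤power)) ⟩
    N                             ∎
    where
    open ≤-Reasoning
    open +-*-Solver using (con; _:*_; _:+_; _:=_)

-- The algorithm and its guarantees

small-algorithm : ∀ {N c} X T → 2 + c ≤ N → (2 + c) ^ c ≤ N → length X ≤ N → suc (#nodes T) ≤ N →
  2 * c + length X * (2 * c) ≤ N → length (leafStrips X T) ≤ c → Small N algorithmE ((X , T) ∷ [])
small-algorithm {N} {c} X T c≤N pow X≤N T≤N bound S≤c =
  small-bind (leafStripsE (fst v0) (snd v0)) solveE ((X , T) ∷ []) (small-leafStrips X T X≤N T≤N)
    λ S S≡ → small-solve c≤N pow {X} {S} {T}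
      (subst (λ S → length S ≤ c) (sym (trans S≡ (leafStripsE-value X T))) S≤c) X≤N bound
  where open Smallness {N}

-- The program enters only through its value and its smallness, so its large normal form takes no
-- part in the argument.
module Analysis (t : Expr (input ∷ []) (list point))
  (value : ∀ X T → ⟦ t ⟧ ((X , T) ∷ []) ≡ solve X (leafStrips X T))
  (small : ∀ {N c : ℕ} X T → 2 + c ≤ N → (2 + c) ^ c ≤ N → length X ≤ N → suc (#nodes T) ≤ N →
    2 * c + length X * (2 * c) ≤ N → length (leafStrips X T) ≤ c → Small N t ((X , T) ∷ []))
  where

  private
    d = degree t

  module _ {X : PointList} {lo hi : ℤ} {T : Tree} (uX : Unique X) (even : All IntegerPoint X) (semi : SemiPermutation X)
           (box : BoundingStrip X lo hi) (part : Partitions X lo hi T) where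

    open Correctness uX even semi box part
    open Capacity {length X} {#columns X} (∈-length (proj₁ (proj₂ (proj₁ box))))

    solved : output (compile t) (X , T) ≡ solve X (strips lo hi T)
    solved = trans (output-value t (X , T)) (trans (value X T) (cong (solve X) (leafStrips-correct T box)))

    nodes≤columns : suc (#nodes T) ≤ #columns X
    nodes≤columns = ≤-trans (≤-reflexive (nodes-strips lo hi T)) (strips-length even part lo≤hi)

    solved-in-time : time (compile t) (X , T) ≤
                     108 ^ d * length X ^ d * #columns X ^ (4 * d * #columns X)
    solved-in-time = ≤-trans
      (time-bound 4≤capacity t (X , T) (small X T k≤capacity states≤capacity m≤capacity
        (≤-trans nodes≤columns (≤-trans (m≤n+m (#columns X) 2) k≤capacity)) solutions≤capacity
        (subst (λ S → length S ≤ #columns X) (sym (leafStrips-correct T box)) (strips-length even part lo≤hi))))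
      (capacity-power (length X) (#columns X) d (≤-trans (s≤s z≤n) nodes≤columns))

    analysis : Feasible X (output (compile t) (X , T)) ×
      Special X lo hi T (output (compile t) (X , T)) ×
      ((opt : ℕ) → IsOpt X opt → length (output (compile t) (X , T)) ≤ 2 * length X + 2 * opt) ×
      time (compile t) (X , T) ≤ 108 ^ d * length X ^ d * #columns X ^ (4 * d * #columns X)
    analysis =
      subst (Feasible X) (sym solved) solve-feasible ,
      subst (Special X lo hi T) (sym solved) solve-special ,
      (λ n isOpt → subst (λ z → length z ≤ 2 * length X + 2 * n) (sym solved) (solve-cost isOpt)) ,
      solved-in-time

  algorithm : Σ[ A ∈ Algorithm (list point ⊗ tree) (list point) ]
      ∃[ K ] ∃[ a ] ∃[ b ]
      ((X : PointList) (lo hi : ℤ) (T : Tree) →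
      Unique X → All IntegerPoint X → SemiPermutation X → ReducedForm X →
      PartitioningTree X lo hi T →
      Feasible X (output A (X , T)) ×
      Special X lo hi T (output A (X , T)) ×
      ((opt : ℕ) → IsOpt X opt → length (output A (X , T)) ≤ 2 * length X + 2 * opt) ×
      time A (X , T) ≤ K * length X ^ a * #columns X ^ (b * #columns X))
  algorithm = compile t , 108 ^ d , d , 4 * d ,
    λ X lo hi T uX even semi _ (box , part) → analysis uX even semi box part

theorem6p6 : Σ[ A ∈ Algorithm (list point ⊗ tree) (list point) ]
    ∃[ K ] ∃[ a ] ∃[ b ]
    ((X : PointList) (lo hi : ℤ) (T : Tree) →
    Unique X → All IntegerPoint X → SemiPermutation X → ReducedForm X →
    PartitioningTree X lo hi T →
    Feasible X (output A (X , T)) ×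
    Special X lo hi T (output A (X , T)) ×
    ((opt : ℕ) → IsOpt X opt → length (output A (X , T)) ≤ 2 * length X + 2 * opt) ×
    time A (X , T) ≤ K * length X ^ a * #columns X ^ (b * #columns X))
theorem6p6 = Analysis.algorithm algorithmE algorithmE-value small-algorithm
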